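{- Every critically $k$-frustrated signed graph $(G,\sigma)$ with no $(K_5,-)$-minor has a negative cycle double cover consisting of exactly $2k$ negative cycles.
   Context: A signed graph $(G,\sigma)$ is a finite graph $G$ (loops and multiple edges allowed) with $\sigma:E(G)\to\{+,-\}$; a cycle is negative if it has an odd number of negative edges. Switching at a vertex $v$ multiplies the signs of all edges at $v$ by $-$. The frustration index $\ell(G,\sigma)$ is the minimum number of negative edges over all signatures obtained from $\sigma$ by switchings; $(G,\sigma)$ is critically $k$-frustrated if $\ell(G,\sigma)=k$ and $\ell(G-e,\sigma)=k-1$ for every edge $e$. A signed graph $(H,\pi)$ is a minor of $(G,\sigma)$ if it is obtained from $(G,\sigma)$ by a sequence of vertex deletions, edge deletions, contractions of positive edges, and switchings. $(K_5,-)$ is $K_5$ with all edges negative. A negative cycle double cover of $(G,\sigma)$ is a collection $\mathcal{C}$ of negative cycles of $(G,\sigma)$ such that every edge of $G$ belongs to exactly two cycles of $\mathcal{C}$; its order is $|\mathcal{C}|$. -}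

module Defs where

open import Data.Nat using (ℕ; zero; suc; _+_; _*_; _≤_; _%_; _<?_)
open import Data.Bool using (Bool; true; false; _xor_; _∧_)
open import Data.Fin using (Fin; zero; suc; toℕ; fromℕ<; punchIn; punchOut; _≟_)
open import Data.Product using (Σ; _×_; _,_; proj₁; proj₂; ∃)
open import Data.Sum using (_⊎_)
open import Relation.Binary.PropositionalEquality using (_≡_; _≢_; sym)
open import Relation.Nullary using (¬_; yes; no)
open import Function using (_∘_; _⇔_)
open import Function.Definitions using (Injective)

-- A signed graph with vertex set Fin n and edge set Fin m.
-- Loops (ends e = (v , v)) and parallel edges are allowed.
-- neg e ≡ true means that edge e is negative.
record SG (n m : ℕ) : Set where
  field
    ends : Fin m → Fin n × Fin n
    neg  : Fin m → Bool
open SG public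

countTrue : ∀ {m} → (Fin m → Bool) → ℕ
countTrue {zero}  f = 0
countTrue {suc m} f with f zero
... | true  = suc (countTrue (f ∘ suc))
... | false = countTrue (f ∘ suc)

numNeg : ∀ {n m} → SG n m → ℕ
numNeg G = countTrue (neg G)

Joins : ∀ {n m} → SG n m → Fin m → Fin n → Fin n → Set
Joins G e u v = (ends G e ≡ (u , v)) ⊎ (ends G e ≡ (v , u))

-- switching at the vertex set X (X v ≡ true: switch at v).
-- Loops keep their sign (both ends are switched).
switch : ∀ {n m} → (Fin n → Bool) → SG n m → SG n m
switch X G = record
  { ends = ends G
  ; neg  = λ e → (neg G e xor X (proj₁ (ends G e))) xor X (proj₂ (ends G e)) }

Frustration : ∀ {n m} → SG n m → ℕ → Set
Frustration G k =
  (Σ (_ → Bool) λ X → numNeg (switch X G) ≡ k) × (∀ X → k ≤ numNeg (switch X G))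

deleteEdge : ∀ {n m} → SG n (suc m) → Fin (suc m) → SG n m
deleteEdge G e = record { ends = ends G ∘ punchIn e ; neg = neg G ∘ punchIn e }

-- critically k-frustrated: ℓ(G) = k and ℓ(G - e) = k - 1 for every edge e
-- (k - 1 is an honest predecessor: suc j ≡ k)
Critical : ∀ {n m} → SG n m → ℕ → Set
Critical {m = zero}  G k = Frustration G k
Critical {m = suc m} G k =
  Frustration G k × (∀ e → Σ ℕ λ j → (suc j ≡ k) × Frustration (deleteEdge G e) j)

deleteIsolated : ∀ {n m} → (G : SG (suc n) m) → (v : Fin (suc n))
  → (p : ∀ e → v ≢ proj₁ (ends G e)) → (q : ∀ e → v ≢ proj₂ (ends G e)) → SG n m
deleteIsolated G v p q = record
  { ends = λ e → punchOut (p e) , punchOut (q e) ; neg = neg G }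

merge : ∀ {n} → (u v : Fin (suc n)) → u ≢ v → Fin (suc n) → Fin n
merge u v u≢v w with v ≟ w
... | yes _   = punchOut {i = v} {j = u} (λ eq → u≢v (sym eq))
... | no v≢w = punchOut v≢w

-- contraction of the non-loop edge e with ends (u , v): delete e, merge v into u
-- (parallel edges become loops). Contraction of a loop is the same as deleting it.
contract : ∀ {n m} → (G : SG (suc n) (suc m)) → (e : Fin (suc m))
  → proj₁ (ends G e) ≢ proj₂ (ends G e) → SG n m
contract G e ne = record
  { ends = λ f → mrg (proj₁ (ends G (punchIn e f))) , mrg (proj₂ (ends G (punchIn e f)))
  ; neg  = neg G ∘ punchIn e }
  where
    mrg = merge (proj₁ (ends G e)) (proj₂ (ends G e)) ne

data Step : ∀ {n m n' m'} → SG n m → SG n' m' → Set where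
  bySwitch  : ∀ {n m} (G : SG n m) (X : Fin n → Bool) → Step G (switch X G)
  byDelEdge : ∀ {n m} (G : SG n (suc m)) (e : Fin (suc m)) → Step G (deleteEdge G e)
  byDelVertex : ∀ {n m} (G : SG (suc n) m) (v : Fin (suc n))
    (p : ∀ e → v ≢ proj₁ (ends G e)) (q : ∀ e → v ≢ proj₂ (ends G e))
    → Step G (deleteIsolated G v p q)
  byContract : ∀ {n m} (G : SG (suc n) (suc m)) (e : Fin (suc m))
    (ne : proj₁ (ends G e) ≢ proj₂ (ends G e)) → neg G e ≡ false
    → Step G (contract G e ne)

-- Minor G H : H is obtained from G by a finite sequence of switchings,
-- edge deletions, vertex deletions and contractions of positive edges.
-- (Deleting a vertex = deleting its incident edges and then the isolated vertex.)
data Minor : ∀ {n m n' m'} → SG n m → SG n' m' → Set where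
  done : ∀ {n m} {G : SG n m} → Minor G G
  step : ∀ {n m n₁ m₁ n' m'} {G : SG n m} {G₁ : SG n₁ m₁} {H : SG n' m'}
    → Step G G₁ → Minor G₁ H → Minor G H

IsK5Neg : ∀ {n m} → SG n m → Set
IsK5Neg {n} {m} H =
  (n ≡ 5)
  × (∀ e → proj₁ (ends H e) ≢ proj₂ (ends H e))
  × (∀ e → neg H e ≡ true)
  × (∀ u v → u ≢ v → Σ (Fin m) λ e → Joins H e u v)
  × (∀ u v e f → Joins H e u v → Joins H f u v → e ≡ f)

HasK5NegMinor : ∀ {n m} → SG n m → Set
HasK5NegMinor G = Σ ℕ λ n' → Σ ℕ λ m' → Σ (SG n' m') λ H → Minor G H × IsK5Neg H

next : ∀ {l} → Fin (suc l) → Fin (suc l)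
next {l} i with suc (toℕ i) <? suc l
... | yes p = fromℕ< p
... | no _  = zero

-- S ⊆ E(G) (as indicator) is the edge set of a cycle: there are l ≥ 1, distinct
-- vertices v₀ … v_{l-1} and distinct edges e₀ … e_{l-1}, e_i joining v_i and v_{i+1 mod l},
-- with S = {e₀,…,e_{l-1}}.  (Length 1: a loop; length 2: two parallel edges.)
IsCycle : ∀ {n m} → SG n m → (Fin m → Bool) → Set
IsCycle {n} {m} G S =
  Σ ℕ λ l → Σ (Fin (suc l) → Fin n) λ vs → Σ (Fin (suc l) → Fin m) λ es →
    Injective _≡_ _≡_ vs × Injective _≡_ _≡_ es
    × (∀ i → Joins G (es i) (vs i) (vs (next i)))
    × (∀ e → (S e ≡ true) ⇔ (Σ (Fin (suc l)) λ i → es i ≡ e))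

IsNegative : ∀ {n m} → SG n m → (Fin m → Bool) → Set
IsNegative G S = countTrue (λ e → S e ∧ neg G e) % 2 ≡ 1

-- a negative cycle double cover of order t (a family, repetitions allowed)
NegCycleDoubleCover : ∀ {n m} → SG n m → (t : ℕ) → (Fin t → Fin m → Bool) → Set
NegCycleDoubleCover {n} {m} G t C =
  (∀ i → IsCycle G (C i) × IsNegative G (C i))
  × (∀ (e : Fin m) → countTrue (λ i → C i e) ≡ 2)

{-# OPTIONS --safe #-}
module Submission where

-- The heart is the theorem of Geelen and Guenin: if edge weights w have all signatures of the same
-- parity, every signature has weight at least t ≡ w mod 2 and there is no (K₅,−)-minor, then t odd
-- closed walks fit into w. Applied to w = 2 and t = 2k it gives 2k negative cycles covering each edge
-- at most twice, and criticality (each edge lies in a minimum signature) makes this exactly twice.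
--
-- Proof of the packing theorem, by induction on t and then on the deficit Σ (t ∸ w f). For an edge
-- e = uv with 0 < w e < t a packing in w + 2e exists; unless it can be repaired it contains three odd
-- walks e P₁, e P₂, e P₃ and t − 3 further walks. Removing e P from w, for a path P of any
-- redistribution of P₁, P₂, P₃ into three paths, one finds by induction either a packing or a
-- signature that is tight on the t − 3 walks and negative on the paths only inside P. After
-- switching, all paths are positive, e is negative, and a tight signature is a vertex set disjoint
-- from u, v. Call a vertex set dependent if it contains the trace of a tight signature on the paths.
-- Sweeping the paths from v to u one finds a connected U ∋ u and V ∋ v, an independent J, and three
-- connected sets Xᵢ adjacent to both U and V such that every Xᵢ ∪ J is dependent. Uncrossing two
-- tight signatures shows that Xᵢ and Xⱼ are linked through odd paths, and these are absorbed to give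
-- (K₅,−).
open import Defs
open import Data.Nat as ℕ using (ℕ; zero; suc; _+_; _*_; _∸_; _≤_; _<_; s≤s; z≤n; _%_)
import Data.Nat.Properties as ℕₚ
open import Data.Nat.DivMod using ([m+n]%n≡m%n)
open import Data.Nat.Tactic.RingSolver using (solve-∀)
open import Data.Bool using (Bool; true; false; _xor_; not; if_then_else_; _∧_)
open import Data.Bool.Properties using (xor-identityʳ; xor-assoc; xor-comm; xor-same; ¬-not; not-involutive)
open import Data.Bool.Solver using (module xor-∧-Solver)
open xor-∧-Solver using (solve; _:+_; _:=_; con)
open import Data.Fin as Fin using (Fin; zero; suc; _≟_; toℕ; fromℕ; fromℕ<; inject₁; punchIn; punchOut)
open import Data.Fin.Patterns using (0F; 1F; 2F; 3F; 4F)
open import Data.Fin.Properties using (any?; all?; punchIn-punchOut; punchOut-punchIn; punchOut-injective; punchOut-cong; punchInᵢ≢i; <-irrelevant; <-cmp; <⇒≢; <-asym; _<?_; injective⇒≤; toℕ-fromℕ<; toℕ-inject₁; toℕ-injective; toℕ<n; toℕ-fromℕ)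
open import Data.Fin.Subset.Properties using (anySubset?)
open import Data.List using (List; []; _∷_; _++_; length; reverse; _ʳ++_; filter; allFin; replicate)
open import Data.List.Properties using (ʳ++-defn; ++-assoc; ++-identityʳ; reverse-involutive; filter-notAll; length-replicate; ∷-injective)
open import Data.List.Relation.Unary.All as All using (All; []; _∷_)
import Data.List.Relation.Unary.All.Properties as Allₚ
open import Data.List.Relation.Unary.AllPairs using ([]; _∷_)
open import Data.List.Relation.Unary.Any as Any using (here; there)
import Data.List.Relation.Unary.Any.Properties as Anyₚ
open import Data.List.Relation.Unary.Unique.Propositional using (Unique)
open import Data.List.Membership.Propositional using (_∈_; _∉_; find; lose)
open import Data.List.Membership.Propositional.Properties using (∈-∃++; ∈-++⁺ˡ; ∈-++⁺ʳ; ∈-filter⁺; ∈-filter⁻; ∈-allFin)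
import Data.List.Membership.DecPropositional as DecMembership
open import Data.Maybe using (Maybe; just; nothing)
open import Data.Maybe.Properties using (just-injective) renaming (≡-dec to maybe-≡-dec)
open import Data.Product using (Σ; _×_; _,_; proj₁; proj₂; ∃)
open import Data.Product.Properties using (,-injectiveˡ; ,-injectiveʳ) renaming (≡-dec to pair-≡-dec)
open import Data.Sum using (_⊎_; inj₁; inj₂)
open import Data.Unit using (⊤; tt)
open import Data.Empty using (⊥; ⊥-elim)
open import Data.Vec using (lookup; tabulate)
open import Data.Vec.Properties using (lookup∘tabulate)
open import Relation.Binary.PropositionalEquality using (_≡_; _≢_; _≗_; refl; sym; trans; cong; cong₂; subst; subst₂; module ≡-Reasoning)
open import Relation.Binary.Definitions using (tri<; tri≈; tri>)
open import Relation.Binary.Construct.Closure.ReflexiveTransitive as Star using (Star; ε; _◅_; _◅◅_)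
open import Relation.Nullary using (¬_; Dec; yes; no; does)
open import Relation.Nullary.Decidable using (_×-dec_; _⊎-dec_; _→-dec_; ¬?; map′; decidable-stable; toWitness)
open import Function using (_∘_; case_of_; _⇔_; mk⇔)

-- From a K₅-model to a minor

-- Passing from `w` to `w + 2e` keeps the parity condition, and a packing there overuses `e` by at
-- most two copies. Two surplus copies together with `0 < w e` are what produce three walks through
-- `e`, and three is the number of middle classes that `(K₅,−)` needs beside those of `u` and `v`.
--
-- The obstacle is that neither the three paths nor the odd connections between the middle classes
-- are disjoint. The paths may exchange tails at common vertices; if their total length cannot be
-- lowered, no cyclic precedence among their vertices is possible, so they can be swept in one
-- common order. For the connections, three tight signatures colour a vertex outside the classes by
-- the signature that disagrees with the other two. This colour makes up for the missing
-- disjointness: it tells which class may absorb the vertex, and whether the vertex has to be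
-- switched for it.

Adj : ∀ {n m} → SG n m → Bool → Fin n → Fin n → Set
Adj G s a b = ∃ λ f → Joins G f a b × neg G f ≡ s

Adj-sym : ∀ {n m} (G : SG n m) {s a b} → Adj G s a b → Adj G s b a
Adj-sym G (f , inj₁ p , q) = f , inj₂ p , q
Adj-sym G (f , inj₂ p , q) = f , inj₁ p , q

Inside : ∀ {n m} {C : Set} → SG n m → (Fin n → C) → C → Fin n → Fin n → Set
Inside G L c a b = Adj G false a b × L a ≡ c × L b ≡ c

-- The signature is prepared beforehand: positive edges connect each class and negative edges join
-- the classes, so all contractions can be done without further switching. Vertices of class
-- `nothing` are discarded in the end.
record K5Model {n m} (G : SG n m) : Set where
  field
    class : Fin n → Maybe (Fin 5)
    root  : Fin 5 → Fin n
    root-class : ∀ i → class (root i) ≡ just i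
    connected  : ∀ i a → class a ≡ just i → Star (Inside G class (just i)) (root i) a
    crossing   : ∀ i j → i ≢ j → ∃ λ a → ∃ λ b → class a ≡ just i × class b ≡ just j × Adj G true a b

-- Asking for an edge only when `i < j` selects ten edges. With one edge per ordered pair, two
-- parallel edges might be chosen for the same pair, against the last clause of `IsK5Neg`.
record K5Subgraph {n m} (G : SG n m) : Set where
  field
    vertex : Fin 5 → Fin n
    vertex-injective : ∀ {i j} → vertex i ≡ vertex j → i ≡ j
    edge : ∀ {i j} → i Fin.< j → Fin m
    edge-joins : ∀ {i j} (lt : i Fin.< j) → Joins G (edge lt) (vertex i) (vertex j)
    edge-neg   : ∀ {i j} (lt : i Fin.< j) → neg G (edge lt) ≡ true

  Chosen : Fin m → Set
  Chosen f = ∃ λ i → ∃ λ j → Σ (i Fin.< j) λ lt → edge lt ≡ f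

  chosen? : ∀ f → Dec (Chosen f)
  chosen? f = any? λ i → any? λ j → pair? i j
    where
    pair? : ∀ i j → Dec (Σ (i Fin.< j) λ lt → edge lt ≡ f)
    pair? i j with i <? j
    ... | no ¬lt = no λ (lt , _) → ¬lt lt
    ... | yes lt = map′ (lt ,_) (λ (lt' , p) → trans (cong edge (<-irrelevant lt lt')) p) (edge lt ≟ f)

hasK5-step : ∀ {n m n' m'} {G : SG n m} {G' : SG n' m'} → Step G G' → HasK5NegMinor G' → HasK5NegMinor G
hasK5-step s (n , m , H , M , K) = n , m , H , step s M , K

joins-ends : ∀ {n m} (G : SG n m) {f a b c d} → Joins G f a b → Joins G f c d → (a ≡ c × b ≡ d) ⊎ (a ≡ d × b ≡ c)
joins-ends G (inj₁ p) (inj₁ q) = let r = trans (sym p) q in inj₁ (,-injectiveˡ r , ,-injectiveʳ r)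
joins-ends G (inj₁ p) (inj₂ q) = let r = trans (sym p) q in inj₂ (,-injectiveˡ r , ,-injectiveʳ r)
joins-ends G (inj₂ p) (inj₁ q) = let r = trans (sym p) q in inj₂ (,-injectiveʳ r , ,-injectiveˡ r)
joins-ends G (inj₂ p) (inj₂ q) = let r = trans (sym p) q in inj₁ (,-injectiveʳ r , ,-injectiveˡ r)

module _ {n m} (G : SG n m) (K : K5Subgraph G) where
  open K5Subgraph K

  exact-isK5 : (∀ f → Chosen f) → (∀ a → ∃ λ i → vertex i ≡ a) → IsK5Neg G
  exact-isK5 allChosen onto = n≡5 , noLoop , allNeg , joined , unique
    where
    onto-injective : ∀ {a b} → proj₁ (onto a) ≡ proj₁ (onto b) → a ≡ b
    onto-injective {a} {b} p = trans (sym (proj₂ (onto a))) (trans (cong vertex p) (proj₂ (onto b)))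
    n≡5 = ℕₚ.≤-antisym (injective⇒≤ onto-injective) (injective⇒≤ vertex-injective)
    allNeg : ∀ f → neg G f ≡ true
    allNeg f with allChosen f
    ... | i , j , lt , refl = edge-neg lt
    noLoop : ∀ f → proj₁ (ends G f) ≢ proj₂ (ends G f)
    noLoop f p with allChosen f
    ... | i , j , lt , refl with edge-joins lt
    ... | inj₁ q = <⇒≢ lt (vertex-injective (trans (sym (cong proj₁ q)) (trans p (cong proj₂ q))))
    ... | inj₂ q = <⇒≢ lt (vertex-injective (trans (sym (cong proj₂ q)) (trans (sym p) (cong proj₁ q))))
    joined : ∀ a b → a ≢ b → Σ (Fin m) λ f → Joins G f a b
    joined a b a≢b with onto a | onto b
    ... | i , refl | j , refl with <-cmp i j
    ... | tri< lt _ _ = edge lt , edge-joins lt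
    ... | tri≈ _ refl _ = ⊥-elim (a≢b refl)
    ... | tri> _ _ gt with edge-joins gt
    ... | inj₁ q = edge gt , inj₂ q
    ... | inj₂ q = edge gt , inj₁ q
    sameEdge : ∀ {i j k l} (p : i Fin.< j) (q : k Fin.< l) → i ≡ k → j ≡ l → edge p ≡ edge q
    sameEdge p q refl refl = cong edge (<-irrelevant p q)
    unique : ∀ a b f g → Joins G f a b → Joins G g a b → f ≡ g
    unique a b f g jf jg with allChosen f | allChosen g
    ... | i , j , lt , refl | k , l , lt' , refl
      with joins-ends G jf (edge-joins lt) | joins-ends G jg (edge-joins lt')
    ... | inj₁ (p , q) | inj₁ (p' , q') =
      sameEdge lt lt' (vertex-injective (trans (sym p) p')) (vertex-injective (trans (sym q) q'))
    ... | inj₂ (p , q) | inj₂ (p' , q') =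
      sameEdge lt lt' (vertex-injective (trans (sym q) q')) (vertex-injective (trans (sym p) p'))
    ... | inj₁ (p , q) | inj₂ (p' , q')
      with vertex-injective (trans (sym p) p') | vertex-injective (trans (sym q) q')
    ... | refl | refl = ⊥-elim (<-asym lt lt')
    unique a b f g jf jg | i , j , lt , refl | k , l , lt' , refl | inj₂ (p , q) | inj₁ (p' , q')
      with vertex-injective (trans (sym p) p') | vertex-injective (trans (sym q) q')
    ... | refl | refl = ⊥-elim (<-asym lt lt')

dropVertices : ∀ {n m} (G : SG n m) (K : K5Subgraph G) → (∀ f → K5Subgraph.Chosen K f) → HasK5NegMinor G
dropVertices {zero} G K allChosen with K5Subgraph.vertex K zero
... | ()
dropVertices {suc n} {m} G K allChosen with all? (λ a → any? λ i → K5Subgraph.vertex K i ≟ a)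
... | yes onto = _ , _ , G , done , exact-isK5 G K allChosen onto
... | no ¬onto = hasK5-step (byDelVertex G a away₁ away₂) (dropVertices G' K' allChosen')
  where
  open K5Subgraph K
  missed : ∃ λ a → ¬ ∃ λ i → vertex i ≡ a
  missed = decidable-stable (any? λ a → ¬? (any? λ i → vertex i ≟ a))
    λ none → ¬onto λ a → decidable-stable (any? λ i → vertex i ≟ a) λ na → none (a , na)
  a = proj₁ missed
  a≢ : ∀ i → a ≢ vertex i
  a≢ i p = proj₂ missed (i , sym p)
  away₁ : ∀ f → a ≢ proj₁ (ends G f)
  away₁ f p with allChosen f
  ... | i , j , lt , refl with edge-joins lt
  ... | inj₁ q = a≢ i (trans p (cong proj₁ q))
  ... | inj₂ q = a≢ j (trans p (cong proj₁ q))
  away₂ : ∀ f → a ≢ proj₂ (ends G f)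
  away₂ f p with allChosen f
  ... | i , j , lt , refl with edge-joins lt
  ... | inj₁ q = a≢ j (trans p (cong proj₂ q))
  ... | inj₂ q = a≢ i (trans p (cong proj₂ q))
  G' = deleteIsolated G a away₁ away₂
  out : ∀ {b c} (p : a ≢ b) (q : a ≢ c) → b ≡ c → punchOut p ≡ punchOut q
  out p q refl = punchOut-cong a refl
  joins' : ∀ {i j f} → Joins G f (vertex i) (vertex j) → Joins G' f (punchOut (a≢ i)) (punchOut (a≢ j))
  joins' (inj₁ q) = inj₁ (cong₂ _,_ (out _ _ (cong proj₁ q)) (out _ _ (cong proj₂ q)))
  joins' (inj₂ q) = inj₂ (cong₂ _,_ (out _ _ (cong proj₁ q)) (out _ _ (cong proj₂ q)))
  K' : K5Subgraph G'
  K' = record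
    { vertex = λ i → punchOut (a≢ i)
    ; vertex-injective = λ {i} {j} p → vertex-injective (punchOut-injective (a≢ i) (a≢ j) p)
    ; edge = edge
    ; edge-joins = λ lt → joins' (edge-joins lt)
    ; edge-neg = edge-neg }
  allChosen' : ∀ f → K5Subgraph.Chosen K' f
  allChosen' f = allChosen f

dropEdges : ∀ {n m} (G : SG n m) → K5Subgraph G → HasK5NegMinor G
dropEdges {n} {m} G K with all? (K5Subgraph.chosen? K)
... | yes allChosen = dropVertices G K allChosen
dropEdges {n} {zero}  G K | no ¬all = ⊥-elim (¬all λ ())
dropEdges {n} {suc m} G K | no ¬all = hasK5-step (byDelEdge G f) (dropEdges G' K')
  where
  open K5Subgraph K
  missed : ∃ λ f → ¬ Chosen f
  missed = decidable-stable (any? λ f → ¬? (chosen? f))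
    λ none → ¬all λ f → decidable-stable (chosen? f) λ nf → none (f , nf)
  f = proj₁ missed
  f≢ : ∀ {i j} (lt : i Fin.< j) → f ≢ edge lt
  f≢ lt p = proj₂ missed (_ , _ , lt , sym p)
  G' = deleteEdge G f
  back : ∀ {i j} (lt : i Fin.< j) → punchIn f (punchOut (f≢ lt)) ≡ edge lt
  back lt = punchIn-punchOut (f≢ lt)
  K' : K5Subgraph G'
  K' = record
    { vertex = vertex
    ; vertex-injective = vertex-injective
    ; edge = λ lt → punchOut (f≢ lt)
    ; edge-joins = λ lt → subst (λ g → Joins G g _ _) (sym (back lt)) (edge-joins lt)
    ; edge-neg = λ lt → trans (cong (neg G) (back lt)) (edge-neg lt) }

-- If no positive edge joins two different vertices of a class, connectedness leaves only its root,
-- so the negative crossing edges already join the roots.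
singletonClasses : ∀ {n m} (G : SG n m) (M : K5Model G) → let open K5Model M in
  (∀ i a b → Inside G class (just i) a b → a ≡ b) → K5Subgraph G
singletonClasses G M collapse = record
  { vertex = root
  ; vertex-injective = λ {i} {j} p → just-injective (trans (sym (root-class i)) (trans (cong class p) (root-class j)))
  ; edge = λ lt → proj₁ (cross lt)
  ; edge-joins = λ lt → proj₁ (proj₂ (cross lt))
  ; edge-neg = λ lt → proj₂ (proj₂ (cross lt)) }
  where
  open K5Model M
  collapse* : ∀ i {a b} → Star (Inside G class (just i)) a b → a ≡ b
  collapse* i ε = refl
  collapse* i (s ◅ w) = trans (collapse i _ _ s) (collapse* i w)
  cross : ∀ {i j} → i Fin.< j → Adj G true (root i) (root j)
  cross {i} {j} lt with crossing i j (<⇒≢ lt)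
  ... | a , b , p , q , r with collapse* i (connected i a p) | collapse* j (connected j b q)
  ... | refl | refl = r

module _ {n m} (G : SG (suc n) (suc m)) (M : K5Model G) (e : Fin (suc m)) where
  open K5Model M
  private
    s = proj₁ (ends G e)
    t = proj₂ (ends G e)

  module _ (s≢t : s ≢ t) (same : class s ≡ class t) (pos : neg G e ≡ false) where
    private
      G' = contract G e s≢t
      mrg = merge s t s≢t
      class' : Fin n → Maybe (Fin 5)
      class' = class ∘ punchIn t

      merge-class : ∀ a → class' (mrg a) ≡ class a
      merge-class a with t ≟ a
      ... | yes refl = trans (cong class (punchIn-punchOut {i = t} {j = s} (λ eq → s≢t (sym eq)))) same
      ... | no t≢a = cong class (punchIn-punchOut t≢a)

      merge-punchIn : ∀ b → mrg (punchIn t b) ≡ b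
      merge-punchIn b with t ≟ punchIn t b
      ... | yes p = ⊥-elim (punchInᵢ≢i t b (sym p))
      ... | no q = punchOut-punchIn t

      merge-ends : mrg s ≡ mrg t
      merge-ends with t ≟ s | t ≟ t
      ... | yes p | _ = ⊥-elim (s≢t (sym p))
      ... | no _ | no q = ⊥-elim (q refl)
      ... | no p | yes _ = punchOut-cong t refl

      joins' : ∀ {f a b} → Joins G (punchIn e f) a b → Joins G' f (mrg a) (mrg b)
      joins' (inj₁ q) = inj₁ (cong₂ _,_ (cong mrg (cong proj₁ q)) (cong mrg (cong proj₂ q)))
      joins' (inj₂ q) = inj₂ (cong₂ _,_ (cong mrg (cong proj₁ q)) (cong mrg (cong proj₂ q)))

      -- An adjacency can be lost only to the contracted edge itself, which is positive. So negative
      -- crossings survive, and a step of a positive walk at worst becomes trivial.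
      adj' : ∀ {σ a b} → Adj G σ a b → mrg a ≡ mrg b × σ ≡ false ⊎ Adj G' σ (mrg a) (mrg b)
      adj' {σ} {a} {b} (f , j , q) with e ≟ f
      ... | yes refl = inj₁ (lem j , trans (sym q) pos)
        where
        lem : Joins G e a b → mrg a ≡ mrg b
        lem (inj₁ r) = trans (cong mrg (sym (cong proj₁ r))) (trans merge-ends (cong mrg (cong proj₂ r)))
        lem (inj₂ r) = trans (cong mrg (sym (cong proj₂ r))) (trans (sym merge-ends) (cong mrg (cong proj₁ r)))
      ... | no e≢f = inj₂ (punchOut e≢f , joins' (subst (λ g → Joins G g a b) (sym (punchIn-punchOut e≢f)) j)
                           , trans (cong (neg G) (punchIn-punchOut e≢f)) q)

      walk' : ∀ i {a b} → Star (Inside G class (just i)) a b → Star (Inside G' class' (just i)) (mrg a) (mrg b)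
      walk' i ε = ε
      walk' i (_◅_ {j = c} (adj , p , q) w) with adj' adj
      ... | inj₁ (r , _) = subst (λ x → Star _ x _) (sym r) (walk' i w)
      ... | inj₂ r = (r , trans (merge-class _) p , trans (merge-class c) q) ◅ walk' i w

    contractModel : K5Model G'
    contractModel = record
      { class = class'
      ; root = mrg ∘ root
      ; root-class = λ i → trans (merge-class (root i)) (root-class i)
      ; connected = λ i a p → subst (Star _ _) (merge-punchIn a) (walk' i (connected i (punchIn t a) p))
      ; crossing = cross' }
      where
      cross' : ∀ i j → i ≢ j → ∃ λ a → ∃ λ b → class' a ≡ just i × class' b ≡ just j × Adj G' true a b
      cross' i j i≢j with crossing i j i≢j
      ... | a , b , p , q , r with adj' r
      ... | inj₁ (_ , ())
      ... | inj₂ r' = mrg a , mrg b , trans (merge-class a) p , trans (merge-class b) q , r'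

-- Each contraction removes a vertex. Equality of classes at the two ends, `nothing` included, is
-- what makes the class of the merged vertex well defined.
K5Model⇒minor : ∀ n {m} (G : SG n m) → K5Model G → HasK5NegMinor G
K5Model⇒minor zero G M with K5Model.root M zero
... | ()
K5Model⇒minor (suc n) {zero} G M with K5Model.crossing M zero (suc zero) (λ ())
... | _ , _ , _ , _ , () , _
K5Model⇒minor (suc n) {suc m} G M with any? contractible?
  where
  open K5Model M
  contractible? : (e : Fin (suc m)) → Dec (proj₁ (ends G e) ≢ proj₂ (ends G e) × class (proj₁ (ends G e)) ≡ class (proj₂ (ends G e)) × neg G e ≡ false)
  contractible? e = ¬? (_ ≟ _) ×-dec (maybe-≡-dec _≟_ _ _ ×-dec (_ Data.Bool.≟ _))
... | yes (e , s≢t , same , pos) =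
  hasK5-step (byContract G e s≢t pos) (K5Model⇒minor n _ (contractModel G M e s≢t same pos))
... | no none = dropEdges G (singletonClasses G M collapse)
  where
  open K5Model M
  collapse : ∀ i a b → Inside G class (just i) a b → a ≡ b
  collapse i a b ((e , j , pos) , p , q) = decidable-stable (a ≟ b) λ a≢b → none (e , lem j a≢b)
    where
    lem : Joins G e a b → a ≢ b → _
    lem (inj₁ r) a≢b = (λ s → a≢b (trans (sym (cong proj₁ r)) (trans s (cong proj₂ r))))
      , trans (cong class (cong proj₁ r)) (trans p (trans (sym q) (cong class (sym (cong proj₂ r))))) , pos
    lem (inj₂ r) a≢b = (λ s → a≢b (trans (sym (cong proj₂ r)) (trans (sym s) (cong proj₁ r))))
      , trans (cong class (cong proj₁ r)) (trans q (trans (sym p) (cong class (sym (cong proj₂ r))))) , pos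

-- Odd triangles on three rooted blobs

_[_≔_] : ∀ {n} {C : Set} → (Fin n → C) → Fin n → C → Fin n → C
(L [ y ≔ c ]) a with a ≟ y
... | yes _ = c
... | no _  = L a

≔-here : ∀ {n} {C : Set} (L : Fin n → C) y {c} → (L [ y ≔ c ]) y ≡ c
≔-here L y with y ≟ y
... | yes _ = refl
... | no ¬p = ⊥-elim (¬p refl)

≔-away : ∀ {n} {C : Set} (L : Fin n → C) {y c a} → a ≢ y → (L [ y ≔ c ]) a ≡ L a
≔-away L {y} {a = a} a≢y with a ≟ y
... | yes p = ⊥-elim (a≢y p)
... | no _  = refl

≔-cases : ∀ {n} {C : Set} (L : Fin n → C) y a {c d} → (L [ y ≔ c ]) a ≡ d → (a ≡ y × c ≡ d) ⊎ (a ≢ y × L a ≡ d)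
≔-cases L y a p with a ≟ y
... | yes q = inj₁ (q , p)
... | no ¬q = inj₂ (¬q , p)

Chain : ∀ {A : Set} → (A → A → Set) → A → List A → A → Set
Chain R a [] b = R a b
Chain R a (y ∷ l) b = R a y × Chain R y l b

chain-map : ∀ {A : Set} {R S : A → A → Set} (OK : A → Set) → (∀ {a b} → OK a → OK b → R a b → S a b) →
  ∀ {a} l {b} → OK a → All OK l → OK b → Chain R a l b → Chain S a l b
chain-map OK f [] pa [] pb r = f pa pb r
chain-map OK f (y ∷ l) pa (py ∷ pl) pb (r , c) = f pa py r , chain-map OK f l py pl pb c

chain-split : ∀ {A : Set} {R : A → A → Set} {a b} p {y q} → Chain R a (p ++ y ∷ q) b → Chain R a p y × Chain R y q b
chain-split [] c = c
chain-split (x ∷ p) (r , c) = let (d , e) = chain-split p c in (r , d) , e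

length-prefix : ∀ {A : Set} (p : List A) {y q} → length p < length (p ++ y ∷ q)
length-prefix [] = s≤s z≤n
length-prefix (x ∷ p) = s≤s (length-prefix p)

length-suffix : ∀ {A : Set} (p : List A) {y q} → length q < length (p ++ y ∷ q)
length-suffix [] = ℕₚ.≤-refl
length-suffix (x ∷ p) = ℕₚ.m≤n⇒m≤1+n (length-suffix p)

switch-adj : ∀ {n m} (G : SG n m) X {σ a b} → Adj G σ a b → Adj (switch X G) ((σ xor X a) xor X b) a b
switch-adj G X (f , inj₁ refl , refl) = f , inj₁ refl , refl
switch-adj G X {a = a} {b} (f , inj₂ refl , refl) = f , inj₂ refl , xor-swap (neg G f) (X b) (X a)
  where
  xor-swap : ∀ p q r → (p xor q) xor r ≡ (p xor r) xor q
  xor-swap = solve 3 (λ p q r → (p :+ q) :+ r := (p :+ r) :+ q) refl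

switch-adj-≡ : ∀ {n m} (G : SG n m) X {σ σ' a b} → Adj G σ a b → (σ xor X a) xor X b ≡ σ' → Adj (switch X G) σ' a b
switch-adj-≡ G X r refl = switch-adj G X r

next3 : Fin 3 → Fin 3
next3 0F = 1F
next3 1F = 2F
next3 2F = 0F

-- X i is the i-th blob; F i is the set of free vertices of colour i.
data Blob : Set where
  U V N : Blob
  X F : Fin 3 → Blob

colour : Blob → Maybe (Fin 3)
colour (X i) = just i
colour (F i) = just i
colour _ = nothing

differ : Maybe (Fin 3) → Maybe (Fin 3) → Bool
differ c d = not (does (maybe-≡-dec _≟_ c d))

-- The colour acts as a potential for the signs. A link uses only the colours `i` and `next3 i` and
-- starts and ends with different ones, so it changes colour an odd number of times and is an odd
-- path.
Good : ∀ {n m} → SG n m → (Fin n → Blob) → Fin n → Fin n → Set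
Good G L a b = Adj G (differ (colour (L a)) (colour (L b))) a b

record Class {n m} (G : SG n m) {C : Set} (L : Fin n → C) (c : C) : Set where
  constructor class
  field
    centre : Fin n
    centre-in : L centre ≡ c
    reach : ∀ a → L a ≡ c → Star (Inside G L c) centre a

-- `τ` is the common sign of the selected edges from the middle blobs to `U` and `V`. It is a
-- parameter because switching all middle blobs reverses it. In the end it can be corrected by
-- switching `U` and `V` together, which leaves the edge between them negative.
record Blobs {n m} (G : SG n m) (L : Fin n → Blob) (τ : Bool) : Set where
  field
    classU : Class G L U
    classV : Class G L V
    classX : ∀ i → Class G L (X i)
    XU : ∀ i → ∃ λ a → ∃ λ b → L a ≡ X i × L b ≡ U × Adj G τ a b
    XV : ∀ i → ∃ λ a → ∃ λ b → L a ≡ X i × L b ≡ V × Adj G τ a b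
    UV : ∃ λ a → ∃ λ b → L a ≡ U × L b ≡ V × Adj G true a b

record Link {n m} (G : SG n m) (L : Fin n → Blob) (i : Fin 3) : Set where
  constructor link
  field
    from to : Fin n
    mid : List (Fin n)
    from-X : L from ≡ X i
    to-X : L to ≡ X (next3 i)
    mid-colour : All (λ a → colour (L a) ≡ just i ⊎ colour (L a) ≡ just (next3 i)) mid
    chain : Chain (Good G L) from mid to
open Link

isFree? : ∀ b → Dec (∃ λ i → b ≡ F i)
isFree? U = no λ ()
isFree? V = no λ ()
isFree? N = no λ ()
isFree? (X _) = no λ ()
isFree? (F i) = yes (i , refl)

colour-X : ∀ {b i} → ¬ (∃ λ j → b ≡ F j) → colour b ≡ just i → b ≡ X i
colour-X {X i} ¬f refl = refl
colour-X {F i} ¬f refl = ⊥-elim (¬f (i , refl))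

colour-F : ∀ {b i} → (∃ λ j → b ≡ F j) → colour b ≡ just i → b ≡ F i
colour-F (j , refl) refl = refl

Star-inside-map : ∀ {n m} (G G' : SG n m) {C C' : Set} {L : Fin n → C} {L' : Fin n → C'} {c c'} →
  (∀ {a b} → L a ≡ c → L b ≡ c → Adj G false a b → Inside G' L' c' a b) →
  ∀ {a b} → Star (Inside G L c) a b → Star (Inside G' L' c') a b
Star-inside-map G G' f = Star.map λ (r , p , q) → f p q r

Star-inside-sym : ∀ {n m} (G : SG n m) {C : Set} {L : Fin n → C} {c a b} →
  Star (Inside G L c) a b → Star (Inside G L c) b a
Star-inside-sym G = Star.reverse λ (r , p , q) → Adj-sym G r , q , p

-- Giving `y` to the blob `X i`, with a switch at `y` if `σ` holds, disturbs only adjacencies at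
-- `y`. Since `y` was free, no connection inside or between blobs uses it.
module Absorb {n m} (G : SG n m) (L : Fin n → Blob) (y : Fin n) (j i : Fin 3) (Ly : L y ≡ F j) (σ : Bool) where
  S : Fin n → Bool
  S = (λ _ → false) [ y ≔ σ ]
  G' = switch S G
  L' = L [ y ≔ X i ]

  off-y : ∀ {a c} → L a ≡ c → c ≢ F j → a ≢ y
  off-y p q refl = q (trans (sym p) Ly)

  adj-away : ∀ {a b τ} → a ≢ y → b ≢ y → Adj G τ a b → Adj G' τ a b
  adj-away {a} {b} {τ} pa pb r = switch-adj-≡ G S r
    (trans (cong₂ (λ s t → (τ xor s) xor t) (≔-away _ pa) (≔-away _ pb)) (trans (xor-identityʳ _) (xor-identityʳ τ)))

  good-away : ∀ {a b} → a ≢ y → b ≢ y → Good G L a b → Good G' L' a b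
  good-away pa pb r = subst₂ (λ s t → Adj G' (differ (colour s) (colour t)) _ _)
    (sym (≔-away L pa)) (sym (≔-away L pb)) (adj-away pa pb r)

  inside-away : ∀ {c} → c ≢ F j → ∀ {a b} → L a ≡ c → L b ≡ c → Adj G false a b → Inside G' L' c a b
  inside-away ne p q r = adj-away (off-y p ne) (off-y q ne) r , trans (≔-away L (off-y p ne)) p , trans (≔-away L (off-y q ne)) q

  stay : ∀ {c} → c ≢ F j → ∀ {a} → L a ≡ c → L' a ≡ c
  stay ne p = trans (≔-away L (off-y p ne)) p

  class-away : ∀ {c} → c ≢ F j → c ≢ X i → Class G L c → Class G' L' c
  class-away {c} ne ne' (class r p f) = class r (stay ne p) g
    where
    g : ∀ a → L' a ≡ c → Star (Inside G' L' c) r a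
    g a q with ≔-cases L y a q
    ... | inj₁ (_ , x) = ⊥-elim (ne' (sym x))
    ... | inj₂ (_ , q') = Star-inside-map G G' (inside-away ne) (f a q')

  blobs : ∀ {τ a₀} → L a₀ ≡ X i → Adj G' false a₀ y → Blobs G L τ → Blobs G' L' τ
  blobs {τ} {a₀} p₀ r₀ B = record
    { classU = class-away (λ ()) (λ ()) classU
    ; classV = class-away (λ ()) (λ ()) classV
    ; classX = cX
    ; XU = λ k → let (a , b , p , q , r) = XU k in a , b , stay (λ ()) p , stay (λ ()) q , adj-away (off-y p λ ()) (off-y q λ ()) r
    ; XV = λ k → let (a , b , p , q , r) = XV k in a , b , stay (λ ()) p , stay (λ ()) q , adj-away (off-y p λ ()) (off-y q λ ()) r
    ; UV = let (a , b , p , q , r) = UV in a , b , stay (λ ()) p , stay (λ ()) q , adj-away (off-y p λ ()) (off-y q λ ()) r }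
    where
    open Blobs B
    cX : ∀ k → Class G' L' (X k)
    cX k with k ≟ i
    ... | no k≢i = class-away (λ ()) (λ { refl → k≢i refl }) (classX k)
    ... | yes refl with classX k
    ... | class r p f = class r (stay (λ ()) p) g
      where
      old : ∀ a → L a ≡ X k → Star (Inside G' L' (X k)) r a
      old a q = Star-inside-map G G' (inside-away λ ()) (f a q)
      g : ∀ a → L' a ≡ X k → Star (Inside G' L' (X k)) r a
      g a q with ≔-cases L y a q
      ... | inj₁ (refl , _) = old a₀ p₀ ◅◅ ((r₀ , stay (λ ()) p₀ , ≔-here L y) ◅ ε)
      ... | inj₂ (_ , q') = old a q'

differ-refl : ∀ c → differ c c ≡ false
differ-refl c with maybe-≡-dec _≟_ c c
... | yes _ = refl
... | no ¬p = ⊥-elim (¬p refl)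

differ-next : ∀ i → differ (just i) (just (next3 i)) ≡ true
differ-next 0F = refl
differ-next 1F = refl
differ-next 2F = refl

differ-next′ : ∀ i → differ (just (next3 i)) (just i) ≡ true
differ-next′ 0F = refl
differ-next′ 1F = refl
differ-next′ 2F = refl

next3-≢ : ∀ i → i ≢ next3 i
next3-≢ 0F ()
next3-≢ 1F ()
next3-≢ 2F ()

next3²-≢ : ∀ i → next3 i ≢ next3 (next3 i)
next3²-≢ i = next3-≢ (next3 i)

third : ∀ i k → k ≢ i → k ≢ next3 i → (next3 k ≡ i × k ≡ next3 (next3 i))
third 0F 0F p q = ⊥-elim (p refl)
third 0F 1F p q = ⊥-elim (q refl)
third 0F 2F p q = refl , refl
third 1F 0F p q = refl , refl
third 1F 1F p q = ⊥-elim (p refl)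
third 1F 2F p q = ⊥-elim (q refl)
third 2F 0F p q = ⊥-elim (q refl)
third 2F 1F p q = refl , refl
third 2F 2F p q = ⊥-elim (p refl)

sum3 : (Fin 3 → ℕ) → ℕ
sum3 f = f 0F + f 1F + f 2F

sum3-< : ∀ (f g : Fin 3 → ℕ) i → (∀ k → f k ≤ g k) → f i < g i → sum3 f < sum3 g
sum3-< f g 0F le lt = ℕₚ.+-mono-<-≤ (ℕₚ.+-mono-<-≤ lt (le 1F)) (le 2F)
sum3-< f g 1F le lt = ℕₚ.+-mono-<-≤ (ℕₚ.+-mono-≤-< (le 0F) lt) (le 2F)
sum3-< f g 2F le lt = ℕₚ.+-mono-≤-< (ℕₚ.+-mono-≤ (le 0F) (le 1F)) lt

sum3-≤ : ∀ (f g : Fin 3 → ℕ) → (∀ k → f k ≤ g k) → sum3 f ≤ sum3 g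
sum3-≤ f g le = ℕₚ.+-mono-≤ (ℕₚ.+-mono-≤ (le 0F) (le 1F)) (le 2F)

module _ {n : ℕ} where
  open DecMembership (_≟_ {n}) public using (_∈?_)

len : ∀ {n m} {G : SG n m} {L i} → Link G L i → ℕ
len l = length (mid l)

module Triangle {n m} (G : SG n m) (L : Fin n → Blob) (Q : ∀ i → Link G L i) where

  -- The possibilities at the first inner vertex of link `i`. As each link has only two colours, a
  -- vertex of colour `next3 i` can lie only on the links `i` and `next3 i`; `other` excludes all
  -- further occurrences there, so recolouring the vertex harms no link.
  data Status (i : Fin 3) : Set where
    shorter : (l : Link G L i) → len l < len (Q i) → Status i
    direct  : mid (Q i) ≡ [] → Status i
    same    : ∀ y l → mid (Q i) ≡ y ∷ l → L y ≡ F i → Status i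
    other   : ∀ y l → mid (Q i) ≡ y ∷ l → L y ≡ F (next3 i) → y ∉ l → y ∉ mid (Q (next3 i)) → Status i
    blocked : ∀ y l → mid (Q i) ≡ y ∷ l → All (λ a → ∃ λ k → L a ≡ F k) l → L y ≡ F (next3 i) → y ∈ mid (Q (next3 i)) → Status i

  private
    findX : ∀ {i} l → All (λ a → colour (L a) ≡ just i ⊎ colour (L a) ≡ just (next3 i)) l → ¬ All (λ a → ∃ λ k → L a ≡ F k) l →
      ∃ λ p → ∃ λ x → ∃ λ q → l ≡ p ++ x ∷ q × (L x ≡ X i ⊎ L x ≡ X (next3 i))
    findX [] [] ¬f = ⊥-elim (¬f [])
    findX (x ∷ l) (c ∷ cs) ¬f with isFree? (L x)
    ... | no ¬g = [] , x , l , refl , lem c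
      where
      lem : ∀ {i j} → colour (L x) ≡ just i ⊎ colour (L x) ≡ just j → L x ≡ X i ⊎ L x ≡ X j
      lem (inj₁ e) = inj₁ (colour-X ¬g e)
      lem (inj₂ e) = inj₂ (colour-X ¬g e)
    ... | yes g with findX l cs (λ h → ¬f (g ∷ h))
    ... | p , z , q , refl , r = x ∷ p , z , q , refl , r

  status : ∀ i → Status i
  status i with All.all? (λ a → isFree? (L a)) (mid (Q i))
  status i | no ¬free with findX (mid (Q i)) (mid-colour (Q i)) ¬free
  ... | p , x , q , e , lx = cut lx
    where
    ch = chain-split p (subst (λ l → Chain (Good G L) (from (Q i)) l (to (Q i))) e (chain (Q i)))
    cs = subst (All _) e (mid-colour (Q i))
    cut : _ → Status i
    cut (inj₁ lx) = shorter (link x (to (Q i)) q lx (to-X (Q i)) (All.tail (Allₚ.++⁻ʳ p cs)) (proj₂ ch))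
      (subst (λ l → length q < length l) (sym e) (length-suffix p))
    cut (inj₂ lx) = shorter (link (from (Q i)) x p (from-X (Q i)) lx (Allₚ.++⁻ˡ p cs) (proj₁ ch))
      (subst (λ l → length p < length l) (sym e) (length-prefix p))
  status i | yes free with Q i in eq
  ... | link a b [] pa pb cs ch = direct (cong mid eq)
  status i | yes (fy ∷ fl) | link a b (y ∷ l) pa pb (inj₁ cy ∷ cs) (g , ch) = same y l (cong mid eq) (colour-F fy cy)
  status i | yes (fy ∷ fl) | link a b (y ∷ l) pa pb (inj₂ cy ∷ cs) (g , ch) with y ∈? l
  ... | yes y∈l with ∈-∃++ y∈l
  ... | p , q , refl = shorter (link a b (y ∷ q) pa pb (inj₂ cy ∷ All.tail (Allₚ.++⁻ʳ p cs)) (g , proj₂ (chain-split p ch)))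
          (subst (λ h → suc (length q) < length h) (sym (cong mid eq)) (s≤s (length-suffix p)))
  status i | yes (fy ∷ fl) | link a b (y ∷ l) pa pb (inj₂ cy ∷ cs) (g , ch) | no y∉l with y ∈? mid (Q (next3 i))
  ... | yes y∈ = blocked y l (cong mid eq) fl (colour-F fy cy) y∈
  ... | no y∉ = other y l (cong mid eq) (colour-F fy cy) y∉l y∉

  replace : ∀ i (l : Link G L i) → len l < len (Q i) → Σ (∀ k → Link G L k) λ Q' → sum3 (len ∘ Q') < sum3 (len ∘ Q)
  replace i l lt = Q' , sum3-< _ _ i le lt'
    where
    Q' : ∀ k → Link G L k
    Q' k with k ≟ i
    ... | yes refl = l
    ... | no _ = Q k
    le : ∀ k → len (Q' k) ≤ len (Q k)
    le k with k ≟ i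
    ... | yes refl = ℕₚ.<⇒≤ lt
    ... | no _ = ℕₚ.≤-refl
    lt' : len (Q' i) < len (Q i)
    lt' with i ≟ i
    ... | yes refl = lt
    ... | no ¬p = ⊥-elim (¬p refl)

  -- The edge from the blob to `y` joins equal colours and is positive, so the blob can swallow `y`
  -- and the link may start there. The switch is by the empty set.
  module Same (i : Fin 3) (y : Fin n) (l : List (Fin n)) (eq : mid (Q i) ≡ y ∷ l) (Ly : L y ≡ F i) where
    open Absorb G L y i i Ly false
    S-false : ∀ a → S a ≡ false
    S-false a with a ≟ y
    ... | yes _ = refl
    ... | no _ = refl
    adj' : ∀ {τ a b} → Adj G τ a b → Adj G' τ a b
    adj' {τ} {a} {b} r = switch-adj-≡ G S r
      (trans (cong₂ (λ s t → (τ xor s) xor t) (S-false a) (S-false b)) (trans (xor-identityʳ _) (xor-identityʳ τ)))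
    col : ∀ a → colour (L' a) ≡ colour (L a)
    col a with a ≟ y
    ... | yes refl = sym (cong colour Ly)
    ... | no _ = refl
    good' : ∀ {a b} → Good G L a b → Good G' L' a b
    good' {a} {b} r = subst₂ (λ s t → Adj G' (differ s t) _ _) (sym (col a)) (sym (col b)) (adj' r)
    chain' : ∀ {a} l {b} → Chain (Good G L) a l b → Chain (Good G' L') a l b
    chain' [] g = good' g
    chain' (x ∷ l) (g , c) = good' g , chain' l c
    col' : ∀ {a c} → colour (L a) ≡ c → colour (L' a) ≡ c
    col' {a} e = trans (col a) e
    cols' : ∀ {c d l} → All (λ a → colour (L a) ≡ c ⊎ colour (L a) ≡ d) l → All (λ a → colour (L' a) ≡ c ⊎ colour (L' a) ≡ d) l
    cols' = All.map λ { (inj₁ e) → inj₁ (col' e) ; (inj₂ e) → inj₂ (col' e) }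
    front : Chain (Good G L) (from (Q i)) (y ∷ l) (to (Q i))
    front = subst (λ l → Chain (Good G L) (from (Q i)) l (to (Q i))) eq (chain (Q i))
    Q' : ∀ k → Link G' L' k
    Q' k with k ≟ i
    ... | yes refl = link y (to (Q i)) l (≔-here L y) (stay (λ ()) (to-X (Q i)))
                       (cols' (All.tail (subst (All _) eq (mid-colour (Q i))))) (chain' l (proj₂ front))
    ... | no _ = link (from (Q k)) (to (Q k)) (mid (Q k)) (stay (λ ()) (from-X (Q k))) (stay (λ ()) (to-X (Q k)))
                       (cols' (mid-colour (Q k))) (chain' (mid (Q k)) (chain (Q k)))
    dec : sum3 (len ∘ Q') < sum3 (len ∘ Q)
    dec = sum3-< _ _ i le lt
      where
      le : ∀ k → len (Q' k) ≤ len (Q k)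
      le k with k ≟ i
      ... | yes refl = subst (λ h → length l ≤ length h) (sym eq) (ℕₚ.n≤1+n _)
      ... | no _ = ℕₚ.≤-refl
      lt : len (Q' i) < len (Q i)
      lt with i ≟ i
      ... | yes refl = subst (λ h → length l < length h) (sym eq) ℕₚ.≤-refl
      ... | no ¬p = ⊥-elim (¬p refl)
    blobs' : ∀ {τ} → Blobs G L τ → Blobs G' L' τ
    blobs' = blobs (from-X (Q i)) (adj' (subst (λ s → Adj G s _ _) same-col (proj₁ front)))
      where
      same-col : differ (colour (L (from (Q i)))) (colour (L y)) ≡ false
      same-col = trans (cong₂ differ (cong colour (from-X (Q i))) (cong colour Ly)) (differ-refl (just i))

  -- The front edge joins different colours and is negative; a switch at `y` makes it positive.
  -- Changing the colour of `y` from `next3 i` to `i` at the same time keeps the following edge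
  -- good, because its other end has one of these two colours.
  module Other (i : Fin 3) (y : Fin n) (l : List (Fin n)) (eq : mid (Q i) ≡ y ∷ l) (Ly : L y ≡ F (next3 i))
               (y∉l : y ∉ l) (y∉next : y ∉ mid (Q (next3 i))) where
    open Absorb G L y (next3 i) i Ly true
    front : Chain (Good G L) (from (Q i)) (y ∷ l) (to (Q i))
    front = subst (λ l → Chain (Good G L) (from (Q i)) l (to (Q i))) eq (chain (Q i))
    from≢ : ∀ {k} (q : Link G L k) → from q ≢ y
    from≢ q = off-y (from-X q) λ ()
    to≢ : ∀ {k} (q : Link G L k) → to q ≢ y
    to≢ q = off-y (to-X q) λ ()
    avoid : ∀ {l} → y ∉ l → All (_≢ y) l
    avoid {l} ¬p = All.tabulate λ {x} x∈ e → ¬p (subst (_∈ l) e x∈)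
    chain' : ∀ {a} l {b} → a ≢ y → y ∉ l → b ≢ y → Chain (Good G L) a l b → Chain (Good G' L') a l b
    chain' l pa pl pb = chain-map (_≢ y) good-away l pa (avoid pl) pb
    cols' : ∀ {c d l} → y ∉ l → All (λ a → colour (L a) ≡ c ⊎ colour (L a) ≡ d) l → All (λ a → colour (L' a) ≡ c ⊎ colour (L' a) ≡ d) l
    cols' ¬p cs = All.zipWith (λ { (ne , inj₁ e) → inj₁ (trans (cong colour (≔-away L ne)) e)
                                 ; (ne , inj₂ e) → inj₂ (trans (cong colour (≔-away L ne)) e) }) (avoid ¬p , cs)
    good-y : ∀ {c} → c ≢ y → colour (L c) ≡ just i ⊎ colour (L c) ≡ just (next3 i) → Good G L y c → Good G' L' y c
    good-y {c} ne cc r = switch-adj-≡ G S r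
      (trans (cong₂ (λ s t → (differ (colour (L y)) (colour (L c)) xor s) xor t) (≔-here _ y) (≔-away _ ne))
       (trans (flip cc) (sym (cong₂ (λ s t → differ (colour s) (colour t)) (≔-here L y) (≔-away L ne)))))
      where
      flip : colour (L c) ≡ just i ⊎ colour (L c) ≡ just (next3 i) →
        (differ (colour (L y)) (colour (L c)) xor true) xor false ≡ differ (just i) (colour (L c))
      flip (inj₁ e) rewrite Ly | e | differ-next′ i | differ-refl (just i) = refl
      flip (inj₂ e) rewrite Ly | e | differ-next i | differ-refl (just (next3 i)) = refl
    chain-y : ∀ l {b} → y ∉ l → b ≢ y → All (λ a → colour (L a) ≡ just i ⊎ colour (L a) ≡ just (next3 i)) l → colour (L b) ≡ just (next3 i) →
      Chain (Good G L) y l b → Chain (Good G' L') y l b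
    chain-y [] pl pb [] cb g = good-y pb (inj₂ cb) g
    chain-y (x ∷ l) pl pb (cx ∷ _) cb (g , c) = good-y (λ e → pl (here (sym e))) cx g
      , chain' l (λ e → pl (here (sym e))) (pl ∘ there) pb c
    y∉third : ∀ k → k ≢ i → k ≢ next3 i → y ∉ mid (Q k)
    y∉third k p q y∈ with third i k p q | All.lookup (mid-colour (Q k)) y∈
    ... | _ , e | inj₁ c = next3²-≢ i (sym (trans (sym e) (just-injective (trans (sym c) (cong colour Ly)))))
    ... | e , _ | inj₂ c = next3-≢ i (trans (sym e) (just-injective (trans (sym c) (cong colour Ly))))
    transport : ∀ k → y ∉ mid (Q k) → Link G' L' k
    transport k ¬p = link (from (Q k)) (to (Q k)) (mid (Q k)) (stay (λ ()) (from-X (Q k))) (stay (λ ()) (to-X (Q k)))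
                       (cols' ¬p (mid-colour (Q k))) (chain' (mid (Q k)) (from≢ (Q k)) ¬p (to≢ (Q k)) (chain (Q k)))
    Q' : ∀ k → Link G' L' k
    Q' k with k ≟ i | k ≟ next3 i
    ... | yes refl | _ = let cs = All.tail (subst (All _) eq (mid-colour (Q i))) in
                       link y (to (Q i)) l (≔-here L y) (stay (λ ()) (to-X (Q i))) (cols' y∉l cs)
                       (chain-y l y∉l (to≢ (Q i)) cs (cong colour (to-X (Q i))) (proj₂ front))
    ... | no _ | yes refl = transport k y∉next
    ... | no p | no q = transport k (y∉third k p q)
    dec : sum3 (len ∘ Q') < sum3 (len ∘ Q)
    dec = sum3-< _ _ i le lt
      where
      le : ∀ k → len (Q' k) ≤ len (Q k)
      le k with k ≟ i | k ≟ next3 i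
      ... | yes refl | _ = subst (λ h → length l ≤ length h) (sym eq) (ℕₚ.n≤1+n _)
      ... | no _ | yes refl = ℕₚ.≤-refl
      ... | no _ | no _ = ℕₚ.≤-refl
      lt : len (Q' i) < len (Q i)
      lt with i ≟ i | i ≟ next3 i
      ... | yes refl | _ = subst (λ h → length l < length h) (sym eq) ℕₚ.≤-refl
      ... | no ¬p | _ = ⊥-elim (¬p refl)
    blobs' : ∀ {τ} → Blobs G L τ → Blobs G' L' τ
    blobs' = blobs (from-X (Q i)) (switch-adj-≡ G S (proj₁ front) sign)
      where
      a = from (Q i)
      sign : (differ (colour (L a)) (colour (L y)) xor S a) xor S y ≡ false
      sign rewrite from-X (Q i) | Ly | differ-next i | ≔-away (λ _ → false) {c = true} (from≢ (Q i)) | ≔-here (λ _ → false) y {true} = refl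

  -- Every `y i` also sits on the next link, so link `i` runs from `y i` to `y (prev3 i)` through
  -- free vertices only. After all middle blobs are switched, blob `i` swallows `y i`, and these
  -- inner pieces become the new links. They run round the cycle in the opposite direction, which is
  -- why the blobs are renamed by the reflection `σ`; `π` renames the free colours so that the
  -- colour of `y i` becomes `σ i`.
  module Twist (y : Fin 3 → Fin n) (l : Fin 3 → List (Fin n)) (eq : ∀ i → mid (Q i) ≡ y i ∷ l i)
               (free : ∀ i → All (λ a → ∃ λ k → L a ≡ F k) (l i)) (Ly : ∀ i → L (y i) ≡ F (next3 i))
               (y∈ : ∀ i → y i ∈ mid (Q (next3 i))) where
    prev3 σ π : Fin 3 → Fin 3
    prev3 i = next3 (next3 i)
    σ 0F = 0F
    σ 1F = 2F
    σ 2F = 1F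
    π 0F = 1F
    π 1F = 0F
    π 2F = 2F
    σσ : ∀ i → σ (σ i) ≡ i
    σσ 0F = refl
    σσ 1F = refl
    σσ 2F = refl
    π-next : ∀ i → π (next3 i) ≡ σ i
    π-next 0F = refl
    π-next 1F = refl
    π-next 2F = refl
    π-next-σ : ∀ i → π i ≡ next3 (σ i)
    π-next-σ 0F = refl
    π-next-σ 1F = refl
    π-next-σ 2F = refl
    σ-prev : ∀ i → σ (prev3 i) ≡ next3 (σ i)
    σ-prev 0F = refl
    σ-prev 1F = refl
    σ-prev 2F = refl
    next-prev : ∀ i → next3 (prev3 i) ≡ i
    next-prev 0F = refl
    next-prev 1F = refl
    next-prev 2F = refl
    next-inj : ∀ {i j} → next3 i ≡ next3 j → i ≡ j
    next-inj {i} {j} p = trans (sym (next-prev i)) (trans (cong (next3 ∘ next3) p) (next-prev j))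
    π-differ : ∀ i j → differ (just (π i)) (just (π j)) ≡ differ (just i) (just j)
    π-differ 0F 0F = refl
    π-differ 0F 1F = refl
    π-differ 0F 2F = refl
    π-differ 1F 0F = refl
    π-differ 1F 1F = refl
    π-differ 1F 2F = refl
    π-differ 2F 0F = refl
    π-differ 2F 1F = refl
    π-differ 2F 2F = refl

    isX : Blob → Bool
    isX (X _) = true
    isX _ = false
    φ : Blob → Blob
    φ (X i) = X (σ i)
    φ (F i) = F (π i)
    φ U = U
    φ V = V
    φ N = N
    S : Fin n → Bool
    S a = isX (L a)
    G' = switch S G
    L' : Fin n → Blob
    L' a with any? (λ i → a ≟ y i)
    ... | yes (i , _) = X (σ i)
    ... | no _ = φ (L a)

    F-inj : ∀ {i j} → F i ≡ F j → i ≡ j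
    F-inj refl = refl
    y-inj : ∀ {i j} → y i ≡ y j → i ≡ j
    y-inj {i} {j} p = next-inj (F-inj (trans (sym (Ly i)) (trans (cong L p) (Ly j))))
    L'y : ∀ i → L' (y i) ≡ X (σ i)
    L'y i with any? (λ j → y i ≟ y j)
    ... | yes (j , p) = cong (X ∘ σ) (sym (y-inj p))
    ... | no ¬p = ⊥-elim (¬p (i , refl))
    L'-stay : ∀ {a} → (∀ k → L a ≢ F k) → L' a ≡ φ (L a)
    L'-stay {a} nf with any? (λ j → a ≟ y j)
    ... | yes (j , refl) = ⊥-elim (nf _ (Ly j))
    ... | no ¬p = refl
    L'-cases : ∀ a → (∃ λ i → a ≡ y i × L' a ≡ X (σ i)) ⊎ L' a ≡ φ (L a)
    L'-cases a with any? (λ j → a ≟ y j)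
    ... | yes (j , p) = inj₁ (j , p , refl)
    ... | no ¬p = inj₂ refl
    col-F : ∀ {a k} → L a ≡ F k → colour (L' a) ≡ just (π k)
    col-F {a} {k} p with L'-cases a
    ... | inj₁ (i , refl , q) = trans (cong colour q) (cong just (trans (sym (π-next i)) (cong π (F-inj (trans (sym (Ly i)) p)))))
    ... | inj₂ q = trans (cong colour q) (cong (colour ∘ φ) p)
    good-F : ∀ {a b} → (∃ λ k → L a ≡ F k) → (∃ λ k → L b ≡ F k) → Good G L a b → Good G' L' a b
    good-F {a} {b} (i , p) (j , q) r = switch-adj-≡ G S r sign
      where
      sign : (differ (colour (L a)) (colour (L b)) xor S a) xor S b ≡ differ (colour (L' a)) (colour (L' b))
      sign rewrite col-F p | col-F q | p | q | π-differ i j = trans (xor-identityʳ _) (xor-identityʳ _)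
    φ-stay : ∀ {a c} → L a ≡ c → (∀ k → c ≢ F k) → L' a ≡ φ c
    φ-stay refl nf = L'-stay nf
    inside' : ∀ {c} → (∀ k → c ≢ F k) → ∀ {a b} → L a ≡ c → L b ≡ c → Adj G false a b → Inside G' L' (φ c) a b
    inside' {c} nf {a} {b} p q r = switch-adj-≡ G S r sign , φ-stay p nf , φ-stay q nf
      where
      sign : (false xor S a) xor S b ≡ false
      sign rewrite p | q = xor-same (isX c)
    before : ∀ i → ∃ λ p → ∃ λ q → l i ≡ p ++ y (prev3 i) ∷ q
    before i with subst (y (prev3 i) ∈_) (trans (cong (λ k → mid (Q k)) (next-prev i)) (eq i)) (y∈ (prev3 i))
    ... | here p = ⊥-elim (next3-≢ i (trans (sym (next-prev i)) (F-inj (trans (sym (Ly (prev3 i))) (trans (cong L p) (Ly i))))))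
    ... | there r = ∈-∃++ r
    front : ∀ i → Chain (Good G L) (from (Q i)) (y i ∷ l i) (to (Q i))
    front i = subst (λ l → Chain (Good G L) (from (Q i)) l (to (Q i))) (eq i) (chain (Q i))
    shortLink : ∀ i → Σ (Link G' L' (σ i)) λ q → len q < len (Q i)
    shortLink i =
      link (y i) (y (prev3 i)) p (L'y i) (trans (L'y (prev3 i)) (cong X (σ-prev i)))
        (All.zipWith cols (Allₚ.++⁻ˡ p fr , Allₚ.++⁻ˡ p cs))
        (chain-map (λ a → ∃ λ k → L a ≡ F k) good-F p (_ , Ly i) (Allₚ.++⁻ˡ p fr) (_ , Ly (prev3 i)) (proj₁ (chain-split p ch)))
      , subst (λ h → length p < length h) (sym (trans (eq i) (cong (y i ∷_) e))) (ℕₚ.m≤n⇒m≤1+n (length-prefix p))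
      where
      cols : ∀ {a} → (∃ λ k → L a ≡ F k) × (colour (L a) ≡ just i ⊎ colour (L a) ≡ just (next3 i)) →
        colour (L' a) ≡ just (σ i) ⊎ colour (L' a) ≡ just (next3 (σ i))
      cols (f , inj₁ c) = inj₂ (trans (col-F (colour-F f c)) (cong just (π-next-σ i)))
      cols (f , inj₂ c) = inj₁ (trans (col-F (colour-F f c)) (cong just (π-next i)))
      p = proj₁ (before i)
      e = proj₂ (proj₂ (before i))
      fr = subst (All _) e (free i)
      cs = subst (All _) e (All.tail (subst (All _) (eq i) (mid-colour (Q i))))
      ch = subst (λ h → Chain (Good G L) (y i) h (to (Q i))) e (proj₂ (front i))
    Q' : ∀ k → Link G' L' k
    Q' k = subst (Link G' L') (σσ k) (proj₁ (shortLink (σ k)))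
    dec : sum3 (len ∘ Q') < sum3 (len ∘ Q)
    dec = ℕₚ.<-≤-trans (sum3-< _ (λ k → len (Q (σ k))) 0F (ℕₚ.<⇒≤ ∘ lt) (lt 0F))
      (ℕₚ.≤-reflexive (trans (ℕₚ.+-assoc (len (Q 0F)) _ _) (trans (cong (len (Q 0F) +_) (ℕₚ.+-comm (len (Q 2F)) _)) (sym (ℕₚ.+-assoc (len (Q 0F)) _ _)))))
      where
      lt : ∀ k → len (Q' k) < len (Q (σ k))
      lt 0F = proj₂ (shortLink 0F)
      lt 1F = proj₂ (shortLink 2F)
      lt 2F = proj₂ (shortLink 1F)
    blobs' : ∀ {τ} → Blobs G L τ → Blobs G' L' (not τ)
    blobs' {τ} B = record
      { classU = plain U refl (λ ()) (λ _ ()) classU (λ { {U} _ → refl ; {V} () ; {N} () ; {X _} () ; {F _} () })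
      ; classV = plain V refl (λ ()) (λ _ ()) classV (λ { {V} _ → refl ; {U} () ; {N} () ; {X _} () ; {F _} () })
      ; classX = λ k → subst (λ j → Class G' L' (X j)) (σσ k) (cX (σ k))
      ; XU = λ k → let (a , b , p , q , r) = XU (σ k) in a , b , trans (φ-stay p λ _ ()) (cong X (σσ k)) , φ-stay q (λ _ ()) , flipped p q r refl
      ; XV = λ k → let (a , b , p , q , r) = XV (σ k) in a , b , trans (φ-stay p λ _ ()) (cong X (σσ k)) , φ-stay q (λ _ ()) , flipped p q r refl
      ; UV = let (a , b , p , q , r) = UV in a , b , φ-stay p (λ _ ()) , φ-stay q (λ _ ()) , switch-adj-≡ G S r (cong₂ (λ s t → not (isX s) xor isX t) p q) }
      where
      open Blobs B
      flipped : ∀ {a b i c} → L a ≡ X i → L b ≡ c → Adj G τ a b → isX c ≡ false → Adj G' (not τ) a b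
      flipped {a} {b} p refl r e = switch-adj-≡ G S r (trans (cong₂ (λ s t → (τ xor isX s) xor t) p e) (trans (xor-identityʳ _) (xor-true τ)))
        where
        xor-true : ∀ s → s xor true ≡ not s
        xor-true false = refl
        xor-true true = refl
      plain : ∀ c → φ c ≡ c → (∀ {i} → X i ≢ c) → (∀ k → c ≢ F k) → Class G L c → (∀ {d} → φ d ≡ c → d ≡ c) → Class G' L' c
      plain c φc nX nF (class r p f) inv = class r (trans (φ-stay p nF) φc) g
        where
        g : ∀ a → L' a ≡ c → Star (Inside G' L' c) r a
        g a q with L'-cases a
        ... | inj₁ (i , _ , e) = ⊥-elim (nX (trans (sym e) q))
        ... | inj₂ e = subst (λ d → Star (Inside G' L' d) r a) φc (Star-inside-map G G' (inside' nF) (f a (inv (trans (sym e) q))))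
      X-inj : ∀ {i j} → X i ≡ X j → i ≡ j
      X-inj refl = refl
      σ-inj : ∀ {i j} → σ i ≡ σ j → i ≡ j
      σ-inj {i} {j} p = trans (sym (σσ i)) (trans (cong σ p) (σσ j))
      cX : ∀ i → Class G' L' (X (σ i))
      cX i with classX i
      ... | class r p f = class r (φ-stay p λ _ ()) g
        where
        old : ∀ a → L a ≡ X i → Star (Inside G' L' (X (σ i))) r a
        old a q = Star-inside-map G G' (inside' λ _ ()) (f a q)
        g : ∀ a → L' a ≡ X (σ i) → Star (Inside G' L' (X (σ i))) r a
        g a q with L'-cases a
        ... | inj₁ (j , refl , e) with σ-inj (X-inj (trans (sym e) q))
        ... | refl = old a₀ p₀ ◅◅ ((switch-adj-≡ G S (proj₁ (front i)) sign , φ-stay p₀ (λ _ ()) , L'y i) ◅ ε)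
          where
          a₀ = from (Q i)
          p₀ = from-X (Q i)
          sign : (differ (colour (L a₀)) (colour (L (y i))) xor S a₀) xor S (y i) ≡ false
          sign rewrite p₀ | Ly i | differ-next i = refl
        g a q | inj₂ e = old a (inv (trans (sym e) q))
          where
          inv : ∀ {d} → φ d ≡ X (σ i) → d ≡ X i
          inv {X k} h = cong X (σ-inj (X-inj h))
          inv {U} ()
          inv {V} ()
          inv {N} ()
          inv {F _} ()

  module Finish {τ} (B : Blobs G L τ) (dir : ∀ i → mid (Q i) ≡ []) where
    open Blobs B
    S : Fin n → Bool
    S a with L a
    ... | U = not τ
    ... | V = not τ
    ... | _ = false
    G' = switch S G
    cls : Blob → Maybe (Fin 5)
    cls U = just 0F
    cls V = just 1F
    cls (X 0F) = just 2F
    cls (X 1F) = just 3F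
    cls (X 2F) = just 4F
    cls _ = nothing
    blob : Fin 5 → Blob
    blob 0F = U
    blob 1F = V
    blob 2F = X 0F
    blob 3F = X 1F
    blob 4F = X 2F
    cls-blob : ∀ i → cls (blob i) ≡ just i
    cls-blob 0F = refl
    cls-blob 1F = refl
    cls-blob 2F = refl
    cls-blob 3F = refl
    cls-blob 4F = refl
    blob-cls : ∀ b {i} → cls b ≡ just i → b ≡ blob i
    blob-cls U refl = refl
    blob-cls V refl = refl
    blob-cls (X 0F) refl = refl
    blob-cls (X 1F) refl = refl
    blob-cls (X 2F) refl = refl
    theClass : ∀ i → Class G L (blob i)
    theClass 0F = classU
    theClass 1F = classV
    theClass 2F = classX 0F
    theClass 3F = classX 1F
    theClass 4F = classX 2F
    S-U : ∀ {a} → L a ≡ U → S a ≡ not τ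
    S-U {a} p with L a
    S-U refl | U = refl
    S-V : ∀ {a} → L a ≡ V → S a ≡ not τ
    S-V {a} p with L a
    S-V refl | V = refl
    S-X : ∀ {a i} → L a ≡ X i → S a ≡ false
    S-X {a} p with L a
    S-X refl | X i = refl
    S-same : ∀ {a b} → L a ≡ L b → S a ≡ S b
    S-same {a} {b} p rewrite p = refl
    Cross : Fin 5 → Fin 5 → Set
    Cross i j = ∃ λ a → ∃ λ b → cls (L a) ≡ just i × cls (L b) ≡ just j × Adj G' true a b
    cross : ∀ i j {a b σ} → L a ≡ blob i → L b ≡ blob j → Adj G σ a b → (σ xor S a) xor S b ≡ true → Cross i j
    cross i j {a} {b} p q r s = a , b , trans (cong cls p) (cls-blob i) , trans (cong cls q) (cls-blob j) , switch-adj-≡ G S r s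
    back : ∀ {i j} → Cross i j → Cross j i
    back (a , b , p , q , r) = b , a , q , p , Adj-sym G' r
    toU : ∀ k i → blob i ≡ X k → Cross 0F i
    toU k i e = let (a , b , p , q , r) = XU k in back (cross i 0F (trans p (sym e)) q r (sgn p q))
      where
      sgn : ∀ {a b} → L a ≡ X k → L b ≡ U → (τ xor S a) xor S b ≡ true
      sgn p q rewrite S-X p | S-U q = lem τ
        where
        lem : ∀ t → (t xor false) xor not t ≡ true
        lem true = refl
        lem false = refl
    toV : ∀ k i → blob i ≡ X k → Cross 1F i
    toV k i e = let (a , b , p , q , r) = XV k in back (cross i 1F (trans p (sym e)) q r (sgn p q))
      where
      sgn : ∀ {a b} → L a ≡ X k → L b ≡ V → (τ xor S a) xor S b ≡ true
      sgn p q rewrite S-X p | S-V q = lem τ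
        where
        lem : ∀ t → (t xor false) xor not t ≡ true
        lem true = refl
        lem false = refl
    uv : Cross 0F 1F
    uv = let (a , b , p , q , r) = UV in cross 0F 1F p q r (sgn p q)
      where
      sgn : ∀ {a b} → L a ≡ U → L b ≡ V → (true xor S a) xor S b ≡ true
      sgn p q rewrite S-U p | S-V q = lem τ
        where
        lem : ∀ t → (true xor not t) xor not t ≡ true
        lem true = refl
        lem false = refl
    xx : ∀ k i j → blob i ≡ X k → blob j ≡ X (next3 k) → Cross i j
    xx k i j e e' with Q k | dir k
    ... | link a b [] p q cs g | refl = cross i j (trans p (sym e)) (trans q (sym e')) g sgn
      where
      sgn : (differ (colour (L a)) (colour (L b)) xor S a) xor S b ≡ true
      sgn rewrite S-X p | S-X q | p | q | differ-next k = refl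
    crossing : ∀ i j → i ≢ j → Cross i j
    crossing 0F 0F ne = ⊥-elim (ne refl)
    crossing 0F 1F ne = uv
    crossing 0F 2F ne = toU 0F 2F refl
    crossing 0F 3F ne = toU 1F 3F refl
    crossing 0F 4F ne = toU 2F 4F refl
    crossing 1F 0F ne = back uv
    crossing 1F 1F ne = ⊥-elim (ne refl)
    crossing 1F 2F ne = toV 0F 2F refl
    crossing 1F 3F ne = toV 1F 3F refl
    crossing 1F 4F ne = toV 2F 4F refl
    crossing 2F 0F ne = back (toU 0F 2F refl)
    crossing 2F 1F ne = back (toV 0F 2F refl)
    crossing 2F 2F ne = ⊥-elim (ne refl)
    crossing 2F 3F ne = xx 0F 2F 3F refl refl
    crossing 2F 4F ne = back (xx 2F 4F 2F refl refl)
    crossing 3F 0F ne = back (toU 1F 3F refl)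
    crossing 3F 1F ne = back (toV 1F 3F refl)
    crossing 3F 2F ne = back (xx 0F 2F 3F refl refl)
    crossing 3F 3F ne = ⊥-elim (ne refl)
    crossing 3F 4F ne = xx 1F 3F 4F refl refl
    crossing 4F 0F ne = back (toU 2F 4F refl)
    crossing 4F 1F ne = back (toV 2F 4F refl)
    crossing 4F 2F ne = xx 2F 4F 2F refl refl
    crossing 4F 3F ne = back (xx 1F 3F 4F refl refl)
    crossing 4F 4F ne = ⊥-elim (ne refl)
    model : K5Model G'
    model = record
      { class = cls ∘ L
      ; root = λ i → Class.centre (theClass i)
      ; root-class = λ i → trans (cong cls (Class.centre-in (theClass i))) (cls-blob i)
      ; connected = λ i a p → Star-inside-map G G' (ins i) (Class.reach (theClass i) a (blob-cls (L a) p))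
      ; crossing = crossing }
      where
      ins : ∀ i {a b} → L a ≡ blob i → L b ≡ blob i → Adj G false a b → Inside G' (cls ∘ L) (just i) a b
      ins i {a} {b} p q r = switch-adj-≡ G S r sgn , trans (cong cls p) (cls-blob i) , trans (cong cls q) (cls-blob i)
        where
        sgn : (false xor S a) xor S b ≡ false
        sgn rewrite S-same (trans p (sym q)) = xor-same (S b)
    minor : HasK5NegMinor G
    minor = hasK5-step (bySwitch G S) (K5Model⇒minor n G' model)

-- Every move lets some blob swallow a vertex of a link. The three links can block each other
-- only cyclically, and then the three front vertices are swallowed at once, switching all blobs.
blobs⇒minor : ∀ k {n m} (G : SG n m) (L : Fin n → Blob) {τ} → Blobs G L τ → (Q : ∀ i → Link G L i) →
  sum3 (len ∘ Q) < k → HasK5NegMinor G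
blobs⇒minor (suc k) {n} {m} G L {τ} B Q (s≤s le) = go (status 0F) (status 1F) (status 2F)
  where
  open Triangle G L Q
  shrink : ∀ i l → len {i = i} l < len (Q i) → HasK5NegMinor G
  shrink i l lt = let (Q' , lt') = replace i l lt in blobs⇒minor k G L B Q' (ℕₚ.<-≤-trans lt' le)
  swallow : ∀ i y l → mid (Q i) ≡ y ∷ l → L y ≡ F i → HasK5NegMinor G
  swallow i y l e f = let open Same i y l e f in
    hasK5-step (bySwitch G ((λ _ → false) [ y ≔ false ])) (blobs⇒minor k _ _ (blobs' B) Q' (ℕₚ.<-≤-trans dec le))
  swallow' : ∀ i y l → mid (Q i) ≡ y ∷ l → L y ≡ F (next3 i) → y ∉ l → y ∉ mid (Q (next3 i)) → HasK5NegMinor G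
  swallow' i y l e f p q = let open Other i y l e f p q in
    hasK5-step (bySwitch G ((λ _ → false) [ y ≔ true ])) (blobs⇒minor k _ _ (blobs' B) Q' (ℕₚ.<-≤-trans dec le))
  empty : ∀ {y : Fin n} {l} {A : Set} → l ≡ [] → y ∈ l → A
  empty refl ()
  go : Status 0F → Status 1F → Status 2F → HasK5NegMinor G
  go (shorter l lt) _ _ = shrink 0F l lt
  go (same y l e f) _ _ = swallow 0F y l e f
  go (other y l e f p q) _ _ = swallow' 0F y l e f p q
  go _ (shorter l lt) _ = shrink 1F l lt
  go _ (same y l e f) _ = swallow 1F y l e f
  go _ (other y l e f p q) _ = swallow' 1F y l e f p q
  go _ _ (shorter l lt) = shrink 2F l lt
  go _ _ (same y l e f) = swallow 2F y l e f
  go _ _ (other y l e f p q) = swallow' 2F y l e f p q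
  go (direct d) (direct d') (direct d'') = Finish.minor B λ { 0F → d ; 1F → d' ; 2F → d'' }
  go (direct d) _ (blocked _ _ _ _ _ y∈) = empty d y∈
  go _ (direct d) (blocked _ _ _ _ _ y∈) = go' (status 0F) d y∈
    where
    go' : ∀ {y} → Status 0F → mid (Q 1F) ≡ [] → y ∈ mid (Q 0F) → HasK5NegMinor G
    go' (shorter l lt) _ _ = shrink 0F l lt
    go' (same y l e f) _ _ = swallow 0F y l e f
    go' (other y l e f p q) _ _ = swallow' 0F y l e f p q
    go' (direct d) _ y∈ = empty d y∈
    go' (blocked _ _ _ _ _ y∈) d _ = empty d y∈
  go (blocked _ _ _ _ _ y∈) (direct d) (direct _) = empty d y∈
  go _ (blocked _ _ _ _ _ y∈) (direct d) = empty d y∈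
  go (blocked y₀ l₀ e₀ a₀ f₀ i₀) (blocked y₁ l₁ e₁ a₁ f₁ i₁) (blocked y₂ l₂ e₂ a₂ f₂ i₂) =
    hasK5-step (bySwitch G S) (blobs⇒minor k _ _ (blobs' B) Q' (ℕₚ.<-≤-trans dec le))
    where
    y : Fin 3 → Fin n
    y 0F = y₀
    y 1F = y₁
    y 2F = y₂
    l : Fin 3 → List (Fin n)
    l 0F = l₀
    l 1F = l₁
    l 2F = l₂
    eqs : ∀ i → mid (Q i) ≡ y i ∷ l i
    eqs 0F = e₀
    eqs 1F = e₁
    eqs 2F = e₂
    frees : ∀ i → All (λ a → ∃ λ k → L a ≡ F k) (l i)
    frees 0F = a₀
    frees 1F = a₁
    frees 2F = a₂
    labels : ∀ i → L (y i) ≡ F (next3 i)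
    labels 0F = f₀
    labels 1F = f₁
    labels 2F = f₂
    onNext : ∀ i → y i ∈ mid (Q (next3 i))
    onNext 0F = i₀
    onNext 1F = i₁
    onNext 2F = i₂
    open Twist y l eqs frees labels onNext

-- Sums over edges and weights of signatures

sumF : ∀ {m} → (Fin m → ℕ) → ℕ
sumF {zero} f = 0
sumF {suc m} f = f zero + sumF (f ∘ suc)

sumF-≤ : ∀ {m} {f g : Fin m → ℕ} → (∀ i → f i ≤ g i) → sumF f ≤ sumF g
sumF-≤ {zero} le = z≤n
sumF-≤ {suc m} le = ℕₚ.+-mono-≤ (le zero) (sumF-≤ (le ∘ suc))

sumF-≡ : ∀ {m} {f g : Fin m → ℕ} → f ≗ g → sumF f ≡ sumF g
sumF-≡ {zero} e = refl
sumF-≡ {suc m} e = cong₂ _+_ (e zero) (sumF-≡ (e ∘ suc))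

interchange : ∀ a b c d → (a + b) + (c + d) ≡ (a + c) + (b + d)
interchange a b c d = trans (ℕₚ.+-assoc a b _) (trans (cong (a +_) (trans (sym (ℕₚ.+-assoc b c d))
  (trans (cong (_+ d) (ℕₚ.+-comm b c)) (ℕₚ.+-assoc c b d)))) (sym (ℕₚ.+-assoc a c _)))

sumF-+ : ∀ {m} (f g : Fin m → ℕ) → sumF (λ i → f i + g i) ≡ sumF f + sumF g
sumF-+ {zero} f g = refl
sumF-+ {suc m} f g = trans (cong ((f zero + g zero) +_) (sumF-+ (f ∘ suc) (g ∘ suc))) (interchange (f zero) (g zero) _ _)

bit : Bool → ℕ
bit true = 1
bit false = 0

-- A signature is represented by a switching set that produces it. Complementary sets give the same
-- signature; this freedom is fixed later by demanding the value `false` at `u`.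
wt : ∀ {n m} → SG n m → (Fin m → ℕ) → (Fin n → Bool) → ℕ
wt G w x = sumF λ f → bit (neg (switch x G) f) * w f

wt-cong : ∀ {n m} (G : SG n m) w {x y} → x ≗ y → wt G w x ≡ wt G w y
wt-cong G w e = sumF-≡ λ f → cong (λ b → bit b * w f) (cong₂ (λ p q → (neg G f xor p) xor q) (e _) (e _))

wt-+ : ∀ {n m} (G : SG n m) w w' x → wt G (λ f → w f + w' f) x ≡ wt G w x + wt G w' x
wt-+ G w w' x = trans (sumF-≡ λ f → ℕₚ.*-distribˡ-+ (bit (neg (switch x G) f)) (w f) (w' f))
  (sumF-+ (λ f → bit (neg (switch x G) f) * w f) (λ f → bit (neg (switch x G) f) * w' f))

wt-≤ : ∀ {n m} (G : SG n m) {w w'} → (∀ f → w f ≤ w' f) → ∀ x → wt G w x ≤ wt G w' x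
wt-≤ G le x = sumF-≤ λ f → ℕₚ.*-monoʳ-≤ (bit (neg (switch x G) f)) (le f)

_⊕_ : ∀ {n} → (Fin n → Bool) → (Fin n → Bool) → Fin n → Bool
(x ⊕ y) a = x a xor y a

searchB : ∀ {n} {P : (Fin n → Bool) → Set} → (∀ x → Dec (P x)) → (∀ {x y} → x ≗ y → P x → P y) → Dec (∃ P)
searchB {P = P} P? resp = map′ (λ (v , p) → lookup v , p) (λ (x , p) → tabulate x , resp (λ a → sym (lookup∘tabulate x a)) p)
  (anySubset? {P = P ∘ lookup} (P? ∘ lookup))

≢true : ∀ {b} → b ≢ true → b ≡ false
≢true {true} p = ⊥-elim (p refl)
≢true {false} p = refl

-- Reachability

-- Both certificates are kept: closure makes `K` a cut when a target is missed, and the trails give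
-- a walk when it is hit.
record Reached {n} (R : Fin n → Fin n → Set) (S : Fin n → Bool) : Set where
  field
    K : Fin n → Bool
    start : ∀ a → S a ≡ true → K a ≡ true
    closed : ∀ a b → K a ≡ true → R a b → K b ≡ true
    trail : ∀ a → K a ≡ true → ∃ λ s → S s ≡ true × Star R s a

module _ {n} {R : Fin n → Fin n → Set} (R? : ∀ a b → Dec (R a b)) (S : Fin n → Bool) where
  private
    grow : ∀ k (rest : List (Fin n)) → length rest < k → (∀ a → S a ≡ true → a ∉ rest) →
      (∀ a → a ∉ rest → ∃ λ s → S s ≡ true × Star R s a) → Reached R S
    grow (suc k) rest (s≤s le) st tr with Any.any? (λ b → any? λ a → ¬? (a ∈? rest) ×-dec R? a b) rest
    ... | no none = record { K = λ a → not (does (a ∈? rest)) ; start = λ a p → out (st a p)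
        ; closed = λ a b p r → out λ b∈ → none (lose b∈ (a , out⁻ p , r)) ; trail = λ a p → tr a (out⁻ p) }
      where
      out : ∀ {a} → a ∉ rest → not (does (a ∈? rest)) ≡ true
      out {a} ¬p with a ∈? rest
      ... | yes p = ⊥-elim (¬p p)
      ... | no _ = refl
      out⁻ : ∀ {a} → not (does (a ∈? rest)) ≡ true → a ∉ rest
      out⁻ {a} e with a ∈? rest
      out⁻ () | yes p
      ... | no ¬p = ¬p
    ... | yes some with find some
    ... | b , b∈ , a , a∉ , r = grow k rest' (ℕₚ.<-≤-trans (filter-notAll (λ c → ¬? (c ≟ b)) rest (lose b∈ λ p → p refl)) le)
            (λ c p c∈ → st c p (proj₁ (∈-filter⁻ (λ c → ¬? (c ≟ b)) c∈))) tr'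
      where
      rest' = filter (λ c → ¬? (c ≟ b)) rest
      tr' : ∀ c → c ∉ rest' → ∃ λ s → S s ≡ true × Star R s c
      tr' c c∉ with c ≟ b
      ... | no c≢b = tr c λ c∈ → c∉ (∈-filter⁺ (λ c → ¬? (c ≟ b)) c∈ c≢b)
      ... | yes refl = let (s , p , w) = tr a a∉ in s , p , w ◅◅ (r ◅ ε)

  reached : Reached R S
  reached = grow (suc (length rest)) rest ℕₚ.≤-refl st tr
    where
    S-false? : ∀ a → Dec (S a ≡ false)
    S-false? a = S a Data.Bool.≟ false
    rest = filter S-false? (allFin n)
    st : ∀ a → S a ≡ true → a ∉ rest
    st a p a∈ with trans (sym p) (proj₂ (∈-filter⁻ S-false? {xs = allFin n} a∈))
    ... | ()
    tr : ∀ a → a ∉ rest → ∃ λ s → S s ≡ true × Star R s a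
    tr a a∉ with S a in e
    ... | true = a , e , ε
    ... | false = ⊥-elim (a∉ (∈-filter⁺ S-false? (∈-allFin a) e))

adj? : ∀ {n m} (G : SG n m) s a b → Dec (Adj G s a b)
adj? G s a b = any? λ f → (pair-≡-dec _≟_ _≟_ (ends G f) (a , b) ⊎-dec pair-≡-dec _≟_ _≟_ (ends G f) (b , a)) ×-dec (neg G f Data.Bool.≟ s)

star⇒chain : ∀ {A : Set} {R : A → A → Set} {P : A → Set} → (∀ {a b} → R a b → P a) → ∀ {a b} → Star R a b →
  a ≡ b ⊎ ∃ λ l → Chain R a l b × All P l
star⇒chain p ε = inj₁ refl
star⇒chain p (_◅_ {j = c} r w) with star⇒chain p w
... | inj₁ refl = inj₂ ([] , r , [])
... | inj₂ (l , ch , ps) = inj₂ (c ∷ l , (r , ch) , first l ch ∷ ps)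
  where
  first : ∀ l {b} → Chain _ c l b → _
  first [] r = p r
  first (y ∷ l) (r , _) = p r

-- Majority and odd one out of three signatures

maj : Bool → Bool → Bool → Bool
maj true true _ = true
maj false false _ = false
maj true false c = c
maj false true c = c

-- The colour names the bit that disagrees with the other two; unanimous vertices get none.
oddOne : Bool → Bool → Bool → Blob
oddOne false false false = N
oddOne true true true = N
oddOne true false false = F 0F
oddOne false true true = F 0F
oddOne false true false = F 1F
oddOne true false true = F 1F
oddOne false false true = F 2F
oddOne true true false = F 2F

-- Of two different bits among three, one is the odd one out and the other equals the majority. So
-- where the signatures `i` and `next3 i` differ, switching by signature `i` differs from switching
-- by the majority exactly at the vertices of colour `i`.
odd-colour : ∀ i (b : Fin 3 → Bool) → b i xor b (next3 i) ≡ true →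
  let M = maj (b 0F) (b 1F) (b 2F) ; c = colour (oddOne (b 0F) (b 1F) (b 2F)) in
  (c ≡ just i × b i xor M ≡ true) ⊎ (c ≡ just (next3 i) × b i xor M ≡ false)
odd-colour 0F b p with b 0F | b 1F | b 2F
odd-colour 0F b () | false | false | _
odd-colour 0F b () | true | true | _
... | true | false | false = inj₁ (refl , refl)
... | false | true | true = inj₁ (refl , refl)
... | true | false | true = inj₂ (refl , refl)
... | false | true | false = inj₂ (refl , refl)
odd-colour 1F b p with b 0F | b 1F | b 2F
odd-colour 1F b () | _ | false | false
odd-colour 1F b () | _ | true | true
... | false | true | false = inj₁ (refl , refl)
... | true | false | true = inj₁ (refl , refl)
... | true | true | false = inj₂ (refl , refl)
... | false | false | true = inj₂ (refl , refl)
odd-colour 2F b p with b 0F | b 1F | b 2F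
odd-colour 2F b () | false | _ | false
odd-colour 2F b () | true | _ | true
... | false | false | true = inj₁ (refl , refl)
... | true | true | false = inj₁ (refl , refl)
... | false | true | true = inj₂ (refl , refl)
... | true | false | false = inj₂ (refl , refl)

maj-one : ∀ i (b : Fin 3 → Bool) → (∀ k → b k ≡ true → k ≡ i) → maj (b 0F) (b 1F) (b 2F) ≡ false
maj-one i b h with b 0F in e₀ | b 1F in e₁ | b 2F in e₂
... | false | false | _ = refl
... | false | true | false = refl
... | true | false | false = refl
... | false | true | true with trans (h 1F e₁) (sym (h 2F e₂))
... | ()
maj-one i b h | true | false | true with trans (h 0F e₀) (sym (h 2F e₂))
... | ()
maj-one i b h | true | true | _ with trans (h 0F e₀) (sym (h 1F e₁))
... | ()

oddOne-one : ∀ i (b : Fin 3 → Bool) → b i ≡ true → (∀ k → b k ≡ true → k ≡ i) → colour (oddOne (b 0F) (b 1F) (b 2F)) ≡ just i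
oddOne-one i b p h with b 0F in e₀ | b 1F in e₁ | b 2F in e₂
... | false | true | true with trans (h 1F e₁) (sym (h 2F e₂))
... | ()
oddOne-one i b p h | true | false | true with trans (h 0F e₀) (sym (h 2F e₂))
... | ()
oddOne-one i b p h | true | true | _ with trans (h 0F e₀) (sym (h 1F e₁))
... | ()
oddOne-one i b p h | true | false | false = cong just (h 0F e₀)
oddOne-one i b p h | false | true | false = cong just (h 1F e₁)
oddOne-one i b p h | false | false | true = cong just (h 2F e₂)
oddOne-one 0F b p h | false | false | false with trans (sym p) e₀
... | ()
oddOne-one 1F b p h | false | false | false with trans (sym p) e₁
... | ()
oddOne-one 2F b p h | false | false | false with trans (sym p) e₂
... | ()

oddOne-free : ∀ p q r → (∃ λ i → oddOne p q r ≡ F i) ⊎ oddOne p q r ≡ N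
oddOne-free false false false = inj₂ refl
oddOne-free false false true = inj₁ (_ , refl)
oddOne-free false true false = inj₁ (_ , refl)
oddOne-free false true true = inj₁ (_ , refl)
oddOne-free true false false = inj₁ (_ , refl)
oddOne-free true false true = inj₁ (_ , refl)
oddOne-free true true false = inj₁ (_ , refl)
oddOne-free true true true = inj₂ refl

not-xor : ∀ {a b} → a xor b ≡ true → b ≡ not a
not-xor {true} {false} p = refl
not-xor {false} {true} p = refl

eq-xor : ∀ {a b} → a xor b ≡ false → b ≡ a
eq-xor {true} {true} p = refl
eq-xor {false} {false} p = refl

-- Uncrossing at a single edge. If `K` contains both ends or neither, no sign changes. If it
-- contains one end and the signatures agree at the other, the edge has different signs in the two
-- signatures and the toggle swaps them. If they differ at the other end too, closedness of `K`
-- makes the edge negative in the first signature, hence in the second, and the toggle makes it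
-- positive in both.
cross-bits : ∀ ν xa xb ya yb ka kb →
  (ka ≡ true → xa xor ya ≡ true) → (kb ≡ true → xb xor yb ≡ true) →
  (ka ≡ true → kb ≡ false → xb xor yb ≡ true → (ν xor xa) xor xb ≡ true) →
  (kb ≡ true → ka ≡ false → xa xor ya ≡ true → (ν xor xa) xor xb ≡ true) →
  bit ((ν xor (xa xor ka)) xor (xb xor kb)) + bit ((ν xor (ya xor ka)) xor (yb xor kb)) ≤
  bit ((ν xor xa) xor xb) + bit ((ν xor ya) xor yb)
cross-bits ν xa xb ya yb false false p q r s
  rewrite xor-identityʳ xa | xor-identityʳ xb | xor-identityʳ ya | xor-identityʳ yb = ℕₚ.≤-refl
cross-bits ν xa xb ya yb true true p q r s = ℕₚ.≤-reflexive (cong₂ (λ c d → bit c + bit d) (lem ν xa xb) (lem ν ya yb))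
  where
  lem : ∀ p q r → (p xor (q xor true)) xor (r xor true) ≡ (p xor q) xor r
  lem = solve 3 (λ p q r → (p :+ (q :+ con true)) :+ (r :+ con true) := (p :+ q) :+ r) refl
cross-bits ν xa xb ya yb true false p q r s with xb xor yb in e
... | true rewrite not-xor {xa} {ya} (p refl) | not-xor {xb} {yb} e = both ν xa xb (r refl refl refl)
  where
  both : ∀ ν a b → (ν xor a) xor b ≡ true → bit ((ν xor (a xor true)) xor (b xor false)) + bit ((ν xor (not a xor true)) xor (not b xor false))
    ≤ bit ((ν xor a) xor b) + bit ((ν xor not a) xor not b)
  both false false true h = z≤n
  both false true false h = z≤n
  both true false false h = z≤n
  both true true true h = z≤n
... | false rewrite not-xor {xa} {ya} (p refl) | eq-xor {xb} {yb} e = ℕₚ.≤-reflexive (one ν xa xb)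
  where
  one : ∀ ν a b → bit ((ν xor (a xor true)) xor (b xor false)) + bit ((ν xor (not a xor true)) xor (b xor false))
    ≡ bit ((ν xor a) xor b) + bit ((ν xor not a) xor b)
  one false false false = refl
  one false false true = refl
  one false true false = refl
  one false true true = refl
  one true false false = refl
  one true false true = refl
  one true true false = refl
  one true true true = refl
cross-bits ν xa xb ya yb false true p q r s with xa xor ya in e
... | true rewrite not-xor {xb} {yb} (q refl) | not-xor {xa} {ya} e = both ν xa xb (s refl refl refl)
  where
  both : ∀ ν a b → (ν xor a) xor b ≡ true → bit ((ν xor (a xor false)) xor (b xor true)) + bit ((ν xor (not a xor false)) xor (not b xor true))
    ≤ bit ((ν xor a) xor b) + bit ((ν xor not a) xor not b)
  both false false true h = z≤n
  both false true false h = z≤n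
  both true false false h = z≤n
  both true true true h = z≤n
... | false rewrite not-xor {xb} {yb} (q refl) | eq-xor {xa} {ya} e = ℕₚ.≤-reflexive (one ν xa xb)
  where
  one : ∀ ν a b → bit ((ν xor (a xor false)) xor (b xor true)) + bit ((ν xor (a xor false)) xor (not b xor true))
    ≡ bit ((ν xor a) xor b) + bit ((ν xor a) xor not b)
  one false false false = refl
  one false false true = refl
  one false true false = refl
  one false true true = refl
  one true false false = refl
  one true false true = refl
  one true true false = refl
  one true true true = refl

-- Tight signatures and uncrossing

-- In the application `H` is the weight left after removing one copy of `e` and the three paths, and
-- `T` is the number of remaining odd walks, which certify `lower`.
module Tightness {n m} (G : SG n m) (H : Fin m → ℕ) (T : ℕ) (lower : ∀ x → T ≤ wt G H x) where

  Tight : (Fin n → Bool) → Set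
  Tight x = wt G H x ≡ T

  -- Toggling a component K of {x ≠ y} in both x and y does not increase the sum of the two weights.
  uncross : ∀ {x y K} → Tight x → Tight y →
    (∀ a → K a ≡ true → x a xor y a ≡ true) →
    (∀ a b → K a ≡ true → x b xor y b ≡ true → Adj (switch x G) false a b → K b ≡ true) →
    Tight (x ⊕ K)
  uncross {x} {y} {K} tx ty inU closed = ℕₚ.≤-antisym (ℕₚ.+-cancelʳ-≤ T _ _ (ℕₚ.≤-trans (ℕₚ.+-monoʳ-≤ _ (lower (y ⊕ K))) total)) (lower (x ⊕ K))
    where
    pos⇒ : ∀ a b f → Joins G f a b → K a ≡ true → K b ≡ false → x b xor y b ≡ true → neg (switch x G) f ≡ true
    pos⇒ a b f j ka kb u with neg (switch x G) f in e
    ... | true = refl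
    ... | false with trans (sym kb) (closed a b ka u (f , j , e))
    ... | ()
    point : ∀ f → bit (neg (switch (x ⊕ K) G) f) * H f + bit (neg (switch (y ⊕ K) G) f) * H f
                ≤ bit (neg (switch x G) f) * H f + bit (neg (switch y G) f) * H f
    point f = subst₂ _≤_ (ℕₚ.*-distribʳ-+ (H f) (bit (neg (switch (x ⊕ K) G) f)) (bit (neg (switch (y ⊕ K) G) f))) (ℕₚ.*-distribʳ-+ (H f) (bit (neg (switch x G) f)) _)
      (ℕₚ.*-monoˡ-≤ (H f) (cross-bits (neg G f) (x a) (x b) (y a) (y b) (K a) (K b) (inU a) (inU b)
        (λ ka kb u → pos⇒ a b f (inj₁ refl) ka kb u) (λ kb ka u → pos⇒ b a f (inj₂ refl) kb ka u)))
      where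
      a = proj₁ (ends G f)
      b = proj₂ (ends G f)
    total : wt G H (x ⊕ K) + wt G H (y ⊕ K) ≤ T + T
    total = subst₂ _≤_ (sumF-+ (λ f → bit (neg (switch (x ⊕ K) G) f) * H f) _)
      (trans (sumF-+ (λ f → bit (neg (switch x G) f) * H f) _) (cong₂ _+_ tx ty)) (sumF-≤ point)

  module Dependence (u v : Fin n) (VD : Fin n → Set) (vd? : ∀ a → Dec (VD a)) where

    Dep : (Fin n → Bool) → Set
    Dep S = ∃ λ x → Tight x × x u ≡ false × x v ≡ false × (∀ a → VD a → x a ≡ true → S a ≡ true)

    Dep-mono : ∀ {S S'} → (∀ a → S a ≡ true → S' a ≡ true) → Dep S → Dep S'
    Dep-mono h (x , t , p , q , tr) = x , t , p , q , λ a va e → h a (tr a va e)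

    dep? : ∀ S → Dec (Dep S)
    dep? S = searchB (λ x → (wt G H x ℕ.≟ T) ×-dec ((x u Data.Bool.≟ false) ×-dec ((x v Data.Bool.≟ false) ×-dec
        all? λ a → vd? a →-dec ((x a Data.Bool.≟ true) →-dec (S a Data.Bool.≟ true)))))
      λ {x} {y} e (t , p , q , tr) → trans (sym (wt-cong G H e)) t , trans (sym (e u)) p , trans (sym (e v)) q , λ a va h → tr a va (trans (e a) h)

    -- Two terminal blobs and three middle blobs, each middle one joined to both terminals. Together
    -- with the negative edge between the terminals, only the three connections among the middle
    -- blobs are missing for a `K5Model`. They come from the tension between `J-indep` and the tight
    -- signatures, whose traces need only one middle blob in addition to `J`.
    record Theta : Set where
      field
        L : Fin n → Blob
        no-F : ∀ a k → L a ≢ F k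
        blobs : Blobs G L false
        J : Fin n → Bool
        J-N : ∀ a → J a ≡ true → L a ≡ N
        blob-VD : ∀ a → L a ≢ N → VD a
        Lu : L u ≡ U
        Lv : L v ≡ V
        J-indep : ¬ Dep J
        sig : Fin 3 → Fin n → Bool
        sig-tight : ∀ i → Tight (sig i)
        sig-trace : ∀ i a → VD a → sig i a ≡ true → L a ≡ X i ⊎ J a ≡ true

      sig-blob : ∀ i a → L a ≢ N → sig i a ≡ true → L a ≡ X i
      sig-blob i a nN e with sig-trace i a (blob-VD a nN) e
      ... | inj₁ p = p
      ... | inj₂ q = ⊥-elim (nN (J-N a q))

    -- At a blob vertex at most one of the three signatures is nonzero, so switching by the majority
    -- leaves the blobs alone; elsewhere `oddOne` colours the vertices. An edge that is positive
    -- under signature `i` and joins two vertices where the signatures `i` and `next3 i` differ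
    -- becomes good.
    theta⇒minor : Theta → HasK5NegMinor G
    theta⇒minor Θ = hasK5-step (bySwitch G M) (blobs⇒minor _ G' L' blobs' links ℕₚ.≤-refl)
      where
      open Theta Θ
      M : Fin n → Bool
      M a = maj (sig 0F a) (sig 1F a) (sig 2F a)
      G' = switch M G
      free : Fin n → Blob
      free a = oddOne (sig 0F a) (sig 1F a) (sig 2F a)
      L' : Fin n → Blob
      L' a with L a
      ... | N = free a
      ... | c = c
      L'-blob : ∀ {a c} → L a ≡ c → c ≢ N → L' a ≡ c
      L'-blob {a} p nN with L a
      L'-blob refl nN | U = refl
      L'-blob refl nN | V = refl
      L'-blob refl nN | X i = refl
      L'-blob refl nN | F i = refl
      L'-blob refl nN | N = ⊥-elim (nN refl)
      L'-blob⁻ : ∀ {a c} → L' a ≡ c → c ≢ N → (∀ k → c ≢ F k) → L a ≡ c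
      L'-blob⁻ {a} p nN nF with L a
      ... | U = p
      ... | V = p
      ... | X i = p
      ... | F i = p
      ... | N with oddOne-free (sig 0F a) (sig 1F a) (sig 2F a)
      ... | inj₁ (i , q) = ⊥-elim (nF i (trans (sym p) q))
      ... | inj₂ q = ⊥-elim (nN (trans (sym p) q))
      X-inj : ∀ {i j} → X i ≡ X j → i ≡ j
      X-inj refl = refl
      M-blob : ∀ {a c} → L a ≡ c → c ≢ N → M a ≡ false
      M-blob {a} {c} p nN with c
      ... | X i = maj-one i (λ k → sig k a) λ k e → X-inj (trans (sym (sig-blob k a nL e)) p)
        where nL : L a ≢ N
              nL q = nN (trans (sym p) q)
      ... | N = ⊥-elim (nN refl)
      ... | F i = ⊥-elim (no-F a i p)
      ... | U = maj-one 0F (λ k → sig k a) λ k e → ⊥-elim (case (trans (sym p) (sig-blob k a (λ q → nN (trans (sym p) q)) e)) of λ ())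
      ... | V = maj-one 0F (λ k → sig k a) λ k e → ⊥-elim (case (trans (sym p) (sig-blob k a (λ q → nN (trans (sym p) q)) e)) of λ ())
      adj' : ∀ {σ a b c d} → L a ≡ c → L b ≡ d → c ≢ N → d ≢ N → Adj G σ a b → Adj G' σ a b
      adj' {σ} p q nc nd r = switch-adj-≡ G M r (trans (cong₂ (λ s t → (σ xor s) xor t) (M-blob p nc) (M-blob q nd)) (trans (xor-identityʳ _) (xor-identityʳ σ)))
      class' : ∀ {c} → c ≢ N → (∀ k → c ≢ F k) → Class G L c → Class G' L' c
      class' nN nF (class r p f) = class r (L'-blob p nN) λ a q →
        Star-inside-map G G' (λ p q r → adj' p q nN nN r , L'-blob p nN , L'-blob q nN) (f a (L'-blob⁻ q nN nF))
      blobs' : Blobs G' L' false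
      blobs' = record
        { classU = class' (λ ()) (λ _ ()) classU
        ; classV = class' (λ ()) (λ _ ()) classV
        ; classX = λ i → class' (λ ()) (λ _ ()) (classX i)
        ; XU = λ i → let (a , b , p , q , r) = XU i in a , b , L'-blob p (λ ()) , L'-blob q (λ ()) , adj' p q (λ ()) (λ ()) r
        ; XV = λ i → let (a , b , p , q , r) = XV i in a , b , L'-blob p (λ ()) , L'-blob q (λ ()) , adj' p q (λ ()) (λ ()) r
        ; UV = let (a , b , p , q , r) = UV in a , b , L'-blob p (λ ()) , L'-blob q (λ ()) , adj' p q (λ ()) (λ ()) r }
        where open Blobs blobs

      module _ (i : Fin 3) where
        j = next3 i
        x = sig i
        y = sig j
        Apart : Fin n → Set
        Apart a = x a xor y a ≡ true
        R : Fin n → Fin n → Set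
        R a b = Adj (switch x G) false a b × Apart a × Apart b
        R? : ∀ a b → Dec (R a b)
        R? a b = adj? (switch x G) false a b ×-dec ((_ Data.Bool.≟ _) ×-dec (_ Data.Bool.≟ _))
        isX? : ∀ k a → Dec (L a ≡ X k)
        isX? k a with L a
        ... | U = no λ ()
        ... | V = no λ ()
        ... | N = no λ ()
        ... | F _ = no λ ()
        ... | X l = map′ (cong X) X-inj (l ≟ k)
        start? : ∀ a → Dec (L a ≡ X i × x a ≡ true)
        start? a = isX? i a ×-dec (x a Data.Bool.≟ true)
        does⁻ : ∀ {P : Set} (d : Dec P) → does d ≡ true → P
        does⁻ (yes p) _ = p
        does⁺ : ∀ {P : Set} (d : Dec P) → P → does d ≡ true
        does⁺ (yes p) _ = refl
        does⁺ (no ¬p) p = ⊥-elim (¬p p)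
        y-off : ∀ a → L a ≡ X i → y a ≡ false
        y-off a p = ≢true λ e → next3-≢ i (X-inj (trans (sym p) (sig-blob j a (λ q → case (trans (sym p) q) of λ ()) e)))
        open Reached (reached R? (λ a → does (start? a)))
        apart-trail : ∀ {s a} → Apart s → Star R s a → Apart a
        apart-trail p ε = p
        apart-trail p ((_ , _ , q) ◅ w) = apart-trail q w
        start-apart : ∀ s → does (start? s) ≡ true → Apart s
        start-apart s p with does⁻ (start? s) p
        ... | l , e = cong₂ _xor_ e (y-off s l)
        K-apart : ∀ a → K a ≡ true → Apart a
        K-apart a p = let (s , q , w) = trail a p in apart-trail (start-apart s q) w
        not-apart : ∀ a → L a ≢ N → (∀ k → L a ≢ X k) → x a ≡ false × y a ≡ false
        not-apart a nN nX = (≢true λ e → nX i (sig-blob i a nN e)) , (≢true λ e → nX j (sig-blob j a nN e))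
        K-off : ∀ {a} → x a ≡ false → y a ≡ false → K a ≡ false
        K-off {a} p q = ≢true λ e → case trans (sym (cong₂ _xor_ p q)) (K-apart a e) of λ ()
        offU : ∀ {a} → L a ≡ U → x a ≡ false × y a ≡ false
        offU {a} p = not-apart a (λ q → case (trans (sym p) q) of λ ()) (λ k q → case (trans (sym p) q) of λ ())
        offV : ∀ {a} → L a ≡ V → x a ≡ false × y a ≡ false
        offV {a} p = not-apart a (λ q → case (trans (sym p) q) of λ ()) (λ k q → case (trans (sym p) q) of λ ())
        hit : ∃ λ b → K b ≡ true × L b ≡ X j
        hit with any? (λ b → (K b Data.Bool.≟ true) ×-dec isX? j b)
        ... | yes h = h
        -- Toggling in `x` a component that misses `X j` deletes the part of `x` in `X i` and, on
        -- `VD`, adds only vertices of `y` outside `X j`. The resulting tight signature has its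
        -- trace in `J`.
        ... | no none = ⊥-elim (J-indep (x ⊕ K , uncross {x} {y} {K} (sig-tight i) (sig-tight j) K-apart
                (λ a b ka ab r → closed a b ka (r , K-apart a ka , ab)) ,
                cong₂ _xor_ (proj₁ (offU Lu)) (K-off (proj₁ (offU Lu)) (proj₂ (offU Lu))) ,
                cong₂ _xor_ (proj₁ (offV Lv)) (K-off (proj₁ (offV Lv)) (proj₂ (offV Lv))) , trace))
          where
          trace : ∀ a → VD a → x a xor K a ≡ true → J a ≡ true
          trace a va e with x a in ex | K a in ek
          trace a va () | false | false
          trace a va () | true | true
          trace a va e | true | false with sig-trace i a va ex
          ... | inj₂ p = p
          ... | inj₁ p with trans (sym ek) (start a (does⁺ (start? a) (p , ex)))
          ... | ()
          trace a va e | false | true with sig-trace j a va (trans (not-xor (K-apart a ek)) (cong not ex))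
          ... | inj₂ p = p
          ... | inj₁ p = ⊥-elim (none (a , ek , p))
        col : ∀ a → Apart a → (colour (L' a) ≡ just i × x a xor M a ≡ true) ⊎ (colour (L' a) ≡ just j × x a xor M a ≡ false)
        col a p = subst (λ c → (c ≡ just i × x a xor M a ≡ true) ⊎ (c ≡ just j × x a xor M a ≡ false)) (sym same) (odd-colour i (λ k → sig k a) p)
          where
          same : colour (L' a) ≡ colour (free a)
          same with L a in e
          ... | N = refl
          ... | F k = ⊥-elim (no-F a k e)
          ... | U with trans (sym (cong₂ _xor_ (proj₁ (offU e)) (proj₂ (offU e)))) p
          ... | ()
          same | V with trans (sym (cong₂ _xor_ (proj₁ (offV e)) (proj₂ (offV e)))) p
          ... | ()
          same | X k with sig k a in ek
          ... | true = sym (oddOne-one k (λ k → sig k a) ek λ l h → X-inj (trans (sym (sig-blob l a (λ q → case (trans (sym e) q) of λ ()) h)) e))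
          ... | false = ⊥-elim (case trans (sym p) (cong₂ _xor_ (all-off i) (all-off j)) of λ ())
            where
            all-off : ∀ l → sig l a ≡ false
            all-off l = ≢true λ h → case trans (sym h) (trans (cong (λ q → sig q a) (X-inj (trans (sym (sig-blob l a (λ q → case (trans (sym e) q) of λ ()) h)) e))) ek) of λ ()
        good : ∀ {a b} → R a b → Good G' L' a b
        good {a} {b} (r , pa , pb) with switch-adj G M (unswitch r)
          where
          unswitch : ∀ {σ a b} → Adj (switch x G) σ a b → Adj G ((σ xor x a) xor x b) a b
          unswitch {a = a} {b} (f , inj₁ refl , refl) = f , inj₁ refl , lem (neg G f) (x a) (x b)
            where
            lem : ∀ p q r → p ≡ ((((p xor q) xor r) xor q) xor r)
            lem = solve 3 (λ p q r → p := (((p :+ q) :+ r) :+ q) :+ r) refl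
          unswitch {a = a} {b} (f , inj₂ refl , refl) = f , inj₂ refl , lem (neg G f) (x b) (x a)
            where
            lem : ∀ p q r → p ≡ ((((p xor q) xor r) xor r) xor q)
            lem = solve 3 (λ p q r → p := (((p :+ q) :+ r) :+ r) :+ q) refl
        ... | r' = subst (λ s → Adj G' s a b) (trans (regroup (x a) (x b) (M a) (M b)) sgn) r'
          where
          regroup : ∀ p q r s → (((false xor p) xor q) xor r) xor s ≡ (p xor r) xor (q xor s)
          regroup = solve 4 (λ p q r s → (((con false :+ p) :+ q) :+ r) :+ s := (p :+ r) :+ (q :+ s)) refl
          sgn : (x a xor M a) xor (x b xor M b) ≡ differ (colour (L' a)) (colour (L' b))
          sgn with col a pa | col b pb
          ... | inj₁ (p , q) | inj₁ (p' , q') rewrite p | q | p' | q' = sym (differ-refl (just i))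
          ... | inj₁ (p , q) | inj₂ (p' , q') rewrite p | q | p' | q' = sym (differ-next i)
          ... | inj₂ (p , q) | inj₁ (p' , q') rewrite p | q | p' | q' = sym (differ-next′ i)
          ... | inj₂ (p , q) | inj₂ (p' , q') rewrite p | q | p' | q' = sym (differ-refl (just j))
        oneLink : Link G' L' i
        oneLink with hit
        ... | b , kb , lb with trail b kb
        ... | s , ps , w with star⇒chain {P = Apart} (λ (_ , p , _) → p) w
        ... | inj₁ refl = ⊥-elim (next3-≢ i (X-inj (trans (sym (proj₁ (does⁻ (start? s) ps))) lb)))
        ... | inj₂ (l , ch , ap) = link s b l (L'-blob (proj₁ (does⁻ (start? s) ps)) (λ ())) (L'-blob lb (λ ()))
                (All.map (λ {a} p → cols (col a p)) ap) (chain-good l ch)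
          where
          cols : ∀ {a} → _ → colour (L' a) ≡ just i ⊎ colour (L' a) ≡ just j
          cols (inj₁ (p , _)) = inj₁ p
          cols (inj₂ (p , _)) = inj₂ p
          chain-good : ∀ {a} l {b} → Chain R a l b → Chain (Good G' L') a l b
          chain-good [] r = good r
          chain-good (y ∷ l) (r , c) = good r , chain-good l c
      links : ∀ i → Link G' L' i
      links i = oneLink i

-- Three interleaved paths from u to v

hd : ∀ {A : Set} → A → List A → A
hd u [] = u
hd u (y ∷ _) = y

tl : ∀ {A : Set} → List A → List A
tl [] = []
tl (_ ∷ l) = l

-- `r` lists an unswept prefix backwards, so `hd u r` is the vertex to which the swept suffix is
-- attached, and this is `u` when the prefix is used up. A whole strand is `r ʳ++ B`, with its two
-- ends left out.
RChain : ∀ {A : Set} → (A → A → Set) → A → List A → Set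
RChain R u [] = ⊤
RChain R u (y ∷ r) = R (hd u r) y × RChain R u r

chain-ʳ++ : ∀ {A : Set} {R : A → A → Set} {u v} r {B} → Chain R u (r ʳ++ B) v → RChain R u r × Chain R (hd u r) B v
chain-ʳ++ [] c = tt , c
chain-ʳ++ (y ∷ r) c with chain-ʳ++ r c
... | rc , (a , c') = (a , rc) , c'

∈-ʳ++ˡ : ∀ {A : Set} {a : A} r {B} → a ∈ r → a ∈ r ʳ++ B
∈-ʳ++ˡ r {B} p = subst (_ ∈_) (sym (ʳ++-defn r)) (∈-++⁺ˡ (Anyₚ.reverse⁺ p))

∈-ʳ++ʳ : ∀ {A : Set} {a : A} r {B} → a ∈ B → a ∈ r ʳ++ B
∈-ʳ++ʳ r {B} p = subst (_ ∈_) (sym (ʳ++-defn r)) (∈-++⁺ʳ (reverse r) p)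

∈-ʳ++⁻ : ∀ {A : Set} {a : A} r {B} → a ∈ r ʳ++ B → a ∈ r ⊎ a ∈ B
∈-ʳ++⁻ [] p = inj₂ p
∈-ʳ++⁻ (y ∷ r) p with ∈-ʳ++⁻ r p
... | inj₁ q = inj₁ (there q)
... | inj₂ (here q) = inj₁ (here q)
... | inj₂ (there q) = inj₂ q

Before : ∀ {A : Set} → List A → A → A → Set
Before l x y = ∃ λ p → ∃ λ q → ∃ λ s → l ≡ p ++ x ∷ q ++ y ∷ s

before-ʳ++ : ∀ {A : Set} {x y : A} t {B} → x ∈ t → Before ((y ∷ t) ʳ++ B) x y
before-ʳ++ {x = x} {y} t {B} x∈ with ∈-∃++ (Anyₚ.reverse⁺ x∈)
... | p , q , e = p , q , B , trans (ʳ++-defn t) (trans (cong (_++ y ∷ B) e) (++-assoc p (x ∷ q) (y ∷ B)))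

-- lV, lT i, lJ: the part of the paths already swept, split into the blob of v, three candidate blobs
-- and the vertices where signatures are unconstrained; lΓ: the part of the blob of u found in the second phase.
data Lab : Set where
  lO lV lJ lΓ : Lab
  lT : Fin 3 → Lab

isJ : Lab → Bool
isJ lJ = true
isJ _ = false

isTJ : Fin 3 → Lab → Bool
isTJ i lJ = true
isTJ i (lT j) = does (i ≟ j)
isTJ i _ = false

isTJ-T : ∀ i → isTJ i (lT i) ≡ true
isTJ-T i with i ≟ i
... | yes _ = refl
... | no ¬p = ⊥-elim (¬p refl)

isJ⁻ : ∀ {l} → isJ l ≡ true → l ≡ lJ
isJ⁻ {lJ} p = refl

isTJ⁻ : ∀ {i l} → isTJ i l ≡ true → l ≡ lT i ⊎ l ≡ lJ
isTJ⁻ {i} {lJ} p = inj₂ refl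
isTJ⁻ {i} {lT j} p with i ≟ j
... | yes refl = inj₁ refl

lT-inj : ∀ {i j} → lT i ≡ lT j → i ≡ j
lT-inj refl = refl

cover3 : ∀ (i j k l : Fin 3) → i ≢ j → i ≢ k → j ≢ k → l ≡ i ⊎ l ≡ j ⊎ l ≡ k
cover3 = toWitness {a? = all? λ i → all? λ j → all? λ k → all? λ l →
  ¬? (i ≟ j) →-dec (¬? (i ≟ k) →-dec (¬? (j ≟ k) →-dec ((l ≟ i) ⊎-dec ((l ≟ j) ⊎-dec (l ≟ k)))))} _

record Coloured (b col : Fin 3 → Bool) : Set where
  field
    c : Bool
    strand : Fin 3
    strand-b : b strand ≡ true
    strand-col : col strand ≡ c
  col' : Fin 3 → Bool
  col' i = if b i then c else col i
  field
    has : ∀ d → ∃ λ i → col' i ≡ d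

-- A strand `k` that avoids the picked vertex guarantees its own colour. If some popped strand has
-- the opposite colour, all popped strands take that one; otherwise they all share the colour of `k`
-- already and nothing changes.
recolour : ∀ b col → (∀ d → ∃ λ i → col i ≡ d) → (∃ λ i → b i ≡ true) → (∃ λ i → b i ≡ false) → Coloured b col
recolour b col both (i₀ , bi₀) (k , bk) with any? (λ i → (b i Data.Bool.≟ true) ×-dec (col i Data.Bool.≟ not (col k)))
... | yes (i , bi , ci) = record { c = not (col k) ; strand = i ; strand-b = bi ; strand-col = ci ; has = has }
  where
  has : ∀ d → ∃ λ i → (if b i then not (col k) else col i) ≡ d
  has d with d Data.Bool.≟ col k
  ... | yes refl = k , cong (λ s → if s then not (col k) else col k) bk
  ... | no ne = i , trans (cong (λ s → if s then not (col k) else col i) bi) (sym (¬-not ne))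
... | no none = record { c = col k ; strand = i₀ ; strand-b = bi₀ ; strand-col = same i₀ bi₀ ; has = has }
  where
  same : ∀ i → b i ≡ true → col i ≡ col k
  same i bi = decidable-stable (col i Data.Bool.≟ col k) λ ne → none (i , bi , ¬-not ne)
  has : ∀ d → ∃ λ i → (if b i then col k else col i) ≡ d
  has d with both d
  ... | j , cj with b j in bj
  ... | true = k , trans (cong (λ s → if s then col k else col k) bk) (trans (sym (same j bj)) cj)
  ... | false = j , trans (cong (λ s → if s then col k else col j) bj) cj

module Sweep {n m} (G : SG n m) (H : Fin m → ℕ) (T : ℕ) (lower : ∀ x → T ≤ wt G H x)
  (u v : Fin n) (VD : Fin n → Set) (vd? : ∀ a → Dec (VD a)) where
  open Tightness G H T lower
  open Dependence u v VD vd?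

  private
    Vtx = Fin n
    Pos : Vtx → Vtx → Set
    Pos = Adj G false

  -- `Goal` is abstract so that a defective redistribution can end the whole argument: in the
  -- application it can be shortened, and the packing then comes from the induction on total length.
  -- In the same way `mate` either reaches `Goal` or hands over its signature.
  record Systems (Goal : Set) : Set₁ where
    field
      Sys : (Fin 3 → List Vtx) → Set
      resp : ∀ {P Q} → (∀ i → P i ≡ Q i) → Sys P → Sys Q
      exchange : ∀ {P Q} i j → i ≢ j → ∀ a b a' b' z → P i ≡ a ++ z ∷ b → P j ≡ a' ++ z ∷ b' →
        Q i ≡ a ++ z ∷ b' → Q j ≡ a' ++ z ∷ b → (∀ k → k ≢ i → k ≢ j → Q k ≡ P k) → Sys P → Sys Q
      repeat : ∀ {P} → Sys P → ∀ i x → Before (P i) x x → Goal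
      avoids-u : ∀ {P} → Sys P → ∀ i → u ∈ P i → Goal
      adjacent : ∀ {P} → Sys P → ∀ i → Chain Pos u (P i) v
      in-VD : ∀ {P} → Sys P → ∀ i {a} → a ∈ P i → VD a
      mate : ∀ {P} → Sys P → ∀ i → ((∃ λ x → Tight x × x u ≡ false × x v ≡ false ×
        (∀ a → VD a → x a ≡ true → a ∈ P i × (∀ j → j ≢ i → a ∉ P j))) → Goal) → Goal
      VDu : VD u
      VDv : VD v
      negative : Adj G true u v
      not-empty : ¬ Dep (λ _ → false)
      onMinor : HasK5NegMinor G → Goal

  module _ {Goal : Set} (𝒮 : Systems Goal) where
    open Systems 𝒮

    -- Exchanging the tails at `x` produces a strand that meets `y` on both sides of `x`.
    cyc2 : ∀ {P} → Sys P → ∀ i j → i ≢ j → ∀ x y → Before (P i) y x → Before (P j) x y → Goal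
    cyc2 {P} S i j i≢j x y (p , q , s , e) (p' , q' , s' , e') =
      repeat {Q} (exchange i j i≢j (p ++ y ∷ q) s p' (q' ++ y ∷ s') x
          (trans e (sym (++-assoc p (y ∷ q) (x ∷ s)))) e' Qi Qj Qk S) i y
        (p , q ++ x ∷ q' , s' , trans Qi (trans (++-assoc p (y ∷ q) _) (cong (λ h → p ++ y ∷ h) (sym (++-assoc q (x ∷ q') (y ∷ s'))))))
      where
      Q = (P [ i ≔ (p ++ y ∷ q) ++ x ∷ (q' ++ y ∷ s') ]) [ j ≔ p' ++ x ∷ s ]
      Qi : Q i ≡ (p ++ y ∷ q) ++ x ∷ (q' ++ y ∷ s')
      Qi = trans (≔-away _ i≢j) (≔-here P i)
      Qj : Q j ≡ p' ++ x ∷ s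
      Qj = ≔-here _ j
      Qk : ∀ k → k ≢ i → k ≢ j → Q k ≡ P k
      Qk k p q = trans (≔-away _ q) (≔-away P p)

    -- Exchanging the strands `i` and `j` at `x` puts `z` before `y` on strand `i`. The untouched
    -- strand `k` has them in the other order, as `cyc2` requires.
    cyc3 : ∀ {P} → Sys P → ∀ i j k → i ≢ j → i ≢ k → j ≢ k → ∀ x y z →
      Before (P j) x y → Before (P k) y z → Before (P i) z x → Goal
    cyc3 {P} S i j k i≢j i≢k j≢k x y z (p' , q' , s' , e') b (p , q , s , e) =
      cyc2 {Q} S' i k i≢k y z
        (p , q ++ x ∷ q' , s' , trans Qi (trans (++-assoc p (z ∷ q) _) (cong (λ h → p ++ z ∷ h) (sym (++-assoc q (x ∷ q') (y ∷ s'))))))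
        (subst (λ l → Before l y z) (sym (Qk k (i≢k ∘ sym) (j≢k ∘ sym))) b)
      where
      Q = (P [ i ≔ (p ++ z ∷ q) ++ x ∷ (q' ++ y ∷ s') ]) [ j ≔ p' ++ x ∷ s ]
      Qi : Q i ≡ (p ++ z ∷ q) ++ x ∷ (q' ++ y ∷ s')
      Qi = trans (≔-away _ i≢j) (≔-here P i)
      Qk : ∀ k → k ≢ i → k ≢ j → Q k ≡ P k
      Qk k p q = trans (≔-away _ q) (≔-away P p)
      S' : Sys Q
      S' = exchange i j i≢j (p ++ z ∷ q) s p' (q' ++ y ∷ s') x
          (trans e (sym (++-assoc p (z ∷ q) (x ∷ s)))) e' Qi (≔-here _ j) Qk S

    -- `z` can be swept from all strands at once, for it occurs in an unswept prefix only as the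
    -- last vertex; `b` marks the strands where it does.
    record Picked (r : Fin 3 → List Vtx) : Set where
      field
        z : Vtx
        b : Fin 3 → Bool
        r' : Fin 3 → List Vtx
        popped : ∀ i → b i ≡ true → r i ≡ z ∷ r' i
        kept : ∀ i → b i ≡ false → r i ≡ r' i
        fresh : ∀ i → z ∉ r' i
        some : ∃ λ i → b i ≡ true

      r'⊆r : ∀ i {a} → a ∈ r' i → a ∈ r i
      r'⊆r i a∈ with b i in e
      ... | true = subst (_ ∈_) (sym (popped i e)) (there a∈)
      ... | false = subst (_ ∈_) (sym (kept i e)) a∈

      z∈r : ∃ λ i → z ∈ r i
      z∈r = proj₁ some , subst (z ∈_) (sym (popped _ (proj₂ some))) (here refl)

      smaller : sum3 (length ∘ r') < sum3 (length ∘ r)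
      smaller = sum3-< _ _ (proj₁ some) le (ℕₚ.≤-reflexive (cong length (sym (popped _ (proj₂ some)))))
        where
        le : ∀ k → length (r' k) ≤ length (r k)
        le k with b k in e
        ... | true = ℕₚ.≤-trans (ℕₚ.n≤1+n _) (ℕₚ.≤-reflexive (cong length (sym (popped k e))))
        ... | false = ℕₚ.≤-reflexive (cong length (sym (kept k e)))

      put : (Fin 3 → List Vtx) → Fin 3 → List Vtx
      put B i = if b i then z ∷ B i else B i

      put-true : ∀ B {i} → b i ≡ true → put B i ≡ z ∷ B i
      put-true B {i} e = cong (λ s → if s then z ∷ B i else B i) e

      put-⊇ : ∀ B i {a} → a ∈ B i → a ∈ put B i
      put-⊇ B i p with b i
      ... | true = there p
      ... | false = p

      put-⊆ : ∀ B i {a} → a ∈ put B i → (a ≡ z × b i ≡ true) ⊎ a ∈ B i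
      put-⊆ B i p with b i
      put-⊆ B i (here q) | true = inj₁ (q , refl)
      put-⊆ B i (there p) | true = inj₂ p
      ... | false = inj₂ p

      put-≡ : ∀ B i → r i ʳ++ B i ≡ r' i ʳ++ put B i
      put-≡ B i with b i in e
      ... | true = cong (_ʳ++ B i) (popped i e)
      ... | false = cong (_ʳ++ B i) (kept i e)

      put-Sys : ∀ {B : Fin 3 → List Vtx} → Sys (λ i → r i ʳ++ B i) → Sys (λ i → r' i ʳ++ put B i)
      put-Sys {B} = resp (put-≡ B)

      end-popped : ∀ i → b i ≡ true → hd u (r i) ≡ z
      end-popped i e = cong (hd u) (popped i e)

      end-kept : ∀ i → b i ≡ false → hd u (r i) ≡ hd u (r' i)
      end-kept i e = cong (hd u) (kept i e)

      end-adj : ∀ {B : Fin 3 → List Vtx} → Sys (λ i → r i ʳ++ B i) → ∀ i → b i ≡ true → Pos (hd u (r' i)) z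
      end-adj {B} S i e = proj₁ (subst (RChain Pos u) (popped i e) (proj₁ (chain-ʳ++ (r i) (adjacent S i))))

    -- If the last vertex of one prefix also occurs deeper in some prefix, move to the last vertex
    -- of that one. With three strands such a chase closes up after at most three moves, and a
    -- closed chase is a cyclic precedence, settled by `repeat`, `cyc2` or `cyc3`.
    pick : ∀ r {B : Fin 3 → List Vtx} → Sys (λ i → r i ʳ++ B i) → (Picked r → Goal) → ((∀ i → r i ≡ []) → Goal) → Goal
    pick r {B} S found none with any? (λ i → nonEmpty? (r i))
      where
      nonEmpty? : ∀ (l : List Vtx) → Dec (∃ λ y → ∃ λ t → l ≡ y ∷ t)
      nonEmpty? [] = no λ ()
      nonEmpty? (y ∷ t) = yes (y , t , refl)
    ... | no empty = none λ i → isEmpty (r i) (λ p → empty (i , p))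
      where
      isEmpty : ∀ (l : List Vtx) → ¬ (∃ λ y → ∃ λ t → l ≡ y ∷ t) → l ≡ []
      isEmpty [] _ = refl
      isEmpty (y ∷ t) ¬p = ⊥-elim (¬p (y , t , refl))
    ... | yes (i , y , t , e) = chase₁
      where
      blocked? : ∀ y → Dec (∃ λ j → y ∈ tl (r j))
      blocked? y = any? λ j → y ∈? tl (r j)
      Top : Fin 3 → Vtx → Set
      Top i y = ∃ λ t → r i ≡ y ∷ t
      take : ∀ i y → Top i y → ¬ (∃ λ j → y ∈ tl (r j)) → Goal
      take i y (t , e) ¬bl = found record { z = y ; b = λ j → proj₁ (pop (r j)) ; r' = λ j → proj₂ (pop (r j))
          ; popped = λ j → popped (r j) ; kept = λ j → kept (r j) ; fresh = λ j → fresh (r j) (λ p → ¬bl (j , p))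
          ; some = i , subst (λ l → proj₁ (pop l) ≡ true) (sym e) (first t) }
        where
        pop : List Vtx → Bool × List Vtx
        pop [] = false , []
        pop (w ∷ l) with w ≟ y
        ... | yes _ = true , l
        ... | no _ = false , w ∷ l
        first : ∀ t → proj₁ (pop (y ∷ t)) ≡ true
        first t with y ≟ y
        ... | yes _ = refl
        ... | no ¬p = ⊥-elim (¬p refl)
        popped : ∀ l → proj₁ (pop l) ≡ true → l ≡ y ∷ proj₂ (pop l)
        popped (w ∷ l) e with w ≟ y
        ... | yes refl = refl
        kept : ∀ l → proj₁ (pop l) ≡ false → l ≡ proj₂ (pop l)
        kept [] e = refl
        kept (w ∷ l) e with w ≟ y
        ... | no _ = refl
        fresh : ∀ l → y ∉ tl l → y ∉ proj₂ (pop l)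
        fresh (w ∷ l) ¬p with w ≟ y
        ... | yes _ = ¬p
        ... | no w≢y = λ { (here q) → w≢y (sym q) ; (there q) → ¬p q }
      blocker : ∀ j {y} → y ∈ tl (r j) → ∃ λ w → Top j w × Before (r j ʳ++ B j) y w
      blocker j p with r j
      ... | w ∷ t = w , (t , refl) , before-ʳ++ t p
      same-top : ∀ {i y w} → Top i y → Top i w → y ≡ w
      same-top (t , e) (t' , e') = cong (hd u) (trans (sym e) e')
      P : Fin 3 → List Vtx
      P i = r i ʳ++ B i
      loop : ∀ {i y w} → Top i y → Top i w → Before (P i) y w → Goal
      loop {i} {y} t t' bf = repeat S i y (subst (Before (P i) y) (sym (same-top t t')) bf)
      chase₁ : Goal
      chase₁ with blocked? y
      ... | no ¬bl = take i y (t , e) ¬bl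
      ... | yes (j , p) with blocker j p
      ... | w , tw , bw with i ≟ j
      ... | yes refl = loop (t , e) tw bw
      ... | no i≢j with blocked? w
      ... | no ¬bl = take j w tw ¬bl
      ... | yes (k , q) with blocker k q
      ... | s , ts , bs with j ≟ k | i ≟ k
      ... | yes refl | _ = loop tw ts bs
      ... | no _ | yes refl = cyc2 S i j i≢j y w (subst (Before (P i) w) (same-top ts (t , e)) bs) bw
      ... | no j≢k | no i≢k with blocked? s
      ... | no ¬bl = take k s ts ¬bl
      ... | yes (l , x) with blocker l x
      ... | s' , ts' , bs' with cover3 i j k l i≢j i≢k j≢k
      ... | inj₁ refl = cyc3 S i j k i≢j i≢k j≢k y w s bw bs (subst (Before (P i) s) (same-top ts' (t , e)) bs')
      ... | inj₂ (inj₁ refl) = cyc2 S j k j≢k w s (subst (Before (P j) s) (same-top ts' tw) bs') bs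
      ... | inj₂ (inj₂ refl) = loop ts ts' bs'

-- The sweep and its two phases

module Phases {n m} (G : SG n m) (H : Fin m → ℕ) (T : ℕ) (lower : ∀ x → T ≤ wt G H x)
  (u v : Fin n) (VD : Fin n → Set) (vd? : ∀ a → Dec (VD a))
  {Goal : Set} (𝒮 : Sweep.Systems G H T lower u v VD vd? Goal) where
  open Tightness G H T lower
  open Dependence u v VD vd?
  open Sweep G H T lower u v VD vd?
  open Systems 𝒮

  Vtx = Fin n
  Strands = Fin 3 → List Vtx
  Pos : Vtx → Vtx → Set
  Pos = Adj G false

  Reaches : (Vtx → Lab) → Lab → Vtx → Set
  Reaches ℓ c τ = ℓ τ ≡ c × (∀ a → ℓ a ≡ c → Star (Inside G ℓ c) τ a)

  Touches : (Vtx → Lab) → Lab → Lab → Set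
  Touches ℓ c d = ∃ λ a → ∃ λ b → ℓ a ≡ c × ℓ b ≡ d × Pos a b

  -- What it takes for `y` to enter class `c` while the class stays connected and in contact with
  -- the blob of `v`. The second alternative is the start of an empty class.
  Hook : (Vtx → Lab) → Vtx → Lab → Set
  Hook ℓ y c = ∃ λ τ → Pos y τ × ((Reaches ℓ c τ × Touches ℓ c lV) ⊎ (ℓ τ ≡ lV × (∀ a → ℓ a ≢ c)))

  -- The i-th strand can be continued to v so that the private vertices of the continuation lie in lT k ∪ lJ.
  record Flag (r : Strands) (ℓ : Vtx → Lab) (k i : Fin 3) : Set where
    constructor flagged
    field
      suffix : Strands
      suffix-Sys : Sys (λ j → r j ʳ++ suffix j)
      private-in : ∀ a → a ∈ suffix i → isTJ k (ℓ a) ≡ true ⊎ ∃ λ j → j ≢ i × a ∈ suffix j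

  relabel : ∀ {ℓ ℓ' : Vtx → Lab} {c c'} → (∀ a → ℓ a ≡ c → ℓ' a ≡ c') → ∀ {a b} → Star (Inside G ℓ c) a b → Star (Inside G ℓ' c') a b
  relabel h = Star-inside-map G G λ p q r → r , h _ p , h _ q

  DepT : (Vtx → Lab) → Fin 3 → Set
  DepT ℓ i = Dep (isTJ i ∘ ℓ)

  module _ {r : Strands} (pk : Picked 𝒮 r) where
    open Picked pk

    -- `z` joins the suffix, so it must either lie in the allowed set or fail to be private because
    -- another strand is popped too.
    flag-pop : ∀ {ℓ ℓ' : Vtx → Lab} {k k'} i → (∀ a → isTJ k (ℓ a) ≡ true → isTJ k' (ℓ' a) ≡ true) →
      (b i ≡ true → isTJ k' (ℓ' z) ≡ true ⊎ ∃ λ j → j ≢ i × b j ≡ true) → Flag r ℓ k i → Flag r' ℓ' k' i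
    flag-pop {ℓ' = ℓ'} {k' = k'} i mono hz (flagged B S h) = flagged (put B) (put-Sys S) g
      where
      g : ∀ a → a ∈ put B i → isTJ k' (ℓ' a) ≡ true ⊎ ∃ λ j → j ≢ i × a ∈ put B j
      g a a∈ with put-⊆ B i a∈
      ... | inj₁ (refl , bi) with hz bi
      ... | inj₁ p = inj₁ p
      ... | inj₂ (j , ne , bj) = inj₂ (j , ne , subst (z ∈_) (sym (put-true B bj)) (here refl))
      g a a∈ | inj₂ a∈B with h a a∈B
      ... | inj₁ p = inj₁ (mono a p)
      ... | inj₂ (j , ne , q) = inj₂ (j , ne , put-⊇ B j q)

    -- Strands popped together can exchange their suffixes at `z`, so a continuation of one serves
    -- the other. Here `z` lies on both and is not private.
    flag-swap : ∀ {ℓ ℓ' : Vtx → Lab} {k k'} i j → i ≢ j → b i ≡ true → b j ≡ true → (∀ a → isTJ k (ℓ a) ≡ true → isTJ k' (ℓ' a) ≡ true) →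
      Flag r ℓ k i → Flag r' ℓ' k' j
    flag-swap {ℓ' = ℓ'} {k' = k'} i j i≢j bi bj mono (flagged B S h) = flagged B''
        (exchange i j i≢j (reverse (r' i)) (B i) (reverse (r' j)) (B j) z
          (trans (cong (r' i ʳ++_) (put-true B bi)) (ʳ++-defn (r' i))) (trans (cong (r' j ʳ++_) (put-true B bj)) (ʳ++-defn (r' j)))
          (trans (cong (r' i ʳ++_) B''i) (ʳ++-defn (r' i))) (trans (cong (r' j ʳ++_) B''j) (ʳ++-defn (r' j)))
          (λ k p q → cong (r' k ʳ++_) (B''k k p q)) (put-Sys S)) g
      where
      B'' : Strands
      B'' = (put B [ i ≔ z ∷ B j ]) [ j ≔ z ∷ B i ]
      B''i : B'' i ≡ z ∷ B j
      B''i = trans (≔-away _ i≢j) (≔-here (put B) i)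
      B''j : B'' j ≡ z ∷ B i
      B''j = ≔-here _ j
      B''k : ∀ k → k ≢ i → k ≢ j → B'' k ≡ put B k
      B''k k p q = trans (≔-away _ q) (≔-away (put B) p)
      g : ∀ a → a ∈ B'' j → isTJ k' (ℓ' a) ≡ true ⊎ ∃ λ l → l ≢ j × a ∈ B'' l
      g a a∈ with subst (a ∈_) B''j a∈
      ... | here refl = inj₂ (i , i≢j , subst (z ∈_) (sym B''i) (here refl))
      ... | there a∈B with h a a∈B
      ... | inj₁ p = inj₁ (mono a p)
      ... | inj₂ (l , ne , q) with l ≟ j
      ... | yes refl = inj₂ (i , i≢j , subst (a ∈_) (sym B''i) (there q))
      ... | no l≢j = inj₂ (l , l≢j , subst (a ∈_) (sym (B''k l ne l≢j)) (put-⊇ B l q))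

    flag-any : ∀ {ℓ ℓ' : Vtx → Lab} {k k'} i j → b i ≡ true → b j ≡ true → (∀ a → isTJ k (ℓ a) ≡ true → isTJ k' (ℓ' a) ≡ true) →
      (isTJ k' (ℓ' z) ≡ true ⊎ ∃ λ l → l ≢ i × b l ≡ true) → Flag r ℓ k i → Flag r' ℓ' k' j
    flag-any i j bi bj mono hz fl with i ≟ j
    ... | yes refl = flag-pop i mono (λ _ → hz) fl
    ... | no i≢j = flag-swap i j i≢j bi bj mono fl

  -- The mate of strand `i` has its trace on vertices private to this strand. In the suffix the flag
  -- puts these into the candidate or `J`; in the prefix the assumption does.
  flag⇒dep : ∀ {r ℓ k i} → Flag r ℓ k i → (∀ a → a ∈ r i → isTJ k (ℓ a) ≡ true) → (DepT ℓ k → Goal) → Goal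
  flag⇒dep {r} {ℓ} {k} {i} (flagged B S h) pre cont = mate S i λ (x , t , xu , xv , tr) → cont (x , t , xu , xv , λ a va e → lem a (tr a va e))
    where
    lem : ∀ a → (a ∈ r i ʳ++ B i × (∀ j → j ≢ i → a ∉ r j ʳ++ B j)) → isTJ k (ℓ a) ≡ true
    lem a (a∈ , ¬a) with ∈-ʳ++⁻ (r i) a∈
    ... | inj₁ p = pre a p
    ... | inj₂ p with h a p
    ... | inj₁ q = q
    ... | inj₂ (j , ne , q) = ⊥-elim (¬a j ne (∈-ʳ++ʳ (r j) q))

  -- Used to see that a dependent candidate is nonempty, as `J` alone is independent.
  dep-empty : ∀ {ℓ i} → (∀ a → ℓ a ≢ lT i) → DepT ℓ i → Dep (isJ ∘ ℓ)
  dep-empty {ℓ} {i} none = Dep-mono λ a p → lem a (isTJ⁻ p)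
    where
    lem : ∀ a → ℓ a ≡ lT i ⊎ ℓ a ≡ lJ → isJ (ℓ a) ≡ true
    lem a (inj₁ p) = ⊥-elim (none a p)
    lem a (inj₂ p) = cong isJ p

  record Common (r : Strands) : Set where
    field
      ℓ : Vtx → Lab
      ℓr : ∀ i a → a ∈ r i → ℓ a ≡ lO
      ℓu : ℓ u ≡ lO
      ℓv : ℓ v ≡ lV
      ℓVD : ∀ a → ℓ a ≢ lO → VD a
      Vconn : ∀ a → ℓ a ≡ lV → Star (Inside G ℓ lV) v a
      indep : ¬ Dep (isJ ∘ ℓ)
      base : Σ Strands λ B → Sys (λ j → r j ʳ++ B j)

    -- The label `lO` does not determine the unswept part, because vertices off the paths carry it
    -- as well.
    inPrefix : Vtx → Set
    inPrefix a = a ≡ u ⊎ ∃ λ i → a ∈ r i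

    inPrefix? : ∀ a → Dec (inPrefix a)
    inPrefix? a = (a ≟ u) ⊎-dec any? λ i → a ∈? r i

    prefix-ℓ : ∀ a → inPrefix a → ℓ a ≡ lO
    prefix-ℓ a (inj₁ refl) = ℓu
    prefix-ℓ a (inj₂ (i , p)) = ℓr i a p

    prefix-VD : ∀ a → inPrefix a → VD a
    prefix-VD a (inj₁ refl) = VDu
    prefix-VD a (inj₂ (i , p)) = in-VD (proj₂ base) i (∈-ʳ++ˡ (r i) p)

    hd-prefix : ∀ i → inPrefix (hd u (r i))
    hd-prefix i with r i in e
    ... | [] = inj₁ refl
    ... | y ∷ _ = inj₂ (i , subst (y ∈_) (sym e) (here refl))

    prefix-conn : ∀ a → inPrefix a → Star (λ a b → Pos a b × inPrefix a × inPrefix b) u a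
    prefix-conn a (inj₁ refl) = ε
    prefix-conn a (inj₂ (i , p)) = go (r i) (λ q → q) (proj₁ (chain-ʳ++ (r i) (adjacent (proj₂ base) i))) p
      where
      go : ∀ l → (∀ {c} → c ∈ l → c ∈ r i) → RChain Pos u l → ∀ {a} → a ∈ l → Star (λ a b → Pos a b × inPrefix a × inPrefix b) u a
      last : ∀ l → (∀ {c} → c ∈ l → c ∈ r i) → RChain Pos u l → Star (λ a b → Pos a b × inPrefix a × inPrefix b) u (hd u l) × inPrefix (hd u l)
      last [] sub rc = ε , inj₁ refl
      last (y ∷ l) sub rc = go (y ∷ l) sub rc (here refl) , inj₂ (i , sub (here refl))
      go (y ∷ l) sub (r , rc) (here refl) = let (w , q) = last l (sub ∘ there) rc in w ◅◅ ((r , q , inj₂ (i , sub (here refl))) ◅ ε)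
      go (y ∷ l) sub (r , rc) (there p) = go l (sub ∘ there) rc p

    -- `UU` is the future blob of `u`: the unswept prefixes, joined by `lΓ` in the second phase.
    record Roots (UU : Vtx → Set) : Set where
      field
        uu? : ∀ a → Dec (UU a)
        uu-u : UU u
        uu-ℓ : ∀ a → UU a → ℓ a ≡ lO ⊎ ℓ a ≡ lΓ
        uu-VD : ∀ a → UU a → VD a
        uu-conn : ∀ a → UU a → Star (λ a b → Pos a b × UU a × UU b) u a
        root : ∀ i → (∃ λ τ → Reaches ℓ (lT i) τ) × Touches ℓ (lT i) lV × (∃ λ a → ∃ λ b → ℓ a ≡ lT i × UU b × Pos a b)
        dep : ∀ i → DepT ℓ i

    toBlob : Lab → Blob
    toBlob lV = V
    toBlob (lT i) = X i
    toBlob _ = N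

    roots⇒theta : ∀ {UU} → Roots UU → Theta
    roots⇒theta {UU} R = record
      { L = L ; no-F = no-F ; blobs = blobs ; J = isJ ∘ ℓ ; J-N = J-N ; blob-VD = blob-VD
      ; Lu = L-U uu-u ; Lv = L-ℓ ℓv (λ ()) (λ ()) ; J-indep = indep
      ; sig = λ i → proj₁ (dep i) ; sig-tight = λ i → proj₁ (proj₂ (dep i)) ; sig-trace = trace }
      where
      open Roots R
      L : Vtx → Blob
      L a with uu? a
      ... | yes _ = U
      ... | no _ = toBlob (ℓ a)
      L-U : ∀ {a} → UU a → L a ≡ U
      L-U {a} p with uu? a
      ... | yes _ = refl
      ... | no ¬p = ⊥-elim (¬p p)
      L-ℓ : ∀ {a c} → ℓ a ≡ c → c ≢ lO → c ≢ lΓ → L a ≡ toBlob c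
      L-ℓ {a} refl n₁ n₂ with uu? a
      ... | no _ = refl
      ... | yes p with uu-ℓ a p
      ... | inj₁ q = ⊥-elim (n₁ q)
      ... | inj₂ q = ⊥-elim (n₂ q)
      L-cases : ∀ a → (UU a × L a ≡ U) ⊎ L a ≡ toBlob (ℓ a)
      L-cases a with uu? a
      ... | yes p = inj₁ (p , refl)
      ... | no _ = inj₂ refl
      toBlob-F : ∀ l k → toBlob l ≢ F k
      toBlob-F lO k ()
      toBlob-F lV k ()
      toBlob-F lJ k ()
      toBlob-F lΓ k ()
      toBlob-F (lT _) k ()
      toBlob-U : ∀ l → toBlob l ≢ U
      toBlob-U lO ()
      toBlob-U lV ()
      toBlob-U lJ ()
      toBlob-U lΓ ()
      toBlob-U (lT _) ()
      toBlob-V : ∀ {l} → toBlob l ≡ V → l ≡ lV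
      toBlob-V {lV} p = refl
      toBlob-X : ∀ {l i} → toBlob l ≡ X i → l ≡ lT i
      toBlob-X {lT i} refl = refl
      no-F : ∀ a k → L a ≢ F k
      no-F a k p with L-cases a
      ... | inj₁ (_ , q) = case trans (sym p) q of λ ()
      ... | inj₂ q = toBlob-F (ℓ a) k (trans (sym q) p)
      J-N : ∀ a → isJ (ℓ a) ≡ true → L a ≡ N
      J-N a p = L-ℓ (isJ⁻ p) (λ ()) (λ ())
      blob-VD : ∀ a → L a ≢ N → VD a
      blob-VD a nN with L-cases a
      ... | inj₁ (p , _) = uu-VD a p
      ... | inj₂ q = ℓVD a λ e → nN (trans q (cong toBlob e))
      trace : ∀ i a → VD a → proj₁ (dep i) a ≡ true → L a ≡ X i ⊎ isJ (ℓ a) ≡ true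
      trace i a va e with isTJ⁻ (proj₂ (proj₂ (proj₂ (proj₂ (dep i)))) a va e)
      ... | inj₁ p = inj₁ (L-ℓ p (λ ()) (λ ()))
      ... | inj₂ p = inj₂ (cong isJ p)
      toStar : ∀ {c} → c ≢ lO → c ≢ lΓ → ∀ {a b} → Star (Inside G ℓ c) a b → Star (Inside G L (toBlob c)) a b
      toStar n₁ n₂ = Star-inside-map G G λ p q r → r , L-ℓ p n₁ n₂ , L-ℓ q n₁ n₂
      blobs : Blobs G L false
      blobs = record
        { classU = class u (L-U uu-u) cU
        ; classV = class v (L-ℓ ℓv (λ ()) (λ ())) cV
        ; classX = λ i → let ((τ , p , f) , _) = root i in class τ (L-ℓ p (λ ()) (λ ())) (cX i τ f)
        ; XU = λ i → let (_ , _ , a , b , p , q , r) = root i in a , b , L-ℓ p (λ ()) (λ ()) , L-U q , r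
        ; XV = λ i → let (_ , (a , b , p , q , r) , _) = root i in a , b , L-ℓ p (λ ()) (λ ()) , L-ℓ q (λ ()) (λ ()) , r
        ; UV = u , v , L-U uu-u , L-ℓ ℓv (λ ()) (λ ()) , negative }
        where
        cU : ∀ a → L a ≡ U → Star (Inside G L U) u a
        cU a e with L-cases a
        ... | inj₁ (p , _) = Star.map (λ (r , p , q) → r , L-U p , L-U q) (uu-conn a p)
        ... | inj₂ q = ⊥-elim (toBlob-U (ℓ a) (trans (sym q) e))
        cV : ∀ a → L a ≡ V → Star (Inside G L V) v a
        cV a e with L-cases a
        ... | inj₁ (_ , q) = case trans (sym e) q of λ ()
        ... | inj₂ q = toStar (λ ()) (λ ()) (Vconn a (toBlob-V (trans (sym q) e)))
        cX : ∀ i τ → (∀ a → ℓ a ≡ lT i → Star (Inside G ℓ (lT i)) τ a) → ∀ a → L a ≡ X i → Star (Inside G L (X i)) τ a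
        cX i τ f a e with L-cases a
        ... | inj₁ (_ , q) = case trans (sym e) q of λ ()
        ... | inj₂ q = toStar (λ ()) (λ ()) (f a (toBlob-X (trans (sym q) e)))

  -- A strand whose candidate is still independent when u is reached would violate the existence of a mate.
  record StateA (r : Strands) : Set where
    field
      common : Common r
    open Common common public
    field
      ℓΓ : ∀ a → ℓ a ≢ lΓ
      hook : ∀ i → Hook ℓ (hd u (r i)) (lT i)
      flag : ∀ i → ¬ DepT ℓ i → Flag r ℓ i i

  -- Entered when two dependent candidates hang off one vertex while the third, k, is still independent.
  -- Strands with col i ≡ true now extend candidate k, the others the blob lΓ carrying the two dependent ones;
  -- this finds disjoint continuations for both as long as no vertex lies on all three strands.
  record StateB (r : Strands) (k : Fin 3) : Set where
    field
      common : Common r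
    open Common common public
    field
      γ : Class G ℓ lΓ
      rootB : ∀ i → i ≢ k → (∃ λ τ → Reaches ℓ (lT i) τ) × Touches ℓ (lT i) lV × Touches ℓ (lT i) lΓ
      depB : ∀ i → i ≢ k → DepT ℓ i
      col : Fin 3 → Bool
      both : ∀ d → ∃ λ i → col i ≡ d
      hookΓ : ∀ i → col i ≡ false → ∃ λ g → ℓ g ≡ lΓ × Pos (hd u (r i)) g
      hookX : ∀ i → col i ≡ true → Hook ℓ (hd u (r i)) (lT k)
      single : (∀ a → ℓ a ≢ lT k) → ∀ i j → col i ≡ true → col j ≡ true → i ≡ j
      flagX : ∀ i → col i ≡ true → Flag r ℓ k i

  thetaA : ∀ {r} (A : StateA r) → (∀ i → DepT (StateA.ℓ A) i) → Goal
  thetaA {r} A dep = onMinor (theta⇒minor (roots⇒theta record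
    { uu? = inPrefix? ; uu-u = inj₁ refl ; uu-ℓ = λ a p → inj₁ (prefix-ℓ a p) ; uu-VD = prefix-VD ; uu-conn = prefix-conn
    ; root = root ; dep = dep }))
    where
    open StateA A
    root : ∀ i → _
    root i with hook i
    ... | τ , r , inj₁ (re , to) = (τ , re) , to , τ , _ , proj₁ re , hd-prefix i , Adj-sym G r
    ... | τ , r , inj₂ (_ , none) = ⊥-elim (indep (dep-empty none (dep i)))

  thetaB : ∀ {r k} (B : StateB r k) → DepT (StateB.ℓ B) k → Goal
  thetaB {r} {k} B dk = onMinor (theta⇒minor (roots⇒theta {UU = UU} record
    { uu? = λ a → inPrefix? a ⊎-dec isΓ? a ; uu-u = inj₁ (inj₁ refl) ; uu-ℓ = uu-ℓ
    ; uu-VD = uu-VD ; uu-conn = uu-conn ; root = root ; dep = dep }))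
    where
    open StateB B
    UU : Vtx → Set
    UU a = inPrefix a ⊎ ℓ a ≡ lΓ
    isΓ? : ∀ a → Dec (ℓ a ≡ lΓ)
    isΓ? a with ℓ a
    ... | lO = no λ ()
    ... | lV = no λ ()
    ... | lJ = no λ ()
    ... | lΓ = yes refl
    ... | lT _ = no λ ()
    uu-ℓ : ∀ a → UU a → ℓ a ≡ lO ⊎ ℓ a ≡ lΓ
    uu-ℓ a (inj₁ p) = inj₁ (prefix-ℓ a p)
    uu-ℓ a (inj₂ p) = inj₂ p
    uu-VD : ∀ a → UU a → VD a
    uu-VD a (inj₁ p) = prefix-VD a p
    uu-VD a (inj₂ p) = ℓVD a λ q → case trans (sym p) q of λ ()
    uu-conn : ∀ a → UU a → Star (λ a b → Pos a b × UU a × UU b) u a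
    uu-conn a (inj₁ p) = Star.map (λ (r , p , q) → r , inj₁ p , inj₁ q) (prefix-conn a p)
    uu-conn a (inj₂ p) with both false
    ... | i , ci with hookΓ i ci
    ... | g , lg , r = uu-conn _ (inj₁ (hd-prefix i)) ◅◅ ((r , inj₁ (hd-prefix i) , inj₂ lg) ◅
            Star.map (λ (r , p , q) → r , inj₂ p , inj₂ q) (Star-inside-sym G (Class.reach γ g lg) ◅◅ Class.reach γ a p))
    dep : ∀ i → DepT ℓ i
    dep i with i ≟ k
    ... | yes refl = dk
    ... | no ne = depB i ne
    root : ∀ i → _
    root i with i ≟ k
    ... | no ne = let (x , y , a , b , p , q , r) = rootB i ne in x , y , a , b , p , inj₂ q , r
    ... | yes refl with both true
    ... | j , cj with hookX j cj
    ... | τ , r , inj₁ (re , to) = (τ , re) , to , τ , _ , proj₁ re , inj₁ (hd-prefix j) , Adj-sym G r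
    ... | τ , r , inj₂ (_ , none) = ⊥-elim (indep (dep-empty none dk))

  hook-map : ∀ {ℓ ℓ' : Vtx → Lab} {y c} → (∀ a → ℓ a ≡ c → ℓ' a ≡ c) → (∀ a → ℓ' a ≡ c → ℓ a ≡ c) → (∀ a → ℓ a ≡ lV → ℓ' a ≡ lV) →
    Hook ℓ y c → Hook ℓ' y c
  hook-map f g h (τ , r , inj₁ ((p , re) , a , b , q , s , t)) =
    τ , r , inj₁ ((f τ p , λ c e → relabel f (re c (g c e))) , a , b , f a q , h b s , t)
  hook-map f g h (τ , r , inj₂ (p , none)) = τ , r , inj₂ (h τ p , λ a e → none a (g a e))

  module _ {r : Strands} (C : Common r) (pk : Picked 𝒮 r) where
    open Common C
    open Picked pk

    ℓz : ℓ z ≡ lO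
    ℓz = ℓr _ z (proj₂ z∈r)

    VDz : VD z
    VDz = in-VD (proj₂ base) (proj₁ z∈r) (∈-ʳ++ˡ (r (proj₁ z∈r)) (proj₂ z∈r))

    unlessU : (z ≢ u → Goal) → Goal
    unlessU cont with z ≟ u
    ... | yes refl = avoids-u (proj₂ base) (proj₁ z∈r) (∈-ʳ++ˡ (r (proj₁ z∈r)) (proj₂ z∈r))
    ... | no z≢u = cont z≢u

    module Relabel (z≢u : z ≢ u) (φ : Lab → Lab) (φO : φ lO ≡ lO) (φV : φ lV ≡ lV)
                   (c : Lab) where
      ℓ' : Vtx → Lab
      ℓ' = (φ ∘ ℓ) [ z ≔ c ]

      ℓ'z : ℓ' z ≡ c
      ℓ'z = ≔-here (φ ∘ ℓ) z

      keep : ∀ {a l} → ℓ a ≡ l → l ≢ lO → ℓ' a ≡ φ l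
      keep {a} refl ne = ≔-away (φ ∘ ℓ) λ { refl → ne ℓz }

      unkeep : ∀ a {l} → ℓ' a ≡ l → (a ≡ z × c ≡ l) ⊎ (a ≢ z × φ (ℓ a) ≡ l)
      unkeep a = ≔-cases (φ ∘ ℓ) z a

      common' : (∀ a → ℓ' a ≡ lV → Star (Inside G ℓ' lV) v a) → ¬ Dep (isJ ∘ ℓ') → Common r'
      common' Vc ind = record
        { ℓ = ℓ' ; ℓr = λ i a a∈ → trans (≔-away (φ ∘ ℓ) λ { refl → fresh i a∈ }) (trans (cong φ (ℓr i a (r'⊆r i a∈))) φO)
        ; ℓu = trans (≔-away (φ ∘ ℓ) (z≢u ∘ sym)) (trans (cong φ ℓu) φO)
        ; ℓv = trans (keep ℓv (λ ())) φV
        ; ℓVD = vd ; Vconn = Vc ; indep = ind ; base = put (proj₁ base) , put-Sys (proj₂ base) }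
        where
        vd : ∀ a → ℓ' a ≢ lO → VD a
        vd a ne with a ≟ z
        ... | yes refl = VDz
        ... | no a≢z = ℓVD a λ e → ne (trans (cong φ e) φO)

    module Single (z≢u : z ≢ u) (c : Lab) (c≢V : c ≢ lV) (c≢J : c ≢ lJ) where
      open Relabel z≢u (λ l → l) refl refl c public

      back : ∀ {a l} → ℓ' a ≡ l → c ≢ l → ℓ a ≡ l
      back {a} p ne with unkeep a p
      ... | inj₁ (_ , q) = ⊥-elim (ne q)
      ... | inj₂ (_ , q) = q

      Vconn' : ∀ a → ℓ' a ≡ lV → Star (Inside G ℓ' lV) v a
      Vconn' a e = relabel (λ _ p → keep p (λ ())) (Vconn a (back e c≢V))

      indep' : ¬ Dep (isJ ∘ ℓ')
      indep' d = indep (Dep-mono (λ a p → cong isJ (back (isJ⁻ p) c≢J)) d)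

      single' : Common r'
      single' = common' Vconn' indep'

      mono : ∀ i a → isTJ i (ℓ a) ≡ true → isTJ i (ℓ' a) ≡ true
      mono i a p with isTJ⁻ {i} {ℓ a} p
      ... | inj₁ q = trans (cong (isTJ i) (keep q (λ ()))) (isTJ-T i)
      ... | inj₂ q = cong (isTJ i) (keep q (λ ()))

      hook-keep : ∀ {y i} → c ≢ lT i → Hook ℓ y (lT i) → Hook ℓ' y (lT i)
      hook-keep ne = hook-map (λ _ p → keep p (λ ())) (λ _ p → back p ne) (λ _ p → keep p (λ ()))

      touch-keep : ∀ {d d'} → d ≢ lO → d' ≢ lO → Touches ℓ d d' → Touches ℓ' d d'
      touch-keep ne ne' (a , b , p , q , r) = a , b , keep p ne , keep q ne' , r

      hook-extend : ∀ {i} → c ≡ lT i → Hook ℓ z (lT i) → Reaches ℓ' (lT i) z × Touches ℓ' (lT i) lV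
      hook-extend {i} refl (τ , rr , inj₁ ((p , re) , to)) = (ℓ'z , reach) , touch-keep (λ ()) (λ ()) to
        where
        reach : ∀ a → ℓ' a ≡ lT i → Star (Inside G ℓ' (lT i)) z a
        reach a e with unkeep a e
        ... | inj₁ (refl , _) = ε
        ... | inj₂ (_ , q) = (rr , ℓ'z , keep p (λ ())) ◅ relabel (λ _ p → keep p (λ ())) (re a q)
      hook-extend {i} refl (τ , rr , inj₂ (p , none)) = (ℓ'z , reach) , z , τ , ℓ'z , keep p (λ ()) , rr
        where
        reach : ∀ a → ℓ' a ≡ lT i → Star (Inside G ℓ' (lT i)) z a
        reach a e with unkeep a e
        ... | inj₁ (refl , _) = ε
        ... | inj₂ (_ , q) = ⊥-elim (none a q)

    -- The restart at `z` shared by both phases. Candidate `k` is still independent, so moving it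
    -- into `J` keeps `J` independent, while `z` joins the blob of `v`. Every strand popped at `z`
    -- begins again with an empty candidate next to `z`. Its flag is that of strand `i`, exchanged
    -- at `z` if necessary; `z` causes no trouble there because a second strand passes through it.
    resume : ∀ (z≢u : z ≢ u) (φ : Lab → Lab) (φO : φ lO ≡ lO) (φV : φ lV ≡ lV) →
      let open Relabel z≢u φ φO φV lV in
      ∀ k i → φ lJ ≡ lJ → φ (lT k) ≡ lJ → (∀ l → φ l ≢ lΓ) → (∀ l → φ l ≡ lJ → isTJ k l ≡ true) →
      b i ≡ true → (∃ λ j → j ≢ i × b j ≡ true) → ¬ DepT ℓ k → Flag r ℓ k i →
      (∀ a → φ (ℓ a) ≡ lV → Star (Inside G ℓ' lV) v a) → Star (Inside G ℓ' lV) v z →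
      (∀ j → b j ≡ true → ∀ l → φ l ≢ lT j) →
      (∀ j → b j ≡ false → φ (lT j) ≡ lT j × (∀ l → φ l ≡ lT j → l ≡ lT j) × Hook ℓ (hd u (r j)) (lT j) × (¬ DepT ℓ j → Flag r ℓ j j)) →
      StateA r'
    resume z≢u φ φO φV k i φJ φk φΓ φJ⁻ bi another ¬dk fl Vφ Vz gone stays = record
      { common = common' Vc ind
      ; ℓΓ = λ a e → noΓ a (unkeep a e)
      ; hook = hk
      ; flag = fg }
      where
      open Relabel z≢u φ φO φV lV
      Vc : ∀ a → ℓ' a ≡ lV → Star (Inside G ℓ' lV) v a
      Vc a e with unkeep a e
      ... | inj₁ (refl , _) = Vz
      ... | inj₂ (_ , q) = Vφ a q
      ind : ¬ Dep (isJ ∘ ℓ')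
      ind d = ¬dk (Dep-mono (λ a p → lem a (unkeep a (isJ⁻ p))) d)
        where
        lem : ∀ a → (a ≡ z × lV ≡ lJ) ⊎ (a ≢ z × φ (ℓ a) ≡ lJ) → isTJ k (ℓ a) ≡ true
        lem a (inj₂ (_ , q)) = φJ⁻ (ℓ a) q
      noΓ : ∀ a → (a ≡ z × lV ≡ lΓ) ⊎ (a ≢ z × φ (ℓ a) ≡ lΓ) → ⊥
      noΓ a (inj₂ (_ , q)) = φΓ (ℓ a) q
      hk : ∀ j → Hook ℓ' (hd u (r' j)) (lT j)
      hk j with b j in e
      ... | true = z , end-adj (proj₂ base) j e , inj₂ (ℓ'z , λ a p → lem a (unkeep a p))
        where
        lem : ∀ a → (a ≡ z × lV ≡ lT j) ⊎ (a ≢ z × φ (ℓ a) ≡ lT j) → ⊥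
        lem a (inj₂ (_ , q)) = gone j e (ℓ a) q
      ... | false with stays j e
      ... | φj , φj⁻ , h , _ = subst (λ y → Hook ℓ' y (lT j)) (end-kept j e)
              (hook-map (λ a p → trans (keep p (λ ())) φj) (λ a p → lem a (unkeep a p)) (λ a p → trans (keep p (λ ())) φV) h)
        where
        lem : ∀ a → (a ≡ z × lV ≡ lT j) ⊎ (a ≢ z × φ (ℓ a) ≡ lT j) → ℓ a ≡ lT j
        lem a (inj₂ (_ , q)) = φj⁻ (ℓ a) q
      fg : ∀ j → ¬ DepT ℓ' j → Flag r' ℓ' j j
      fg j ¬d with b j in e
      ... | true = flag-any pk i j bi e mono (inj₂ another) fl
        where
        mono : ∀ a → isTJ k (ℓ a) ≡ true → isTJ j (ℓ' a) ≡ true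
        mono a p with isTJ⁻ {k} {ℓ a} p
        ... | inj₁ q = cong (isTJ j) (trans (keep q (λ ())) φk)
        ... | inj₂ q = cong (isTJ j) (trans (keep q (λ ())) φJ)
      ... | false with stays j e
      ... | φj , φj⁻ , _ , f = flag-pop pk j mono (λ e' → case trans (sym e) e' of λ ()) (f λ d → ¬d (Dep-mono mono d))
        where
        mono : ∀ a → isTJ j (ℓ a) ≡ true → isTJ j (ℓ' a) ≡ true
        mono a p with isTJ⁻ {j} {ℓ a} p
        ... | inj₁ q = trans (cong (isTJ j) (trans (keep q (λ ())) φj)) (isTJ-T j)
        ... | inj₂ q = cong (isTJ j) (trans (keep q (λ ())) φJ)

  module StepA {r : Strands} (A : StateA r) (pk : Picked 𝒮 r) (z≢u : Picked.z pk ≢ u) where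
    open StateA A
    open Picked pk

    -- With no other strand at `z`, the vertex may be private to strand `i`, so its candidate has to
    -- take it.
    push : ∀ i → b i ≡ true → (∀ j → j ≢ i → b j ≡ false) → StateA r'
    push i bi others = record
      { common = single'
      ; ℓΓ = λ a e → ℓΓ a (back e (λ ()))
      ; hook = hk ; flag = fg }
      where
      open Single common pk z≢u (lT i) (λ ()) (λ ())
      hk : ∀ j → Hook ℓ' (hd u (r' j)) (lT j)
      hk j with j ≟ i
      ... | yes refl = z , end-adj (proj₂ base) j bi , inj₁ (hook-extend refl (subst (λ y → Hook ℓ y (lT j)) (end-popped j bi) (hook j)))
      ... | no ne = subst (λ y → Hook ℓ' y (lT j)) (end-kept j (others j ne)) (hook-keep (λ e → ne (sym (lT-inj e))) (hook j))
      fg : ∀ j → ¬ DepT ℓ' j → Flag r' ℓ' j j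
      fg j ¬d = flag-pop pk j (mono j) hz (flag j λ d → ¬d (Dep-mono (mono j) d))
        where
        hz : b j ≡ true → isTJ j (ℓ' z) ≡ true ⊎ ∃ λ l → l ≢ j × b l ≡ true
        hz bj with j ≟ i
        ... | yes refl = inj₁ (trans (cong (isTJ j) ℓ'z) (isTJ-T j))
        ... | no ne = case trans (sym bj) (others j ne) of λ ()

    -- The independent candidate `i` goes to `J`. The other candidates met at `z` are in contact
    -- with `lV` and merge with it, and `z` is attached through the hook of strand `j`.
    fuse : ∀ i j → j ≢ i → b i ≡ true → b j ≡ true → ¬ DepT ℓ i → StateA r'
    fuse i j j≢i bi bj ¬di = resume common pk z≢u φ refl refl i i refl φi φΓ φJ⁻ bi (j , j≢i , bj) ¬di (flag i ¬di) Vφ Vz gone stays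
      where
      ψ : Fin 3 → Lab
      ψ k with k ≟ i
      ... | yes _ = lJ
      ... | no _ = if b k then lV else lT k
      φ : Lab → Lab
      φ lO = lO
      φ lV = lV
      φ lJ = lJ
      φ lΓ = lV
      φ (lT k) = ψ k
      φi : ψ i ≡ lJ
      φi with i ≟ i
      ... | yes _ = refl
      ... | no ¬p = ⊥-elim (¬p refl)
      ψ-true : ∀ {k} → k ≢ i → b k ≡ true → ψ k ≡ lV
      ψ-true {k} ne e with k ≟ i
      ... | yes p = ⊥-elim (ne p)
      ... | no _ = cong (λ s → if s then lV else lT k) e
      ψ-false : ∀ {k} → b k ≡ false → ψ k ≡ lT k
      ψ-false {k} e with k ≟ i
      ... | yes refl = case trans (sym bi) e of λ ()
      ... | no _ = cong (λ s → if s then lV else lT k) e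
      ψ-cases : ∀ k → (k ≡ i × ψ k ≡ lJ) ⊎ (k ≢ i × b k ≡ true × ψ k ≡ lV) ⊎ (b k ≡ false × ψ k ≡ lT k)
      ψ-cases k with k ≟ i
      ... | yes p = inj₁ (p , refl)
      ... | no ne with b k
      ... | true = inj₂ (inj₁ (ne , refl , refl))
      ... | false = inj₂ (inj₂ (refl , refl))
      φΓ : ∀ l → φ l ≢ lΓ
      φΓ (lT k) p with ψ-cases k
      ... | inj₁ (_ , q) = case trans (sym p) q of λ ()
      ... | inj₂ (inj₁ (_ , _ , q)) = case trans (sym p) q of λ ()
      ... | inj₂ (inj₂ (_ , q)) = case trans (sym p) q of λ ()
      φJ⁻ : ∀ l → φ l ≡ lJ → isTJ i l ≡ true
      φJ⁻ lJ p = refl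
      φJ⁻ (lT k) p with ψ-cases k
      ... | inj₁ (refl , q) = isTJ-T i
      ... | inj₂ (inj₁ (_ , _ , q)) = case trans (sym p) q of λ ()
      ... | inj₂ (inj₂ (_ , q)) = case trans (sym p) q of λ ()
      gone : ∀ j → b j ≡ true → ∀ l → φ l ≢ lT j
      gone j bj (lT k) p with ψ-cases k
      ... | inj₁ (_ , q) = case trans (sym p) q of λ ()
      ... | inj₂ (inj₁ (_ , _ , q)) = case trans (sym p) q of λ ()
      ... | inj₂ (inj₂ (bk , q)) with lT-inj (trans (sym q) p)
      ... | refl = case trans (sym bj) bk of λ ()
      stays : ∀ j → b j ≡ false → φ (lT j) ≡ lT j × (∀ l → φ l ≡ lT j → l ≡ lT j) × Hook ℓ (hd u (r j)) (lT j) × (¬ DepT ℓ j → Flag r ℓ j j)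
      stays j bj = ψ-false bj , inv , hook j , flag j
        where
        inv : ∀ l → φ l ≡ lT j → l ≡ lT j
        inv (lT k) p with ψ-cases k
        ... | inj₁ (_ , q) = case trans (sym p) q of λ ()
        ... | inj₂ (inj₁ (_ , _ , q)) = case trans (sym p) q of λ ()
        ... | inj₂ (inj₂ (bk , q)) = trans (sym q) p
      open Relabel common pk z≢u φ refl refl lV
      oldV : ∀ a → ℓ a ≡ lV → Star (Inside G ℓ' lV) v a
      oldV a e = relabel (λ _ p → keep p (λ ())) (Vconn a e)
      joinT : ∀ k → k ≢ i → b k ≡ true → ∀ a → ℓ a ≡ lT k → Star (Inside G ℓ' lV) v a
      joinT k ne bk a e with hook k
      ... | τ , _ , inj₂ (_ , none) = ⊥-elim (none a e)
      ... | τ , _ , inj₁ ((p , re) , c , d , pc , pd , s) = oldV d pd ◅◅ ((Adj-sym G s , keep pd (λ ()) , toV c pc) ◅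
              relabel toV (Star-inside-sym G (re c pc) ◅◅ re a e))
        where
        toV : ∀ a → ℓ a ≡ lT k → ℓ' a ≡ lV
        toV a e = trans (keep e (λ ())) (ψ-true ne bk)
      Vφ : ∀ a → φ (ℓ a) ≡ lV → Star (Inside G ℓ' lV) v a
      Vφ a e with ℓ a in eq
      ... | lV = oldV a eq
      ... | lΓ = ⊥-elim (ℓΓ a eq)
      ... | lT k with ψ-cases k
      ... | inj₁ (_ , q) = case trans (sym e) q of λ ()
      ... | inj₂ (inj₁ (ne , bk , q)) = joinT k ne bk a eq
      ... | inj₂ (inj₂ (_ , q)) = case trans (sym e) q of λ ()
      Vz : Star (Inside G ℓ' lV) v z
      Vz with hook j
      ... | τ , s , inj₂ (p , _) = oldV τ p ◅◅ ((Adj-sym G (subst (λ y → Pos y τ) (end-popped j bj) s) , keep p (λ ()) , ℓ'z) ◅ ε)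
      ... | τ , s , inj₁ ((p , _) , _) = joinT j j≢i bj τ p ◅◅
              ((Adj-sym G (subst (λ y → Pos y τ) (end-popped j bj) s) , trans (keep p (λ ())) (ψ-true j≢i bj) , ℓ'z) ◅ ε)

    -- Both candidates at `z` are dependent, so neither may go to `J`. Instead `z` becomes the first
    -- vertex of `lΓ` and is adjacent to both; only strand `k` still extends a candidate.
    enterB : ∀ k → (∀ i → i ≢ k → b i ≡ true) → b k ≡ false → (∀ i → i ≢ k → DepT ℓ i) → ¬ DepT ℓ k → StateB r' k
    enterB k bo bk deps ¬dk = record
      { common = single'
      ; γ = class z ℓ'z λ a e → star a (unkeep a e)
      ; rootB = rt
      ; depB = λ i ne → Dep-mono (mono i) (deps i ne)
      ; col = λ i → does (i ≟ k)
      ; both = both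
      ; hookΓ = λ i e → z , ℓ'z , end-adj (proj₂ base) i (bo i (isNo i e))
      ; hookX = hx
      ; single = λ _ i j p q → trans (isYes i p) (sym (isYes j q))
      ; flagX = fx }
      where
      open Single common pk z≢u lΓ (λ ()) (λ ())
      isYes : ∀ i → does (i ≟ k) ≡ true → i ≡ k
      isYes i e with i ≟ k
      ... | yes p = p
      isNo : ∀ i → does (i ≟ k) ≡ false → i ≢ k
      isNo i e with i ≟ k
      ... | no p = p
      star : ∀ a → (a ≡ z × lΓ ≡ lΓ) ⊎ (a ≢ z × ℓ a ≡ lΓ) → Star (Inside G ℓ' lΓ) z a
      star a (inj₁ (refl , _)) = ε
      star a (inj₂ (_ , p)) = ⊥-elim (ℓΓ a p)
      both : ∀ d → ∃ λ i → does (i ≟ k) ≡ d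
      both true = k , lem
        where
        lem : does (k ≟ k) ≡ true
        lem with k ≟ k
        ... | yes _ = refl
        ... | no ¬p = ⊥-elim (¬p refl)
      both false = next3 k , lem
        where
        lem : does (next3 k ≟ k) ≡ false
        lem with next3 k ≟ k
        ... | yes p = ⊥-elim (next3-≢ k (sym p))
        ... | no _ = refl
      rt : ∀ i → i ≢ k → (∃ λ τ → Reaches ℓ' (lT i) τ) × Touches ℓ' (lT i) lV × Touches ℓ' (lT i) lΓ
      rt i ne with hook i
      ... | τ , s , inj₂ (_ , none) = ⊥-elim (indep (dep-empty none (deps i ne)))
      ... | τ , s , inj₁ ((p , re) , to) = (τ , keep p (λ ()) , λ a e → relabel (λ _ p → keep p (λ ())) (re a (back e (λ ()))))
              , touch-keep (λ ()) (λ ()) to , τ , z , keep p (λ ()) , ℓ'z , Adj-sym G (subst (λ y → Pos y τ) (end-popped i (bo i ne)) s)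
      hx : ∀ i → does (i ≟ k) ≡ true → Hook ℓ' (hd u (r' i)) (lT k)
      hx i e with isYes i e
      ... | refl = subst (λ y → Hook ℓ' y (lT k)) (end-kept k bk) (hook-keep (λ ()) (hook k))
      fx : ∀ i → does (i ≟ k) ≡ true → Flag r' ℓ' k i
      fx i e with isYes i e
      ... | refl = flag-pop pk k (mono k) (λ e' → case trans (sym bk) e' of λ ()) (flag k ¬dk)

  module StepB {r : Strands} {k : Fin 3} (B : StateB r k) (pk : Picked 𝒮 r) (z≢u : Picked.z pk ≢ u) where
    open StateB B
    open Picked pk

    private
      open module Col (C : Coloured b col) = Coloured C using (col'; strand; strand-b; strand-col; has) public

      col'-cases : ∀ C i → (b i ≡ true × col' C i ≡ Coloured.c C) ⊎ (b i ≡ false × col' C i ≡ col i)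
      col'-cases C i with b i
      ... | true = inj₁ (refl , refl)
      ... | false = inj₂ (refl , refl)

    -- All strands through `z` now lead into `lΓ`. One of them did so before, which keeps `lΓ`
    -- connected.
    advanceΓ : (C : Coloured b col) → Coloured.c C ≡ false → StateB r' k
    advanceΓ C c≡ = record
      { common = single'
      ; γ = γ'
      ; rootB = λ i ne → let ((τ , p , re) , to , tg) = rootB i ne in
          (τ , keep p (λ ()) , λ a e → relabel (λ _ p → keep p (λ ())) (re a (back e (λ ())))) , touch-keep (λ ()) (λ ()) to , touch-keep (λ ()) (λ ()) tg
      ; depB = λ i ne → Dep-mono (mono i) (depB i ne)
      ; col = col' C ; both = has C ; hookΓ = hΓ ; hookX = hX
      ; single = λ none i j p q → single (λ a e → none a (keep e (λ ()))) i j (proj₂ (wasX i p)) (proj₂ (wasX j q))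
      ; flagX = fX }
      where
      open Single common pk z≢u lΓ (λ ()) (λ ())
      i₀ = strand C
      near = hookΓ i₀ (trans (strand-col C) c≡)
      g = proj₁ near
      zg : Pos g z
      zg = Adj-sym G (subst (λ y → Pos y g) (end-popped i₀ (strand-b C)) (proj₂ (proj₂ near)))
      γ' : Class G ℓ' lΓ
      γ' = class (Class.centre γ) (keep (Class.centre-in γ) (λ ())) rch
        where
        old : ∀ a → ℓ a ≡ lΓ → Star (Inside G ℓ' lΓ) (Class.centre γ) a
        old a e = relabel (λ _ p → keep p (λ ())) (Class.reach γ a e)
        rch : ∀ a → ℓ' a ≡ lΓ → Star (Inside G ℓ' lΓ) (Class.centre γ) a
        rch a e with unkeep a e
        ... | inj₁ (refl , _) = old g (proj₁ (proj₂ near)) ◅◅ ((zg , keep (proj₁ (proj₂ near)) (λ ()) , ℓ'z) ◅ ε)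
        ... | inj₂ (_ , q) = old a q
      wasX : ∀ i → col' C i ≡ true → b i ≡ false × col i ≡ true
      wasX i p with col'-cases C i
      ... | inj₁ (_ , q) = case trans (sym p) (trans q c≡) of λ ()
      ... | inj₂ (bi , q) = bi , trans (sym q) p
      hΓ : ∀ i → col' C i ≡ false → ∃ λ g → ℓ' g ≡ lΓ × Pos (hd u (r' i)) g
      hΓ i e with col'-cases C i
      ... | inj₁ (bi , _) = z , ℓ'z , end-adj (proj₂ base) i bi
      ... | inj₂ (bi , q) = let (g , p , s) = hookΓ i (trans (sym q) e) in g , keep p (λ ()) , subst (λ y → Pos y g) (end-kept i bi) s
      hX : ∀ i → col' C i ≡ true → Hook ℓ' (hd u (r' i)) (lT k)
      hX i e = let (bi , ci) = wasX i e in subst (λ y → Hook ℓ' y (lT k)) (end-kept i bi) (hook-keep (λ ()) (hookX i ci))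
      fX : ∀ i → col' C i ≡ true → Flag r' ℓ' k i
      fX i e = let (bi , ci) = wasX i e in flag-pop pk i (mono k) (λ e' → case trans (sym bi) e' of λ ()) (flagX i ci)

    advanceX : (C : Coloured b col) → Coloured.c C ≡ true → StateB r' k
    advanceX C c≡ = record
      { common = single'
      ; γ = class (Class.centre γ) (keep (Class.centre-in γ) (λ ())) λ a e → relabel (λ _ p → keep p (λ ())) (Class.reach γ a (back e (λ ())))
      ; rootB = λ i ne → let ((τ , p , re) , to , tg) = rootB i ne in
          (τ , keep p (λ ()) , λ a e → relabel (λ _ p → keep p (λ ())) (re a (back e (λ q → ne (sym (lT-inj q)))))) , touch-keep (λ ()) (λ ()) to , touch-keep (λ ()) (λ ()) tg
      ; depB = λ i ne → Dep-mono (mono i) (depB i ne)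
      ; col = col' C ; both = has C ; hookΓ = hΓ ; hookX = hX
      ; single = λ none → ⊥-elim (none z ℓ'z)
      ; flagX = fX }
      where
      open Single common pk z≢u (lT k) (λ ()) (λ ())
      i₀ = strand C
      colᵢ₀ = trans (strand-col C) c≡
      hook₀ : Hook ℓ z (lT k)
      hook₀ = subst (λ y → Hook ℓ y (lT k)) (end-popped i₀ (strand-b C)) (hookX i₀ colᵢ₀)
      ext : Reaches ℓ' (lT k) z × Touches ℓ' (lT k) lV
      ext = hook-extend refl hook₀
      hΓ : ∀ i → col' C i ≡ false → ∃ λ g → ℓ' g ≡ lΓ × Pos (hd u (r' i)) g
      hΓ i e with col'-cases C i
      ... | inj₁ (_ , q) = case trans (sym e) (trans q c≡) of λ ()
      ... | inj₂ (bi , q) = let (g , p , s) = hookΓ i (trans (sym q) e) in g , keep p (λ ()) , subst (λ y → Pos y g) (end-kept i bi) s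
      hX : ∀ i → col' C i ≡ true → Hook ℓ' (hd u (r' i)) (lT k)
      hX i e with col'-cases C i
      ... | inj₁ (bi , _) = z , end-adj (proj₂ base) i bi , inj₁ ext
      ... | inj₂ (bi , q) with hookX i (trans (sym q) e)
      ... | τ , s , inj₁ ((p , _) , _) = τ , subst (λ y → Pos y τ) (end-kept i bi) s ,
              inj₁ ((keep p (λ ()) , λ a e → Star-inside-sym G (proj₂ (proj₁ ext) τ (keep p (λ ()))) ◅◅ proj₂ (proj₁ ext) a e) , proj₂ ext)
      -- An empty candidate is extended by one strand only, which would have to be both the popped
      -- strand `i₀` and the kept strand `i`.
      ... | τ , s , inj₂ (_ , none) with single none i i₀ (trans (sym q) e) colᵢ₀
      ... | refl = case trans (sym bi) (strand-b C) of λ ()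
      fX : ∀ i → col' C i ≡ true → Flag r' ℓ' k i
      fX i e with col'-cases C i
      ... | inj₁ (bi , _) = flag-any pk i₀ i (strand-b C) bi (mono k) (inj₁ (trans (cong (isTJ k) ℓ'z) (isTJ-T k))) (flagX i₀ colᵢ₀)
      ... | inj₂ (bi , q) = flag-pop pk i (mono k) (λ e' → case trans (sym bi) e' of λ ()) (flagX i (trans (sym q) e))

    -- A vertex on all three strands would leave only one colour. If candidate `k` is still
    -- independent it goes to `J`, the dependent candidates and `lΓ` merge with `lV`, and the first
    -- phase resumes at `z`.
    leave : (∀ i → b i ≡ true) → ¬ DepT ℓ k → StateA r'
    leave all ¬dk = resume common pk z≢u φ refl refl k i refl φk φΓ φJ⁻ (all i) (next3 i , (λ e → next3-≢ i (sym e)) , all _) ¬dk (flagX i ci)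
        Vφ Vz gone (λ j bj → case trans (sym (all j)) bj of λ ())
      where
      i = proj₁ (both true)
      ci = proj₂ (both true)
      ψ : Fin 3 → Lab
      ψ j with j ≟ k
      ... | yes _ = lJ
      ... | no _ = lV
      φ : Lab → Lab
      φ lO = lO
      φ lV = lV
      φ lJ = lJ
      φ lΓ = lV
      φ (lT k) = ψ k
      ψ-cases : ∀ j → (j ≡ k × ψ j ≡ lJ) ⊎ (j ≢ k × ψ j ≡ lV)
      ψ-cases j with j ≟ k
      ... | yes p = inj₁ (p , refl)
      ... | no p = inj₂ (p , refl)
      φk : ψ k ≡ lJ
      φk with k ≟ k
      ... | yes _ = refl
      ... | no ¬p = ⊥-elim (¬p refl)
      ψ-V : ∀ {j} → j ≢ k → ψ j ≡ lV
      ψ-V {j} ne with j ≟ k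
      ... | yes p = ⊥-elim (ne p)
      ... | no _ = refl
      φΓ : ∀ l → φ l ≢ lΓ
      φΓ (lT j) p with ψ-cases j
      ... | inj₁ (_ , q) = case trans (sym p) q of λ ()
      ... | inj₂ (_ , q) = case trans (sym p) q of λ ()
      φJ⁻ : ∀ l → φ l ≡ lJ → isTJ k l ≡ true
      φJ⁻ lJ p = refl
      φJ⁻ (lT j) p with ψ-cases j
      ... | inj₁ (refl , q) = isTJ-T k
      ... | inj₂ (_ , q) = case trans (sym p) q of λ ()
      gone : ∀ j → b j ≡ true → ∀ l → φ l ≢ lT j
      gone j bj (lT j') p with ψ-cases j'
      ... | inj₁ (_ , q) = case trans (sym p) q of λ ()
      ... | inj₂ (_ , q) = case trans (sym p) q of λ ()
      open Relabel common pk z≢u φ refl refl lV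
      oldV : ∀ a → ℓ a ≡ lV → Star (Inside G ℓ' lV) v a
      oldV a e = relabel (λ _ p → keep p (λ ())) (Vconn a e)
      joinT : ∀ j → j ≢ k → ∀ a → ℓ a ≡ lT j → Star (Inside G ℓ' lV) v a
      joinT j ne a e with rootB j ne
      ... | (τ , p , re) , (c , d , pc , pd , s) , _ = oldV d pd ◅◅ ((Adj-sym G s , keep pd (λ ()) , toV c pc) ◅
              relabel toV (Star-inside-sym G (re c pc) ◅◅ re a e))
        where
        toV : ∀ a → ℓ a ≡ lT j → ℓ' a ≡ lV
        toV a e = trans (keep e (λ ())) (ψ-V ne)
      joinΓ : ∀ a → ℓ a ≡ lΓ → Star (Inside G ℓ' lV) v a
      joinΓ a e with rootB (next3 k) (λ e → next3-≢ k (sym e))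
      ... | _ , _ , c , d , pc , pd , s = joinT (next3 k) (λ e → next3-≢ k (sym e)) c pc ◅◅
              ((s , trans (keep pc (λ ())) (ψ-V (λ e → next3-≢ k (sym e))) , keep pd (λ ())) ◅
              relabel (λ _ p → keep p (λ ())) (Star-inside-sym G (Class.reach γ d pd) ◅◅ Class.reach γ a e))
      Vφ : ∀ a → φ (ℓ a) ≡ lV → Star (Inside G ℓ' lV) v a
      Vφ a e with ℓ a in eq
      ... | lV = oldV a eq
      ... | lΓ = joinΓ a eq
      ... | lT j with ψ-cases j
      ... | inj₁ (_ , q) = case trans (sym e) q of λ ()
      ... | inj₂ (ne , _) = joinT j ne a eq
      Vz : Star (Inside G ℓ' lV) v z
      Vz with both false
      ... | j , cj with hookΓ j cj
      ... | g , lg , s = joinΓ g lg ◅◅ ((Adj-sym G (subst (λ y → Pos y g) (end-popped j (all j)) s) , keep lg (λ ()) , ℓ'z) ◅ ε)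

  -- When `z` ends at least two prefixes, one of three things holds: a popped strand has an
  -- independent candidate (`fuse`), all candidates are dependent (`thetaA`), or exactly the third
  -- strand, not popped, has an independent one (`enterB`).
  phaseA : ∀ f r → StateA r → sum3 (length ∘ r) < f → Goal
  -- At a vertex missed by some strand the popped strands are recoloured. At a vertex of all three,
  -- either candidate `k` has become dependent or the first phase resumes. When the prefixes are
  -- used up, the mate of a strand extending candidate `k` shows that it is dependent.
  phaseB : ∀ f r k → StateB r k → sum3 (length ∘ r) < f → Goal

  phaseA (suc f) r A (s≤s le) = pick 𝒮 r (proj₂ base) found ended
    where
    open StateA A
    ended : (∀ i → r i ≡ []) → Goal
    ended empty with any? (λ i → ¬? (dep? (isTJ i ∘ ℓ)))
    ... | no none = thetaA A λ i → decidable-stable (dep? (isTJ i ∘ ℓ)) λ ¬d → none (i , ¬d)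
    ... | yes (i , ¬d) = flag⇒dep (flag i ¬d) (λ a a∈ → case subst (a ∈_) (empty i) a∈ of λ ()) λ d → ⊥-elim (¬d d)
    found : Picked 𝒮 r → Goal
    found pk = unlessU common pk λ z≢u → go z≢u
      where
      open Picked pk
      lt : sum3 (length ∘ r') < f
      lt = ℕₚ.<-≤-trans smaller le
      go : z ≢ u → Goal
      go z≢u with any? (λ j → ¬? (j ≟ proj₁ some) ×-dec (b j Data.Bool.≟ true))
      ... | no alone = phaseA f r' (push (proj₁ some) (proj₂ some) λ j ne → ≢true λ bj → alone (j , ne , bj)) lt
        where open StepA A pk z≢u
      ... | yes (j , j≢i , bj) with any? (λ k → (b k Data.Bool.≟ true) ×-dec ¬? (dep? (isTJ k ∘ ℓ)))
      ... | yes (k , bk , ¬dk) = phaseA f r' (proj₂ another) lt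
        where
        open StepA A pk z≢u
        another : Fin 3 × StateA r'
        another with k ≟ j
        ... | no ne = j , fuse k j (λ e → ne (sym e)) bk bj ¬dk
        ... | yes refl = proj₁ some , fuse k (proj₁ some) (λ e → j≢i (sym e)) bk (proj₂ some) ¬dk
      ... | no none with any? (λ k → ¬? (dep? (isTJ k ∘ ℓ)))
      ... | no allDep = thetaA A λ i → decidable-stable (dep? (isTJ i ∘ ℓ)) λ ¬d → allDep (i , ¬d)
      ... | yes (k , ¬dk) = phaseB f r' k (enterB k bo bk (λ i ne → decidable-stable (dep? (isTJ i ∘ ℓ)) λ ¬d → none (i , bo i ne , ¬d)) ¬dk) lt
        where
        open StepA A pk z≢u
        bk : b k ≡ false
        bk = ≢true λ e → none (k , e , ¬dk)
        k≢ : ∀ {i} → b i ≡ true → i ≢ k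
        k≢ bi refl = case trans (sym bi) bk of λ ()
        bo : ∀ i → i ≢ k → b i ≡ true
        bo i ne with cover3 (proj₁ some) j k i (λ e → j≢i (sym e)) (k≢ (proj₂ some)) (k≢ bj)
        ... | inj₁ refl = proj₂ some
        ... | inj₂ (inj₁ refl) = bj
        ... | inj₂ (inj₂ e) = ⊥-elim (ne e)

  phaseB (suc f) r k B (s≤s le) = pick 𝒮 r (proj₂ base) found ended
    where
    open StateB B
    ended : (∀ i → r i ≡ []) → Goal
    ended empty = flag⇒dep (flagX i ci) (λ a a∈ → case subst (a ∈_) (empty i) a∈ of λ ()) (thetaB B)
      where
      i = proj₁ (both true)
      ci = proj₂ (both true)
    found : Picked 𝒮 r → Goal
    found pk = unlessU common pk λ z≢u → go z≢u
      where
      open Picked pk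
      lt : sum3 (length ∘ r') < f
      lt = ℕₚ.<-≤-trans smaller le
      go : z ≢ u → Goal
      go z≢u with any? (λ i → b i Data.Bool.≟ false)
      ... | yes notAll with recolour b col both some notAll
      ... | C = phaseB f r' k (byColour (Coloured.c C) refl) lt
        where
        open StepB B pk z≢u
        byColour : ∀ c → Coloured.c C ≡ c → StateB r' k
        byColour true e = advanceX C e
        byColour false e = advanceΓ C e
      go z≢u | no all with dep? (isTJ k ∘ ℓ)
      ... | yes d = thetaB B d
      ... | no ¬d = phaseA f r' (leave (λ i → isTrue λ e → all (i , e)) ¬d) lt
        where
        open StepB B pk z≢u
        isTrue : ∀ {s} → s ≢ false → s ≡ true
        isTrue {true} _ = refl
        isTrue {false} h = ⊥-elim (h refl)

  sweep : ∀ {P} → Sys P → u ≢ v → (∀ i → v ∉ P i) → Goal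
  sweep {P} S u≢v v∉ with any? (λ i → u ∈? P i)
  ... | yes (i , u∈) = avoids-u S i u∈
  ... | no u∉ = phaseA _ r record
      { common = record
        { ℓ = ℓ ; ℓr = λ i a a∈ → ≔-away (λ _ → lO) {v} {lV} {a} λ { refl → v∉ i (sub i a∈) } ; ℓu = ≔-away (λ _ → lO) u≢v ; ℓv = ≔-here _ v
        ; ℓVD = λ a ne → vd a ne ; Vconn = λ a e → vc a e ; indep = λ d → not-empty (Dep-mono (λ a p → ⊥-elim (noJ a p)) d)
        ; base = (λ _ → []) , S' }
      ; ℓΓ = λ a e → case ≔-cases _ v a e of λ { (inj₁ (_ , ())) ; (inj₂ (_ , ())) }
      ; hook = λ i → v , proj₂ (chain-ʳ++ (r i) (adjacent S' i)) , inj₂ (≔-here _ v , λ a e → case ≔-cases _ v a e of λ { (inj₁ (_ , ())) ; (inj₂ (_ , ())) })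
      ; flag = λ i _ → flagged (λ _ → []) S' λ a () } ℕₚ.≤-refl
    where
    r : Strands
    r i = reverse (P i)
    sub : ∀ i {a} → a ∈ r i → a ∈ P i
    sub i {a} a∈ = Anyₚ.reverse⁻ a∈
    S' : Sys (λ i → r i ʳ++ [])
    S' = resp (λ i → sym (trans (ʳ++-defn (r i)) (trans (++-identityʳ _) (reverse-involutive (P i))))) S
    ℓ : Vtx → Lab
    ℓ = (λ _ → lO) [ v ≔ lV ]
    vd : ∀ a → ℓ a ≢ lO → VD a
    vd a ne with a ≟ v
    ... | yes refl = VDv
    ... | no _ = ⊥-elim (ne refl)
    vc : ∀ a → ℓ a ≡ lV → Star (Inside G ℓ lV) v a
    vc a e with a ≟ v
    ... | yes refl = ε
    noJ : ∀ a → isJ (ℓ a) ≢ true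
    noJ a e with a ≟ v
    noJ a () | yes _
    noJ a () | no _

-- Parity

par : ℕ → Bool
par zero = false
par (suc n) = not (par n)

par-+ : ∀ a b → par (a + b) ≡ par a xor par b
par-+ zero b = refl
par-+ (suc a) b with par a | par (a + b) | par-+ a b
... | true | _ | refl = not-involutive (par b)
... | false | _ | refl = refl

par-bit : ∀ b → par (bit b) ≡ b
par-bit true = refl
par-bit false = refl

not≢ : ∀ b → not b ≢ b
not≢ true ()
not≢ false ()

par-gap : ∀ {a b} → par a ≡ par b → a < b → 2 + a ≤ b
par-gap {a} {b} p lt with ℕₚ.m≤n⇒m<n∨m≡n lt
... | inj₁ q = q
... | inj₂ refl = ⊥-elim (not≢ (par a) (sym p))

xor-cancel : ∀ {a b c} → a xor b ≡ c → b ≡ c xor a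
xor-cancel {true} {true} refl = refl
xor-cancel {true} {false} refl = refl
xor-cancel {false} {true} refl = refl
xor-cancel {false} {false} refl = refl

δ : ∀ {m} → Fin m → Fin m → ℕ
δ e f = bit (does (e ≟ f))

δ-self : ∀ {m} (e : Fin m) → δ e e ≡ 1
δ-self e with e ≟ e
... | yes _ = refl
... | no ¬p = ⊥-elim (¬p refl)

δ-other : ∀ {m} {e f : Fin m} → e ≢ f → δ e f ≡ 0
δ-other {e = e} {f} ne with e ≟ f
... | yes p = ⊥-elim (ne p)
... | no _ = refl

sumF-zero : ∀ {m} {f : Fin m → ℕ} → (∀ i → f i ≡ 0) → sumF f ≡ 0
sumF-zero {zero} e = refl
sumF-zero {suc m} e = cong₂ _+_ (e zero) (sumF-zero (e ∘ suc))

sumF-zero⁻ : ∀ {m} {f : Fin m → ℕ} → sumF f ≡ 0 → ∀ i → f i ≡ 0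
sumF-zero⁻ {suc m} {f} p zero = ℕₚ.m+n≡0⇒m≡0 (f zero) p
sumF-zero⁻ {suc m} {f} p (suc i) = sumF-zero⁻ (ℕₚ.m+n≡0⇒n≡0 (f zero) p) i

sumF-δ : ∀ {m} (h : Fin m → ℕ) e → sumF (λ f → h f * δ e f) ≡ h e
sumF-δ {suc m} h zero = trans (cong₂ _+_ (ℕₚ.*-identityʳ (h zero)) (sumF-zero λ i → ℕₚ.*-zeroʳ (h (suc i)))) (ℕₚ.+-identityʳ (h zero))
sumF-δ {suc m} h (suc e) = cong₂ _+_ (ℕₚ.*-zeroʳ (h zero)) (trans (sumF-≡ λ i → cong (h (suc i) *_) (shift e i)) (sumF-δ (h ∘ suc) e))
  where
  shift : ∀ {m} (e f : Fin m) → δ (suc e) (suc f) ≡ δ e f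
  shift e f with e ≟ f
  ... | yes _ = refl
  ... | no _ = refl

-- Walks, trails and odd closed walks

module Walks {n m} (G : SG n m) where

  data Walk : Fin n → Fin n → Set where
    [] : ∀ {a} → Walk a a
    cons : ∀ {a b c} (f : Fin m) → Joins G f a b → Walk b c → Walk a c

  cnt : ∀ {a b} → Walk a b → Fin m → ℕ
  cnt [] f = 0
  cnt (cons e _ p) f = δ e f + cnt p f

  sgn : ∀ {a b} → Walk a b → Bool
  sgn [] = false
  sgn (cons e _ p) = neg G e xor sgn p

  len' : ∀ {a b} → Walk a b → ℕ
  len' [] = 0
  len' (cons _ _ p) = suc (len' p)

  -- The final vertex is left out, so concatenation becomes `++` and a closed walk does not list its
  -- base point twice.
  vs : ∀ {a b} → Walk a b → List (Fin n)
  vs [] = []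
  vs (cons {a} _ _ p) = a ∷ vs p

  infixr 5 _⊙_
  _⊙_ : ∀ {a b c} → Walk a b → Walk b c → Walk a c
  [] ⊙ q = q
  cons f j p ⊙ q = cons f j (p ⊙ q)

  joins-sym : ∀ {f a b} → Joins G f a b → Joins G f b a
  joins-sym (inj₁ p) = inj₂ p
  joins-sym (inj₂ p) = inj₁ p

  rev : ∀ {a b} → Walk a b → Walk b a
  rev [] = []
  rev (cons f j p) = rev p ⊙ cons f (joins-sym j) []

  cnt-⊙ : ∀ {a b c} (p : Walk a b) (q : Walk b c) f → cnt (p ⊙ q) f ≡ cnt p f + cnt q f
  cnt-⊙ [] q f = refl
  cnt-⊙ (cons e _ p) q f = trans (cong (δ e f +_) (cnt-⊙ p q f)) (sym (ℕₚ.+-assoc (δ e f) _ _))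

  sgn-⊙ : ∀ {a b c} (p : Walk a b) (q : Walk b c) → sgn (p ⊙ q) ≡ sgn p xor sgn q
  sgn-⊙ [] q = refl
  sgn-⊙ (cons e _ p) q = trans (cong (neg G e xor_) (sgn-⊙ p q)) (sym (xor-assoc (neg G e) _ _))

  len-⊙ : ∀ {a b c} (p : Walk a b) (q : Walk b c) → len' (p ⊙ q) ≡ len' p + len' q
  len-⊙ [] q = refl
  len-⊙ (cons e _ p) q = cong suc (len-⊙ p q)

  vs-⊙ : ∀ {a b c} (p : Walk a b) (q : Walk b c) → vs (p ⊙ q) ≡ vs p ++ vs q
  vs-⊙ [] q = refl
  vs-⊙ (cons e _ p) q = cong (_ ∷_) (vs-⊙ p q)

  cnt-rev : ∀ {a b} (p : Walk a b) f → cnt (rev p) f ≡ cnt p f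
  cnt-rev [] f = refl
  cnt-rev (cons e j p) f = trans (cnt-⊙ (rev p) _ f) (trans (cong₂ _+_ (cnt-rev p f) (ℕₚ.+-identityʳ (δ e f))) (ℕₚ.+-comm _ (δ e f)))

  sgn-rev : ∀ {a b} (p : Walk a b) → sgn (rev p) ≡ sgn p
  sgn-rev [] = refl
  sgn-rev (cons e j p) = trans (sgn-⊙ (rev p) _) (trans (cong₂ _xor_ (sgn-rev p) (xor-identityʳ (neg G e))) (xor-comm _ (neg G e)))

  record Split {a b} (p : Walk a b) (f : Fin m) : Set where
    constructor split
    field
      {s t} : Fin n
      before : Walk a s
      joins : Joins G f s t
      after : Walk t b
      whole : p ≡ before ⊙ cons f joins after

  splitAt : ∀ {a b} (p : Walk a b) f → 0 < cnt p f → Split p f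
  splitAt (cons e j p) f lt with e ≟ f
  ... | yes refl = split [] j p refl
  ... | no _ with splitAt p f lt
  ... | split q k r refl = split (cons e j q) k r refl

  Closed : Set
  Closed = ∃ λ a → Walk a a

  cntC : Closed → Fin m → ℕ
  cntC (_ , p) = cnt p

  Odd : Closed → Set
  Odd (_ , p) = sgn p ≡ true

  data Twice {a b} (f : Fin m) : Walk a b → Set where
    along : ∀ {s t} (p : Walk a s) (j k : Joins G f s t) (q : Walk t s) (r : Walk t b) → Twice f (p ⊙ cons f j (q ⊙ cons f k r))
    against : ∀ {s t} (p : Walk a s) (j : Joins G f s t) (k : Joins G f t s) (q : Walk t t) (r : Walk s b) → Twice f (p ⊙ cons f j (q ⊙ cons f k r))

  splitLast : ∀ {a b} (p : Walk a b) f → 1 < cnt p f → Σ (Split p f) λ s → 0 < cnt (Split.after s) f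
  splitLast (cons e j p) f lt with e ≟ f
  ... | yes refl = split [] j p refl , ℕₚ.≤-pred lt
  ... | no _ with splitLast p f lt
  ... | split q k r refl , h = split (cons e j q) k r refl , h

  twice : ∀ {a b} (p : Walk a b) f → 1 < cnt p f → Twice f p
  twice p f lt with splitLast p f lt
  ... | split q j r refl , h with splitAt r f h
  ... | split q' k r' refl with joins-ends G j k
  ... | inj₁ (refl , refl) = along q j k q' r'
  ... | inj₂ (refl , refl) = against q j k q' r'

  cnt-twice : ∀ {a b s t s' t'} (p : Walk a s) {f} (j : Joins G f s t) (q : Walk t s') (k : Joins G f s' t') (r : Walk t' b) g →
    cnt (p ⊙ cons f j (q ⊙ cons f k r)) g ≡ cnt p g + (δ f g + (cnt q g + (δ f g + cnt r g)))
  cnt-twice p {f} j q k r g = trans (cnt-⊙ p _ g) (cong (λ h → cnt p g + (δ f g + h)) (cnt-⊙ q _ g))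

  len-twice : ∀ {a b s t s' t'} (p : Walk a s) {f} (j : Joins G f s t) (q : Walk t s') (k : Joins G f s' t') (r : Walk t' b) →
    len' (p ⊙ cons f j (q ⊙ cons f k r)) ≡ len' p + suc (len' q + suc (len' r))
  len-twice p j q k r = trans (len-⊙ p _) (cong (λ h → len' p + suc h) (len-⊙ q _))

  sgn-twice : ∀ {a b s t s' t'} (p : Walk a s) {f} (j : Joins G f s t) (q : Walk t s') (k : Joins G f s' t') (r : Walk t' b) →
    sgn (p ⊙ cons f j (q ⊙ cons f k r)) ≡ sgn p xor (neg G f xor (sgn q xor (neg G f xor sgn r)))
  sgn-twice p {f} j q k r = trans (sgn-⊙ p _) (cong (λ h → sgn p xor (neg G f xor h)) (sgn-⊙ q _))

  IsTrail : (Fin m → ℕ) → Set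
  IsTrail c = ∀ f → c f ≤ 1

  repeated? : ∀ {a b} (p : Walk a b) → (∃ λ f → 1 < cnt p f) ⊎ IsTrail (cnt p)
  repeated? p with any? (λ f → 1 ℕ.<? cnt p f)
  ... | yes h = inj₁ h
  ... | no none = inj₂ λ f → ℕₚ.≮⇒≥ λ lt → none (f , lt)

  shorter-≤ : ∀ a b c d → a + d ≤ a + (b + (c + (b + d)))
  shorter-≤ a b c d = ℕₚ.+-monoʳ-≤ a (ℕₚ.≤-trans (ℕₚ.m≤n+m d b) (ℕₚ.≤-trans (ℕₚ.m≤n+m (b + d) c) (ℕₚ.m≤n+m _ b)))

  trail : ∀ k {a b} (p : Walk a b) → len' p < k → Σ (Walk a b) λ q → (∀ f → cnt q f ≤ cnt p f) × IsTrail (cnt q)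
  trail (suc k) p (s≤s le) with repeated? p
  ... | inj₂ t = p , (λ f → ℕₚ.≤-refl) , t
  ... | inj₁ (f , lt) with twice p f lt
  ... | along p' j k' q r =
    let (w , c , t) = trail k (p' ⊙ cons f k' r) (ℕₚ.<-≤-trans (subst₂ _<_ (sym (len-⊙ p' _)) (sym (len-twice p' j q k' r)) l₁) le)
    in w , (λ g → ℕₚ.≤-trans (c g) (subst₂ _≤_ (sym (cnt-⊙ p' _ g)) (sym (cnt-twice p' j q k' r g)) (c₁ g))) , t
    where
    l₁ : len' p' + suc (len' r) < len' p' + suc (len' q + suc (len' r))
    l₁ = ℕₚ.+-monoʳ-< (len' p') (s≤s (ℕₚ.m≤n+m _ (len' q)))
    c₁ : ∀ g → cnt p' g + (δ f g + cnt r g) ≤ cnt p' g + (δ f g + (cnt q g + (δ f g + cnt r g)))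
    c₁ g = ℕₚ.+-monoʳ-≤ (cnt p' g) (ℕₚ.≤-trans (ℕₚ.m≤n+m _ (cnt q g)) (ℕₚ.m≤n+m _ (δ f g)))
  ... | against p' j k' q r =
    let (w , c , t) = trail k (p' ⊙ r) (ℕₚ.<-≤-trans (subst₂ _<_ (sym (len-⊙ p' _)) (sym (len-twice p' j q k' r)) l₁) le)
    in w , (λ g → ℕₚ.≤-trans (c g) (subst₂ _≤_ (sym (cnt-⊙ p' _ g)) (sym (cnt-twice p' j q k' r g)) (shorter-≤ (cnt p' g) (δ f g) (cnt q g) (cnt r g)))) , t
    where
    l₁ : len' p' + len' r < len' p' + suc (len' q + suc (len' r))
    l₁ = ℕₚ.+-monoʳ-< (len' p') (s≤s (ℕₚ.≤-trans (ℕₚ.n≤1+n _) (ℕₚ.m≤n+m _ (len' q))))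

  xor-odd : ∀ {a b} → a xor b ≡ true → a ≡ true ⊎ b ≡ true
  xor-odd {true} p = inj₁ refl
  xor-odd {false} p = inj₂ p

  -- Two passes of an edge in the same direction split a closed walk into two whose signs add, so
  -- one is odd. With opposite directions the part between the passes and the remainder are closed,
  -- and the two passes cancel in the sign.
  oddTrail : ∀ k (C : Closed) → Odd C → len' (proj₂ C) < k → Σ Closed λ D → Odd D × (∀ f → cntC D f ≤ cntC C f) × IsTrail (cntC D)
  oddTrail (suc k) (a , p) o (s≤s le) with repeated? p
  ... | inj₂ t = (a , p) , o , (λ f → ℕₚ.≤-refl) , t
  ... | inj₁ (f , lt) with twice p f lt
  ... | along {s} p' j k' q r = pick
    where
    x = sgn p'
    y = sgn q
    z = sgn r
    ν = neg G f
    lem : ∀ x ν y z → x xor (ν xor (y xor (ν xor z))) ≡ (ν xor y) xor (x xor (ν xor z))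
    lem false ν y z = sym (xor-assoc ν y _)
    lem true false false z = refl
    lem true false true false = refl
    lem true false true true = refl
    lem true true false false = refl
    lem true true false true = refl
    lem true true true false = refl
    lem true true true true = refl
    use : ∀ D → Odd D → len' (proj₂ D) < k → (∀ g → cntC D g ≤ cnt (p' ⊙ cons f j (q ⊙ cons f k' r)) g) →
      Σ Closed λ D → Odd D × (∀ g → cntC D g ≤ cnt (p' ⊙ cons f j (q ⊙ cons f k' r)) g) × IsTrail (cntC D)
    use D o l c with oddTrail k D o l
    ... | E , oE , cE , t = E , oE , (λ g → ℕₚ.≤-trans (cE g) (c g)) , t
    pick : Σ Closed λ D → Odd D × (∀ g → cntC D g ≤ cnt (p' ⊙ cons f j (q ⊙ cons f k' r)) g) × IsTrail (cntC D)
    pick with xor-odd {ν xor y} (trans (sym (lem x ν y z)) (trans (sym (sgn-twice p' j q k' r)) o))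
    ... | inj₁ h = use (s , cons f j q) h
            (ℕₚ.<-≤-trans (subst (suc (len' q) <_) (sym (len-twice p' j q k' r))
              (ℕₚ.≤-trans (s≤s (subst (suc (len' q) ≤_) (sym (ℕₚ.+-suc (len' q) (len' r))) (s≤s (ℕₚ.m≤m+n _ _)))) (ℕₚ.m≤n+m _ (len' p')))) le)
            (λ g → (subst (δ f g + cnt q g ≤_) (sym (cnt-twice p' j q k' r g))
              (ℕₚ.≤-trans (ℕₚ.+-monoʳ-≤ (δ f g) (ℕₚ.m≤m+n _ _)) (ℕₚ.m≤n+m _ (cnt p' g)))))
    ... | inj₂ h = use (a , p' ⊙ cons f k' r) (trans (sgn-⊙ p' _) h)
            (ℕₚ.<-≤-trans (subst₂ _<_ (sym (len-⊙ p' _)) (sym (len-twice p' j q k' r)) (ℕₚ.+-monoʳ-< (len' p') (s≤s (ℕₚ.m≤n+m _ (len' q))))) le)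
            (λ g → (subst₂ _≤_ (sym (cnt-⊙ p' _ g)) (sym (cnt-twice p' j q k' r g))
              (ℕₚ.+-monoʳ-≤ (cnt p' g) (ℕₚ.≤-trans (ℕₚ.m≤n+m _ (cnt q g)) (ℕₚ.m≤n+m _ (δ f g))))))
  ... | against {s} {t'} p' j k' q r = pick
    where
    x = sgn p'
    y = sgn q
    z = sgn r
    ν = neg G f
    lem : ∀ x ν y z → x xor (ν xor (y xor (ν xor z))) ≡ y xor (x xor z)
    lem false false y z = refl
    lem true false false z = refl
    lem true false true false = refl
    lem true false true true = refl
    lem false true false false = refl
    lem false true false true = refl
    lem false true true false = refl
    lem false true true true = refl
    lem true true false false = refl
    lem true true false true = refl
    lem true true true false = refl
    lem true true true true = refl
    use : ∀ D → Odd D → len' (proj₂ D) < k → (∀ g → cntC D g ≤ cnt (p' ⊙ cons f j (q ⊙ cons f k' r)) g) →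
      Σ Closed λ D → Odd D × (∀ g → cntC D g ≤ cnt (p' ⊙ cons f j (q ⊙ cons f k' r)) g) × IsTrail (cntC D)
    use D o l c with oddTrail k D o l
    ... | E , oE , cE , t = E , oE , (λ g → ℕₚ.≤-trans (cE g) (c g)) , t
    pick : Σ Closed λ D → Odd D × (∀ g → cntC D g ≤ cnt (p' ⊙ cons f j (q ⊙ cons f k' r)) g) × IsTrail (cntC D)
    pick with xor-odd {y} (trans (sym (lem x ν y z)) (trans (sym (sgn-twice p' j q k' r)) o))
    ... | inj₁ h = use (t' , q) h
            (ℕₚ.<-≤-trans (subst (len' q <_) (sym (len-twice p' j q k' r))
              (ℕₚ.≤-trans (s≤s (ℕₚ.m≤m+n _ _)) (ℕₚ.m≤n+m _ (len' p')))) le)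
            (λ g → (subst (cnt q g ≤_) (sym (cnt-twice p' j q k' r g))
              (ℕₚ.≤-trans (ℕₚ.m≤m+n _ _) (ℕₚ.≤-trans (ℕₚ.m≤n+m _ (δ f g)) (ℕₚ.m≤n+m _ (cnt p' g))))))
    ... | inj₂ h = use (a , p' ⊙ r) (trans (sgn-⊙ p' _) h)
            (ℕₚ.<-≤-trans (subst₂ _<_ (sym (len-⊙ p' _)) (sym (len-twice p' j q k' r)) (ℕₚ.+-monoʳ-< (len' p') (s≤s (ℕₚ.≤-trans (ℕₚ.n≤1+n _) (ℕₚ.m≤n+m _ (len' q)))))) le)
            (λ g → (subst₂ _≤_ (sym (cnt-⊙ p' _ g)) (sym (cnt-twice p' j q k' r g)) (shorter-≤ (cnt p' g) (δ f g) (cnt q g) (cnt r g))))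

  wt-δ : ∀ e x → wt G (δ e) x ≡ bit (neg (switch x G) e)
  wt-δ e x = sumF-δ (λ f → bit (neg (switch x G) f)) e

  wt-zero : ∀ x → wt G (λ _ → 0) x ≡ 0
  wt-zero x = sumF-zero λ f → ℕₚ.*-zeroʳ (bit (neg (switch x G) f))

  neg-joins : ∀ {f a b} x → Joins G f a b → neg (switch x G) f ≡ (neg G f xor x a) xor x b
  neg-joins x (inj₁ refl) = refl
  neg-joins {f} {a} {b} x (inj₂ refl) = lem (neg G f) (x b) (x a)
    where
    lem : ∀ p q r → (p xor q) xor r ≡ (p xor r) xor q
    lem p q r = trans (xor-assoc p q r) (trans (cong (p xor_) (xor-comm q r)) (sym (xor-assoc p r q)))

  par-walk : ∀ {a b} (p : Walk a b) x → par (wt G (cnt p) x) ≡ (sgn p xor x a) xor x b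
  par-walk {a} [] x = trans (cong par (wt-zero x)) (sym (xor-same (x a)))
  par-walk {a} {c} (cons {b = b} f j p) x = begin
    par (wt G (λ g → δ f g + cnt p g) x)              ≡⟨ cong par (wt-+ G (δ f) (cnt p) x) ⟩
    par (wt G (δ f) x + wt G (cnt p) x)               ≡⟨ par-+ (wt G (δ f) x) _ ⟩
    par (wt G (δ f) x) xor par (wt G (cnt p) x)       ≡⟨ cong₂ _xor_ (trans (cong par (wt-δ f x)) (trans (par-bit _) (neg-joins x j))) (par-walk p x) ⟩
    ((neg G f xor x a) xor x b) xor ((sgn p xor x b) xor x c) ≡⟨ lem (neg G f) (x a) (x b) (sgn p) (x c) ⟩
    ((neg G f xor sgn p) xor x a) xor x c ∎
    where
    open ≡-Reasoning
    lem : ∀ ν a b s c → ((ν xor a) xor b) xor ((s xor b) xor c) ≡ ((ν xor s) xor a) xor c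
    lem false false false s c = cong (_xor c) (trans (xor-identityʳ s) (sym (xor-identityʳ s)))
    lem false false true false c = not-involutive c
    lem false false true true c = refl
    lem false true false false c = refl
    lem false true false true c = not-involutive c
    lem false true true false c = refl
    lem false true true true c = refl
    lem true false false false c = refl
    lem true false false true c = not-involutive c
    lem true false true false c = refl
    lem true false true true c = refl
    lem true true false false c = refl
    lem true true false true c = refl
    lem true true true false c = not-involutive c
    lem true true true true c = refl

  -- Modulo 2, switching changes the weight by the weight of a cut. So this says that `w` is
  -- Eulerian, every cut having even weight, and fixes the parity of its negative part.
  Par : (Fin m → ℕ) → Bool → Set
  Par w b = ∀ x → par (wt G w x) ≡ b

  Par-closed : ∀ C → Par (cntC C) (sgn (proj₂ C))
  Par-closed (a , p) x = trans (par-walk p x) (lem (sgn p) (x a))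
    where
    lem : ∀ s t → (s xor t) xor t ≡ s
    lem s t = trans (xor-assoc s t t) (trans (cong (s xor_) (xor-same t)) (xor-identityʳ s))

  Par-minus : ∀ {w w' w''} {b b'} → (∀ f → w f ≡ w' f + w'' f) → Par w b → Par w' b' → Par w'' (b xor b')
  Par-minus {w} {w'} {w''} {b} {b'} e pw pw' x = xor-cancel {b'} (trans (cong (_xor par (wt G w'' x)) (sym (pw' x)))
    (trans (sym (par-+ (wt G w' x) _)) (trans (cong par (trans (sym (wt-+ G w' w'' x)) (sumF-≡ λ f → cong (bit (neg (switch x G) f) *_) (sym (e f))))) (pw x))))

  wt-ext : ∀ {w w'} → (∀ f → w f ≡ w' f) → ∀ x → wt G w x ≡ wt G w' x
  wt-ext e x = sumF-≡ λ f → cong (bit (neg (switch x G) f) *_) (e f)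

  Zero : (Fin n → Bool) → (Fin m → ℕ) → Set
  Zero x w = ∀ f → 0 < w f → neg (switch x G) f ≡ false

  zero⇒wt : ∀ {x w} → Zero x w → wt G w x ≡ 0
  zero⇒wt {x} {w} z = sumF-zero λ f → lem f (w f) refl
    where
    lem : ∀ f k → w f ≡ k → bit (neg (switch x G) f) * w f ≡ 0
    lem f zero e = trans (cong (bit (neg (switch x G) f) *_) e) (ℕₚ.*-zeroʳ (bit (neg (switch x G) f)))
    lem f (suc k) e = cong (λ b → bit b * w f) (z f (subst (0 <_) (sym e) (s≤s z≤n)))

  wt⇒zero : ∀ {x w} → wt G w x ≡ 0 → Zero x w
  wt⇒zero {x} {w} e f lt with neg (switch x G) f | sumF-zero⁻ e f
  ... | false | _ = refl
  ... | true | p = ⊥-elim (ℕₚ.<⇒≢ lt (sym (trans (sym (ℕₚ.+-identityʳ (w f))) p)))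

  sgn-zero : ∀ {a b} (p : Walk a b) {x} → Zero x (cnt p) → sgn p ≡ x a xor x b
  sgn-zero {a} {b} p {x} z = lem (sgn p) (x a) (x b) (trans (sym (par-walk p x)) (cong par (zero⇒wt {x} z)))
    where
    lem : ∀ s a b → (s xor a) xor b ≡ false → s ≡ a xor b
    lem false false false p = refl
    lem false true true p = refl
    lem true false true p = refl
    lem true true false p = refl

  record Supported (R : Fin m → ℕ) (a b : Fin n) : Set where
    constructor supported
    field
      walk : Walk a b
      supp : ∀ f → 0 < cnt walk f → 0 < R f

  toWalk : ∀ {R : Fin m → ℕ} {P : Fin m → Set} → (∀ {f} → P f → 0 < R f) → ∀ {a b} →
    Star (λ c d → ∃ λ g → P g × Joins G g c d) a b → Σ (Supported R a b) λ W → ∀ f → 0 < cnt (Supported.walk W) f → P f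
  toWalk h ε = supported [] (λ f ()) , λ f ()
  toWalk {R} {P} h ((g , pg , j) ◅ s) with toWalk {R} {P} h s
  ... | supported w sp , q = supported (cons g j w) (λ f lt → h (lem f lt)) , lem
    where
    lem : ∀ f → 0 < δ g f + cnt w f → P f
    lem f lt with g ≟ f
    ... | yes refl = pg
    ... | no _ = q f lt

  joins? : ∀ g c d → Dec (Joins G g c d)
  joins? g c d = pair-≡-dec _≟_ _≟_ (ends G g) (c , d) ⊎-dec pair-≡-dec _≟_ _≟_ (ends G g) (d , c)

  BipartiteOn : (Fin m → ℕ) → Set
  BipartiteOn R = ∃ λ x → Zero x R

  OddOn : (Fin m → ℕ) → Set
  OddOn R = Σ Closed λ C → Odd C × (∀ f → 0 < cntC C f → 0 < R f)

  -- The signed test for bipartiteness, edge by edge. An edge that is negative under the current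
  -- signature either joins two components, one of which is then switched, or closes an odd walk
  -- with a path of positive edges.
  bipartite-or-odd : ∀ R → BipartiteOn R ⊎ OddOn R
  bipartite-or-odd R with go (allFin m)
    where
    go : ∀ es → (∃ λ x → ∀ f → f ∈ es → 0 < R f → neg (switch x G) f ≡ false) ⊎ OddOn R
    go [] = inj₁ ((λ _ → false) , λ f ())
    go (f ∷ es) with go es
    ... | inj₂ C = inj₂ C
    ... | inj₁ (x , h) with neg (switch x G) f in e | 0 ℕ.<? R f
    ... | false | _ = inj₁ (x , λ { g (here refl) _ → e ; g (there g∈) lt → h g g∈ lt })
    ... | true | no ¬lt = inj₁ (x , λ { g (here refl) lt → ⊥-elim (¬lt lt) ; g (there g∈) lt → h g g∈ lt })
    ... | true | yes lt = attach
      where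
      a = proj₁ (ends G f)
      b = proj₂ (ends G f)
      P : Fin m → Set
      P g = g ∈ es × 0 < R g
      open Reached (reached {R = λ c d → ∃ λ g → P g × Joins G g c d}
        (λ c d → any? λ g → ((g ∈? es) ×-dec (0 ℕ.<? R g)) ×-dec joins? g c d) (λ c → does (c ≟ a)))
      Ka : K a ≡ true
      Ka = start a lem
        where
        lem : does (a ≟ a) ≡ true
        lem with a ≟ a
        ... | yes _ = refl
        ... | no ¬p = ⊥-elim (¬p refl)
      starts : ∀ s → does (s ≟ a) ≡ true → s ≡ a
      starts s p with s ≟ a
      ... | yes q = q
      sameSide : ∀ g → P g → K (proj₁ (ends G g)) ≡ K (proj₂ (ends G g))
      sameSide g pg with K (proj₁ (ends G g)) in e₁ | K (proj₂ (ends G g)) in e₂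
      ... | true | true = refl
      ... | false | false = refl
      ... | true | false = trans (sym (closed _ _ e₁ (g , pg , inj₁ refl))) e₂
      ... | false | true = trans (sym e₁) (closed _ _ e₂ (g , pg , inj₂ refl))
      attach : (∃ λ x → ∀ g → g ∈ f ∷ es → 0 < R g → neg (switch x G) g ≡ false) ⊎ OddOn R
      attach with K b in eb
      ... | true with Reached.trail (reached {R = λ c d → ∃ λ g → P g × Joins G g c d}
        (λ c d → any? λ g → ((g ∈? es) ×-dec (0 ℕ.<? R g)) ×-dec joins? g c d) (λ c → does (c ≟ a))) b eb
      ... | s , ps , st with starts s ps
      ... | refl with toWalk {R} {P} proj₂ st
      ... | supported w sp , inP = inj₂ ((b , cons f (inj₂ refl) w) , odd , sp')
        where
        odd : neg G f xor sgn w ≡ true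
        odd = trans (cong (neg G f xor_) (sgn-zero w {x} λ g lt → let (g∈ , r) = inP g lt in h g g∈ r)) (trans (sym (xor-assoc (neg G f) (x a) (x b))) e)
        sp' : ∀ g → 0 < δ f g + cnt w g → 0 < R g
        sp' g l with f ≟ g
        ... | yes refl = lt
        ... | no _ = sp g l
      attach | false = inj₁ (x ⊕ K , good)
        where
        good : ∀ g → g ∈ f ∷ es → 0 < R g → neg (switch (x ⊕ K) G) g ≡ false
        good g (here refl) _ rewrite Ka | eb = lem (neg G f) (x a) (x b) e
          where
          lem : ∀ p q r → (p xor q) xor r ≡ true → (p xor (q xor true)) xor (r xor false) ≡ false
          lem false false true _ = refl
          lem false true false _ = refl
          lem true false false _ = refl
          lem true true true _ = refl
        good g (there g∈) l = trans (lem (neg G g) (x (proj₁ (ends G g))) (x (proj₂ (ends G g))) _ _ (sameSide g (g∈ , l))) (h g g∈ l)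
          where
          lem : ∀ p q r k k' → k ≡ k' → (p xor (q xor k)) xor (r xor k') ≡ (p xor q) xor r
          lem p q r false .false refl = cong₂ _xor_ (cong (p xor_) (xor-identityʳ q)) (xor-identityʳ r)
          lem false false false true .true refl = refl
          lem false false true true .true refl = refl
          lem false true false true .true refl = refl
          lem false true true true .true refl = refl
          lem true false false true .true refl = refl
          lem true false true true .true refl = refl
          lem true true false true .true refl = refl
          lem true true true true .true refl = refl
  ... | inj₁ (x , h) = inj₁ (x , λ f lt → h f (∈-allFin f) lt)
  ... | inj₂ C = inj₂ C

  trail-fits : ∀ {c R : Fin m → ℕ} → IsTrail c → (∀ f → 0 < c f → 0 < R f) → ∀ f → c f ≤ R f
  trail-fits {c} {R} t s f with c f in e
  ... | zero = z≤n
  ... | suc k = ℕₚ.≤-trans (subst (_≤ 1) e (t f)) (s f (subst (0 <_) (sym e) (s≤s z≤n)))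

  oddOn-trail : ∀ {R} → OddOn R → Σ Closed λ C → Odd C × IsTrail (cntC C) × (∀ f → cntC C f ≤ R f)
  oddOn-trail {R} (C , o , s) with oddTrail _ C o ℕₚ.≤-refl
  ... | D , oD , le , t = D , oD , t , trail-fits t λ f lt → s f (ℕₚ.<-≤-trans lt (le f))

  odd-parity⇒odd : ∀ {R} → Par R true → OddOn R
  odd-parity⇒odd {R} p with bipartite-or-odd R
  ... | inj₂ C = C
  ... | inj₁ (x , z) = case trans (sym (p x)) (cong par (zero⇒wt {x} z)) of λ ()

  openAt : ∀ C e → 0 < cntC C e → Σ (Walk (proj₁ (ends G e)) (proj₂ (ends G e))) λ p →
    (∀ f → cntC C f ≡ δ e f + cnt p f) × sgn (proj₂ C) ≡ neg G e xor sgn p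
  openAt (a , p) e lt with splitAt p e lt
  ... | split q (inj₁ refl) r refl = rev (r ⊙ q) , c , s
    where
    c : ∀ f → cnt (q ⊙ cons e (inj₁ refl) r) f ≡ δ e f + cnt (rev (r ⊙ q)) f
    c f = trans (cnt-⊙ q _ f) (trans (lem (cnt q f) (δ e f) (cnt r f)) (cong (δ e f +_) (sym (trans (cnt-rev (r ⊙ q) f) (cnt-⊙ r q f)))))
      where
      lem : ∀ a b c → a + (b + c) ≡ b + (c + a)
      lem = solve-∀
    s : sgn (q ⊙ cons e (inj₁ refl) r) ≡ neg G e xor sgn (rev (r ⊙ q))
    s = trans (sgn-⊙ q _) (trans (lem (sgn q) (neg G e) (sgn r)) (cong (neg G e xor_) (sym (trans (sgn-rev (r ⊙ q)) (sgn-⊙ r q)))))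
      where
      lem : ∀ a b c → a xor (b xor c) ≡ b xor (c xor a)
      lem a b c = trans (xor-comm a _) (xor-assoc b c a)
  ... | split q (inj₂ refl) r refl = r ⊙ q , c , s
    where
    c : ∀ f → cnt (q ⊙ cons e (inj₂ refl) r) f ≡ δ e f + cnt (r ⊙ q) f
    c f = trans (cnt-⊙ q _ f) (trans (lem (cnt q f) (δ e f) (cnt r f)) (cong (δ e f +_) (sym (cnt-⊙ r q f))))
      where
      lem : ∀ a b c → a + (b + c) ≡ b + (c + a)
      lem = solve-∀
    s : sgn (q ⊙ cons e (inj₂ refl) r) ≡ neg G e xor sgn (r ⊙ q)
    s = trans (sgn-⊙ q _) (trans (lem (sgn q) (neg G e) (sgn r)) (cong (neg G e xor_) (sym (sgn-⊙ r q))))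
      where
      lem : ∀ a b c → a xor (b xor c) ≡ b xor (c xor a)
      lem a b c = trans (xor-comm a _) (xor-assoc b c a)

-- Packings of odd closed walks

module Packings {n m} (G : SG n m) where
  open Walks G public

  total : List Closed → Fin m → ℕ
  total [] f = 0
  total (C ∷ l) f = cntC C f + total l f

  record Pack (t : ℕ) (w : Fin m → ℕ) : Set where
    constructor pack
    field
      walks : List Closed
      odds : All Odd walks
      size : length walks ≡ t
      fits : ∀ f → total walks f ≤ w f

  odd⇒1≤wt : ∀ C → Odd C → ∀ x → 1 ≤ wt G (cntC C) x
  odd⇒1≤wt C o x with wt G (cntC C) x | Par-closed C x
  ... | zero | p = case trans p o of λ ()
  ... | suc _ | _ = s≤s z≤n

  length≤wt : ∀ {l} → All Odd l → ∀ x → length l ≤ wt G (total l) x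
  length≤wt [] x = z≤n
  length≤wt {C ∷ l} (o ∷ os) x = subst (suc (length l) ≤_) (sym (wt-+ G (cntC C) (total l) x)) (ℕₚ.+-mono-≤ (odd⇒1≤wt C o x) (length≤wt os x))

  Par-total : ∀ {l} → All Odd l → Par (total l) (par (length l))
  Par-total [] x = cong par (wt-zero x)
  Par-total {C ∷ l} (o ∷ os) x = trans (cong par (wt-+ G (cntC C) (total l) x)) (trans (par-+ (wt G (cntC C) x) _)
    (cong₂ _xor_ (trans (Par-closed C x) o) (Par-total os x)))

  PackAll : ℕ → Set
  PackAll t = ∀ w → Par w (par t) → (∀ x → t ≤ wt G w x) → Pack t w

  -- An odd closed walk has odd weight in every signature, so the parity hypothesis for `t` survives
  -- its removal; the lower bound is the real condition.
  peel : ∀ {t w w'} → PackAll t → ∀ C → Odd C → (∀ f → w f ≡ cntC C f + w' f) → Par w (par (suc t)) → (∀ x → t ≤ wt G w' x) → Pack (suc t) w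
  peel {t} {w} {w'} ih C o e pw low with ih w' (subst (Par w') (lem (par t)) (Par-minus e pw λ x → trans (Par-closed C x) o)) low
    where
    lem : ∀ b → not b xor true ≡ b
    lem true = refl
    lem false = refl
  ... | pack l os s fit = pack (C ∷ l) (o ∷ os) (cong suc s) λ f → subst (cntC C f + total l f ≤_) (sym (e f)) (ℕₚ.+-monoʳ-≤ (cntC C f) (fit f))

  Trails : List Closed → Set
  Trails = All (IsTrail ∘ cntC)

  trailify : ∀ l → All Odd l → Σ (List Closed) λ l' → All Odd l' × Trails l' × length l' ≡ length l × (∀ f → total l' f ≤ total l f)
  trailify [] [] = [] , [] , [] , refl , λ f → z≤n
  trailify (C ∷ l) (o ∷ os) with oddTrail _ C o ℕₚ.≤-refl | trailify l os
  ... | D , oD , le , t | l' , os' , ts , s , le' = D ∷ l' , oD ∷ os' , t ∷ ts , cong suc s , λ f → ℕₚ.+-mono-≤ (le f) (le' f)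

  record Extracted (l : List Closed) (e : Fin m) : Set where
    constructor extracted
    field
      C : Closed
      rest : List Closed
      C-odd : Odd C
      rest-odd : All Odd rest
      rest-trails : Trails rest
      once : cntC C e ≡ 1
      size : length l ≡ suc (length rest)
      sum : ∀ f → total l f ≡ cntC C f + total rest f

  -- Trails guarantee that a walk through `e` takes exactly one copy of it.
  extract : ∀ l e → All Odd l → Trails l → 0 < total l e → Extracted l e
  extract (C ∷ l) e (o ∷ os) (t ∷ ts) lt with cntC C e in eq | t e
  ... | suc zero | _ = extracted C l o os ts eq refl λ f → refl
  ... | suc (suc _) | s≤s ()
  ... | zero | _ with extract l e os ts lt
  ... | extracted D r oD or tr once s sm = extracted D (C ∷ r) oD (o ∷ or) (t ∷ tr) once (cong suc s) λ f →
          trans (cong (cntC C f +_) (sm f)) (lem (cntC C f) (cntC D f) (total r f))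
    where
    lem : ∀ a b c → a + (b + c) ≡ b + (a + c)
    lem = solve-∀

  module _ (e : Fin m) where
    private
      u = proj₁ (ends G e)
      v = proj₂ (ends G e)

    -- If `v` were not reached, switching the set reachable from `u` would change the sign of no
    -- edge in `R'`, but that of the one extra copy of `e`, and so reverse the parity.
    connect : ∀ {R R' b} → Par R b → (∀ f → R f ≡ δ e f + R' f) → Supported R' u v
    connect {R} {R'} {b} pR eR = reachedFrom (reached (λ c d → any? λ g → (0 ℕ.<? R' g) ×-dec joins? g c d) (λ c → does (c ≟ u)))
      where
      starts : ∀ s → does (s ≟ u) ≡ true → s ≡ u
      starts s p with s ≟ u
      ... | yes q = q
      reachedFrom : Reached (λ c d → ∃ λ g → 0 < R' g × Joins G g c d) (λ c → does (c ≟ u)) → Supported R' u v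
      reachedFrom RC with Reached.K RC v in ev
      ... | true with Reached.trail RC v ev
      ... | s , ps , st with starts s ps
      ... | refl = proj₁ (toWalk {R'} {λ g → 0 < R' g} (λ p → p) st)
      reachedFrom RC | false = ⊥-elim (not≢ _ (trans (sym toggled) (trans (pR K) (sym (pR (λ _ → false))))))
        where
        open Reached RC using (K; start; closed)
        Ku : K u ≡ true
        Ku = start u lem
          where
          lem : does (u ≟ u) ≡ true
          lem with u ≟ u
          ... | yes _ = refl
          ... | no ¬p = ⊥-elim (¬p refl)
        sameSide : ∀ g → 0 < R' g → K (proj₁ (ends G g)) ≡ K (proj₂ (ends G g))
        sameSide g pg with K (proj₁ (ends G g)) in e₁ | K (proj₂ (ends G g)) in e₂
        ... | true | true = refl
        ... | false | false = refl
        ... | true | false = trans (sym (closed _ _ e₁ (g , pg , inj₁ refl))) e₂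
        ... | false | true = trans (sym e₁) (closed _ _ e₂ (g , pg , inj₂ refl))
        same : wt G R' K ≡ wt G R' (λ _ → false)
        same = sumF-≡ λ g → lem g (R' g) refl
          where
          bits : ∀ p k k' → k ≡ k' → (p xor k) xor k' ≡ (p xor false) xor false
          bits p k _ refl = solve 2 (λ p k → (p :+ k) :+ k := (p :+ con false) :+ con false) refl p k
          lem : ∀ g k → R' g ≡ k → bit (neg (switch K G) g) * R' g ≡ bit (neg (switch (λ _ → false) G) g) * R' g
          lem g zero z rewrite z = trans (ℕₚ.*-zeroʳ (bit (neg (switch K G) g))) (sym (ℕₚ.*-zeroʳ (bit (neg (switch (λ _ → false) G) g))))
          lem g (suc k) z = cong (λ s → bit s * R' g) (bits (neg G g) _ _ (sameSide g (subst (0 <_) (sym z) (s≤s z≤n))))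
        split-wt : ∀ x → par (wt G R x) ≡ neg (switch x G) e xor par (wt G R' x)
        split-wt x = trans (cong par (trans (wt-ext eR x) (wt-+ G (δ e) R' x))) (trans (par-+ (wt G (δ e) x) _)
          (cong (_xor par (wt G R' x)) (trans (cong par (wt-δ e x)) (par-bit (neg (switch x G) e)))))
        toggled : par (wt G R K) ≡ not (par (wt G R (λ _ → false)))
        toggled = trans (split-wt K) (trans (cong₂ _xor_ flip (cong par same)) (trans (lem (neg G e) (par (wt G R' (λ _ → false)))) (cong not (sym (split-wt (λ _ → false))))))
          where
          flip : neg (switch K G) e ≡ not ((neg G e xor false) xor false)
          flip rewrite Ku | ev with neg G e
          ... | true = refl
          ... | false = refl
          lem : ∀ ν q → not ((ν xor false) xor false) xor q ≡ not (((ν xor false) xor false) xor q)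
          lem true q = sym (not-involutive q)
          lem false q = refl

    private
      sum-lemma : ∀ d p l r → ((p + l) + r) + 2 * d ≡ ((d + p) + l) + (d + r)
      sum-lemma = solve-∀
      swap-lemma : ∀ a b c → (a + b) + c ≡ (a + c) + b
      swap-lemma = solve-∀
      odd-bits : ∀ ν p q → ν xor p ≡ true → ν xor q ≡ false → p xor q ≡ true
      odd-bits true false true _ _ = refl
      odd-bits false true false _ _ = refl

    module _ {w R' : Fin m → ℕ} {t : ℕ} (P : Walk u v) (oP : neg G e xor sgn P ≡ true) {l} (os : All Odd l) (s : suc (length l) ≡ t)
             (pR : Par (λ f → δ e f + R' f) false) (sum : ∀ f → (cnt P f + total l f) + R' f ≡ w f)
             (Q : Walk u v) (Q≤ : ∀ f → cnt Q f ≤ R' f) where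

      -- `e P` is odd and `e Q` even, so `P` followed by `Q` backwards is an odd closed walk; it
      -- replaces `e P`.
      rerouteEven : neg G e xor sgn Q ≡ false → Pack t w
      rerouteEven q = pack ((u , P ⊙ rev Q) ∷ l) (odd ∷ os) s fit
        where
        odd : sgn (P ⊙ rev Q) ≡ true
        odd = trans (sgn-⊙ P (rev Q)) (trans (cong (sgn P xor_) (sgn-rev Q)) (odd-bits (neg G e) (sgn P) (sgn Q) oP q))
        fit : ∀ f → cnt (P ⊙ rev Q) f + total l f ≤ w f
        fit f = begin
          cnt (P ⊙ rev Q) f + total l f     ≡⟨ cong (_+ total l f) (trans (cnt-⊙ P (rev Q) f) (cong (cnt P f +_) (cnt-rev Q f))) ⟩
          (cnt P f + cnt Q f) + total l f   ≡⟨ swap-lemma (cnt P f) (cnt Q f) (total l f) ⟩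
          (cnt P f + total l f) + cnt Q f   ≤⟨ ℕₚ.+-monoʳ-≤ (cnt P f + total l f) (Q≤ f) ⟩
          (cnt P f + total l f) + R' f      ≡⟨ sum f ⟩
          w f ∎
          where open ℕₚ.≤-Reasoning

      -- The leftover has even parity. Without the odd walk `e Q` its parity is odd, so it contains
      -- another odd walk, which replaces `e P`.
      rerouteOdd : neg G e xor sgn Q ≡ true → Pack t w
      rerouteOdd q with oddOn-trail (odd-parity⇒odd {λ f → R' f ∸ cnt Q f} left)
        where
        left : Par (λ f → R' f ∸ cnt Q f) true
        left = Par-minus {w = λ f → δ e f + R' f} {w' = λ f → δ e f + cnt Q f}
          (λ f → trans (cong (δ e f +_) (sym (ℕₚ.m+[n∸m]≡n (Q≤ f)))) (sym (ℕₚ.+-assoc (δ e f) _ _)))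
          pR (λ x → trans (Par-closed (v , cons e (inj₂ refl) Q) x) q)
      ... | D , oD , _ , le = pack (D ∷ l) (oD ∷ os) s fit
        where
        fit : ∀ f → cntC D f + total l f ≤ w f
        fit f = begin
          cntC D f + total l f              ≤⟨ ℕₚ.+-monoˡ-≤ (total l f) (ℕₚ.≤-trans (le f) (ℕₚ.m∸n≤m (R' f) (cnt Q f))) ⟩
          R' f + total l f                  ≤⟨ ℕₚ.m≤n+m _ (cnt P f) ⟩
          cnt P f + (R' f + total l f)      ≡⟨ trans (sym (ℕₚ.+-assoc (cnt P f) _ _)) (swap-lemma (cnt P f) (R' f) (total l f)) ⟩
          (cnt P f + total l f) + R' f      ≡⟨ sum f ⟩
          w f ∎
          where open ℕₚ.≤-Reasoning

    -- One copy of e too many was used: replace one walk through e by a walk in the leftover.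
    reroute : ∀ {w R'} {t} (P : Walk u v) → neg G e xor sgn P ≡ true → ∀ {l} → All Odd l → suc (length l) ≡ t →
      Par (λ f → δ e f + R' f) false → (∀ f → ((δ e f + cnt P f) + total l f) + (δ e f + R' f) ≡ w f + 2 * δ e f) → Pack t w
    reroute {w} {R'} P oP {l} os s pR sum with connect {R' = R'} pR (λ f → refl)
    ... | supported Q₀ supp with trail _ Q₀ ℕₚ.≤-refl
    ... | Q , Q≤Q₀ , tr = choose (neg G e xor sgn Q) refl
      where
      Q≤ : ∀ f → cnt Q f ≤ R' f
      Q≤ = trail-fits tr λ f lt → supp f (ℕₚ.<-≤-trans lt (Q≤Q₀ f))
      sum' : ∀ f → (cnt P f + total l f) + R' f ≡ w f
      sum' f = ℕₚ.+-cancelʳ-≡ (2 * δ e f) _ _ (trans (sum-lemma (δ e f) (cnt P f) (total l f) (R' f)) (sum f))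
      choose : ∀ b → neg G e xor sgn Q ≡ b → Pack _ w
      choose false q = rerouteEven P oP os s pR sum' Q Q≤ q
      choose true q = rerouteOdd P oP os s pR sum' Q Q≤ q

sum3-cong : ∀ {Φ Φ' : Fin 3 → ℕ} → (∀ k → Φ k ≡ Φ' k) → sum3 Φ ≡ sum3 Φ'
sum3-cong e = cong₂ _+_ (cong₂ _+_ (e 0F) (e 1F)) (e 2F)

sum3-pos : ∀ (Φ : Fin 3 → ℕ) → 0 < sum3 Φ → ∃ λ i → 0 < Φ i
sum3-pos Φ lt with Φ 0F in e₀ | Φ 1F in e₁
... | suc _ | _ = 0F , subst (0 <_) (sym e₀) (s≤s z≤n)
... | zero | suc _ = 1F , subst (0 <_) (sym e₁) (s≤s z≤n)
... | zero | zero = 2F , lt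

term≤sum3 : ∀ (Φ : Fin 3 → ℕ) i → Φ i ≤ sum3 Φ
term≤sum3 Φ 0F = ℕₚ.≤-trans (ℕₚ.m≤m+n _ _) (ℕₚ.m≤m+n _ _)
term≤sum3 Φ 1F = ℕₚ.≤-trans (ℕₚ.m≤n+m _ (Φ 0F)) (ℕₚ.m≤m+n _ _)
term≤sum3 Φ 2F = ℕₚ.m≤n+m _ (Φ 0F + Φ 1F)

sum3-out : ∀ (Φ : Fin 3 → ℕ) i → sum3 Φ ≡ Φ i + sum3 (Φ [ i ≔ 0 ])
sum3-out Φ 0F = ℕₚ.+-assoc (Φ 0F) _ _
sum3-out Φ 1F = lem (Φ 0F) (Φ 1F) (Φ 2F)
  where
  lem : ∀ a b c → (a + b) + c ≡ b + ((a + 0) + c)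
  lem = solve-∀
sum3-out Φ 2F = lem (Φ 0F) (Φ 1F) (Φ 2F)
  where
  lem : ∀ a b c → (a + b) + c ≡ c + ((a + b) + 0)
  lem = solve-∀

sum3-swap : ∀ (Φ Φ' : Fin 3 → ℕ) i j → i ≢ j → Φ i + Φ j ≡ Φ' i + Φ' j → (∀ k → k ≢ i → k ≢ j → Φ' k ≡ Φ k) → sum3 Φ ≡ sum3 Φ'
sum3-swap Φ Φ' i j i≢j e oth = begin
  sum3 Φ                                              ≡⟨ two Φ ⟩
  (Φ i + Φ j) + sum3 ((Φ [ i ≔ 0 ]) [ j ≔ 0 ])        ≡⟨ cong₂ _+_ e (sum3-cong same) ⟩
  (Φ' i + Φ' j) + sum3 ((Φ' [ i ≔ 0 ]) [ j ≔ 0 ])     ≡⟨ sym (two Φ') ⟩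
  sum3 Φ' ∎
  where
  open ≡-Reasoning
  two : ∀ Φ → sum3 Φ ≡ (Φ i + Φ j) + sum3 ((Φ [ i ≔ 0 ]) [ j ≔ 0 ])
  two Φ = trans (sum3-out Φ i) (trans (cong (Φ i +_) (trans (sum3-out (Φ [ i ≔ 0 ]) j) (cong (_+ sum3 ((Φ [ i ≔ 0 ]) [ j ≔ 0 ])) (≔-away Φ (i≢j ∘ sym)))))
    (sym (ℕₚ.+-assoc (Φ i) _ _)))
  same : ∀ k → ((Φ [ i ≔ 0 ]) [ j ≔ 0 ]) k ≡ ((Φ' [ i ≔ 0 ]) [ j ≔ 0 ]) k
  same k with k ≟ j
  ... | yes _ = refl
  ... | no k≢j with k ≟ i
  ... | yes _ = refl
  ... | no k≢i = sym (oth k k≢i k≢j)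

maj-two : ∀ i (b : Fin 3 → Bool) → b (next3 i) ≡ b (next3 (next3 i)) → maj (b 0F) (b 1F) (b 2F) ≡ b (next3 i)
maj-two 0F b e with b 0F | b 1F | b 2F
maj-two 0F b refl | true | true | _ = refl
maj-two 0F b refl | true | false | _ = refl
maj-two 0F b refl | false | true | _ = refl
maj-two 0F b refl | false | false | _ = refl
maj-two 1F b e with b 0F | b 1F | b 2F
maj-two 1F b refl | true | true | _ = refl
maj-two 1F b refl | true | false | _ = refl
maj-two 1F b refl | false | true | _ = refl
maj-two 1F b refl | false | false | _ = refl
maj-two 2F b e with b 0F | b 1F | b 2F
maj-two 2F b refl | true | true | _ = refl
maj-two 2F b refl | false | false | _ = refl

module WalkVertices {n m} (G : SG n m) where
  open Packings G public

  record SplitV {a b} (p : Walk a b) (xs : List (Fin n)) (z : Fin n) (ys : List (Fin n)) : Set where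
    constructor splitV
    field
      left : Walk a z
      right : Walk z b
      whole : p ≡ left ⊙ right
      vs-left : vs left ≡ xs
      vs-right : vs right ≡ z ∷ ys

  splitVs : ∀ {a b} (p : Walk a b) xs {z ys} → vs p ≡ xs ++ z ∷ ys → SplitV p xs z ys
  splitVs (cons f j p) [] refl = splitV [] (cons f j p) refl refl refl
  splitVs [] (x ∷ xs) ()
  splitVs (cons f j p) (x ∷ xs) e with ∷-injective e
  ... | refl , e' with splitVs p xs e'
  ... | splitV l r refl vl vr = splitV (cons f j l) r refl (cong (_ ∷_) vl) vr

  cnt>0 : ∀ {a b c} {f} {j : Joins G f a b} {p : Walk b c} → 0 < cnt (cons f j p) f
  cnt>0 {f = f} rewrite δ-self f = s≤s z≤n

  cnt-tail : ∀ {a b c} {f} {j : Joins G f a b} (p : Walk b c) {g} → 0 < cnt p g → 0 < cnt (cons f j p) g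
  cnt-tail {f = f} p {g} lt = ℕₚ.≤-trans lt (ℕₚ.m≤n+m _ (δ f g))

  cnt-cons⁻ : ∀ {a b c} {f} {j : Joins G f a b} (p : Walk b c) {g} → 0 < cnt (cons f j p) g → f ≡ g ⊎ 0 < cnt p g
  cnt-cons⁻ {f = f} p {g} lt with f ≟ g
  ... | yes e = inj₁ e
  ... | no _ = inj₂ lt

  walk-chain : ∀ {R : Fin n → Fin n → Set} {a c} (p : Walk a c) {L} → vs p ≡ a ∷ L →
    (∀ {f c d} → 0 < cnt p f → Joins G f c d → R c d) → Chain R a L c
  walk-chain (cons f j []) refl h = h (cnt>0 {j = j} {p = []}) j
  walk-chain (cons f j (cons g k p)) refl h = h (cnt>0 {j = j} {p = cons g k p}) j , walk-chain (cons g k p) refl λ lt → h (cnt-tail {j = j} (cons g k p) lt)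

  EndOf : Fin m → Fin n → Set
  EndOf f a = a ≡ proj₁ (ends G f) ⊎ a ≡ proj₂ (ends G f)

  joins-left : ∀ {f a b} → Joins G f a b → EndOf f a
  joins-left (inj₁ refl) = inj₁ refl
  joins-left (inj₂ refl) = inj₂ refl

  end-joins : ∀ {f a b c} → Joins G f a b → EndOf f c → c ≡ a ⊎ c ≡ b
  end-joins (inj₁ refl) e = e
  end-joins (inj₂ refl) (inj₁ e) = inj₂ e
  end-joins (inj₂ refl) (inj₂ e) = inj₁ e

  vs⇒edge : ∀ {a b} (p : Walk a b) {c} → c ∈ vs p → ∃ λ f → 0 < cnt p f × EndOf f c
  vs⇒edge (cons f j p) (here refl) = f , cnt>0 {j = j} {p = p} , joins-left j
  vs⇒edge (cons f j p) (there c∈) with vs⇒edge p c∈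
  ... | g , lt , e = g , cnt-tail {j = j} p lt , e

  hd-vs : ∀ {a b} (p : Walk a b) → a ∈ vs p ⊎ a ≡ b
  hd-vs [] = inj₂ refl
  hd-vs (cons _ _ _) = inj₁ (here refl)

  edge⇒vs : ∀ {a b} (p : Walk a b) {f c} → 0 < cnt p f → EndOf f c → c ∈ vs p ⊎ c ≡ b
  edge⇒vs (cons f j p) lt e with cnt-cons⁻ {j = j} p lt
  ... | inj₁ refl with end-joins j e
  ... | inj₁ refl = inj₁ (here refl)
  ... | inj₂ refl with hd-vs p
  ... | inj₁ q = inj₁ (there q)
  ... | inj₂ q = inj₂ q
  edge⇒vs (cons f j p) lt e | inj₂ lt' with edge⇒vs p lt' e
  ... | inj₁ q = inj₁ (there q)
  ... | inj₂ q = inj₂ q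

  -- Along an edge made positive by a switching set, the value at one end determines the value at
  -- the other.
  agree : ∀ {a b} (p : Walk a b) {x y} → Zero x (cnt p) → Zero y (cnt p) → x a ≡ y a → (∀ {c} → c ∈ vs p → x c ≡ y c) × x b ≡ y b
  agree [] zx zy e = (λ ()) , e
  agree {a} (cons {b = b} f j p) {x} {y} zx zy e with agree p {x} {y} (λ g lt → zx g (cnt-tail {j = j} p lt)) (λ g lt → zy g (cnt-tail {j = j} p lt)) next-agrees
    where
    lem : ∀ ν p q r s → (ν xor p) xor q ≡ false → (ν xor r) xor s ≡ false → p ≡ r → q ≡ s
    lem false false false _ false _ _ refl = refl
    lem false true true _ true _ _ refl = refl
    lem true false true _ true _ _ refl = refl
    lem true true false _ false _ _ refl = refl
    next-agrees : x b ≡ y b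
    next-agrees = lem (neg G f) (x a) (x b) (y a) (y b) (trans (sym (neg-joins x j)) (zx f (cnt>0 {j = j} {p = p}))) (trans (sym (neg-joins y j)) (zy f (cnt>0 {j = j} {p = p}))) e
  ... | h , l = (λ { (here refl) → e ; (there c∈) → h c∈ }) , l

-- Three odd walks through a common edge

module Core {n m} (G : SG n m) (noK5 : ¬ HasK5NegMinor G) where
  open WalkVertices G public

  module _ (T : ℕ) (ih : PackAll (2 + T)) (w : Fin m → ℕ) (pw : Par w (par (3 + T))) (low : ∀ x → 3 + T ≤ wt G w x)
           (e : Fin m) (u≢v : proj₁ (ends G e) ≢ proj₂ (ends G e)) {l : List Closed} (os : All Odd l) (size : length l ≡ T) where
    private
      u = proj₁ (ends G e)
      v = proj₂ (ends G e)

    Goal = Pack (3 + T) w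

    Triple = Fin 3 → Walk u v

    used : Triple → Fin m → ℕ
    used P f = sum3 λ i → cnt (P i) f

    used-out : ∀ P i f → used P f ≡ cnt (P i) f + sum3 ((λ j → cnt (P j) f) [ i ≔ 0 ])
    used-out P i f = sum3-out (λ j → cnt (P j) f) i

    module Mates (D H : Fin m → ℕ) (eH : ∀ f → w f ≡ (δ e f + D f) + H f) (lower : ∀ x → T ≤ wt G H x) where

      -- Remove the odd walk `e P i`. If every signature keeps weight at least `2 + T`, induction
      -- packs the rest. Otherwise parity improves the failure to a signature of weight at most `T`;
      -- since `H` alone requires `T`, it is tight on `H` and vanishes on the other two paths.
      mate : ∀ P → (∀ i → neg G e xor sgn (P i) ≡ true) → (∀ f → used P f ≡ D f) → ∀ i →
        ((∃ λ x → wt G H x ≡ T × x u ≡ false × (∀ j → j ≢ i → Zero x (cnt (P j)))) → Goal) → Goal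
      mate P odd eD i cont = decide (searchB (λ x → wt G w' x ℕ.<? 2 + T) (λ q lt → subst (_< 2 + T) (wt-cong G w' q) lt))
        where
        rest : Fin m → ℕ
        rest f = sum3 ((λ j → cnt (P j) f) [ i ≔ 0 ])
        w' : Fin m → ℕ
        w' f = H f + rest f
        C : Closed
        C = v , cons e (inj₂ refl) (P i)
        eC : ∀ f → w f ≡ cntC C f + w' f
        eC f = trans (eH f) (trans (cong (λ h → (δ e f + h) + H f) (trans (sym (eD f)) (used-out P i f))) (lem (δ e f) (cnt (P i) f) _ (H f)))
          where
          lem : ∀ a b c d → (a + (b + c)) + d ≡ (a + b) + (d + c)
          lem = solve-∀
        module _ (x : Fin n → Bool) (lt : wt G w' x < 2 + T) where
          parity : par (wt G w' x) ≡ par (2 + T)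
          parity = trans (Par-minus eC pw (λ x → trans (Par-closed C x) (odd i)) x) (lem (par T))
            where
            lem : ∀ b → not (not (not b)) xor true ≡ not (not b)
            lem true = refl
            lem false = refl
          small : wt G H x + wt G rest x ≤ T
          small = subst (_≤ T) (wt-+ G H rest x) (ℕₚ.+-cancelˡ-≤ 2 _ _ (par-gap parity lt))
          tight : wt G H x ≡ T
          tight = ℕₚ.≤-antisym (ℕₚ.≤-trans (ℕₚ.m≤m+n _ _) small) (lower x)
          rest-zero : wt G rest x ≡ 0
          rest-zero = ℕₚ.n≤0⇒n≡0 (ℕₚ.+-cancelˡ-≤ T _ _ (subst₂ _≤_ (cong (_+ wt G rest x) tight) (sym (ℕₚ.+-identityʳ T)) small))
          others : ∀ j → j ≢ i → Zero x (cnt (P j))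
          others j ne f lt = wt⇒zero {x} rest-zero f (ℕₚ.<-≤-trans (subst (0 <_) (sym (≔-away _ ne)) lt) (term≤sum3 ((λ j → cnt (P j) f) [ i ≔ 0 ]) j))
          flip : ∀ f → neg (switch (not ∘ x) G) f ≡ neg (switch x G) f
          flip f = lem (neg G f) (x (proj₁ (ends G f))) (x (proj₂ (ends G f)))
            where
            lem : ∀ p q r → (p xor not q) xor not r ≡ (p xor q) xor r
            lem false false false = refl
            lem false false true = refl
            lem false true false = refl
            lem false true true = refl
            lem true false false = refl
            lem true false true = refl
            lem true true false = refl
            lem true true true = refl
          normalise : ∀ b → x u ≡ b → ∃ λ x → wt G H x ≡ T × x u ≡ false × (∀ j → j ≢ i → Zero x (cnt (P j)))
          normalise false q = x , tight , q , others
          normalise true q = not ∘ x , trans (sumF-≡ λ f → cong (λ b → bit b * H f) (flip f)) tight , cong not q , λ j ne f lt → trans (flip f) (others j ne f lt)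
        decide : Dec (∃ λ x → wt G w' x < 2 + T) → Goal
        decide (no none) = peel ih C (odd i) eC pw λ x → ℕₚ.≮⇒≥ λ lt → none (x , lt)
        decide (yes (x , lt)) = cont (normalise x lt (x u) refl)

    -- The induction on total length makes redistributions tame: a path that repeats a vertex, or
    -- meets `u` or `v` in its interior, is shortened, and the dropped edges return to the leftover
    -- weight.
    core : ∀ d P → (∀ i → neg G e xor sgn (P i) ≡ true) → (∀ f → (δ e f + used P f) + total l f ≤ w f) → sum3 (len' ∘ P) < d → Goal
    core (suc d) P odd fits (s≤s le) = mate P odd (λ _ → refl) 0F λ m₀ → mate P odd (λ _ → refl) 1F λ m₁ → mate P odd (λ _ → refl) 2F λ m₂ →
        main λ { 0F → m₀ ; 1F → m₁ ; 2F → m₂ }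
      where
      D : Fin m → ℕ
      D = used P
      H : Fin m → ℕ
      H f = w f ∸ (δ e f + D f)
      eH : ∀ f → w f ≡ (δ e f + D f) + H f
      eH f = sym (ℕₚ.m+[n∸m]≡n {δ e f + D f} (ℕₚ.≤-trans (ℕₚ.m≤m+n (δ e f + D f) (total l f)) (fits f)))
      lower : ∀ x → T ≤ wt G H x
      lower x = subst (_≤ wt G H x) size (ℕₚ.≤-trans (length≤wt os x) (wt-≤ G (λ f → ℕₚ.+-cancelˡ-≤ (δ e f + D f) _ _ (subst ((δ e f + D f) + total l f ≤_) (eH f) (fits f))) x))
      open Mates D H eH lower

      main : (∀ i → ∃ λ x → wt G H x ≡ T × x u ≡ false × (∀ j → j ≢ i → Zero x (cnt (P j)))) → Goal
      main ms = decideV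
        where
        Y : Fin 3 → Fin n → Bool
        Y i = proj₁ (ms i)
        -- Each path is positive under two of the three mates. These agree at `u`, hence along the
        -- whole path, where they determine the majority. So the majority makes all three paths
        -- positive at once.
        M : Fin n → Bool
        M a = maj (Y 0F a) (Y 1F a) (Y 2F a)
        Mu : M u ≡ false
        Mu = maj-one 0F (λ k → Y k u) λ k q → case trans (sym q) (proj₁ (proj₂ (proj₂ (ms k)))) of λ ()
        zeroX : ∀ i j → j ≢ i → Zero (Y i) (cnt (P j))
        zeroX i = proj₂ (proj₂ (proj₂ (ms i)))
        zeroM : ∀ i → Zero M (cnt (P i))
        zeroM i f lt = trans (cong₂ (λ s t → (neg G f xor s) xor t) (onP _ (inj₁ refl)) (onP _ (inj₂ refl))) (zeroX j i (next3-≢ i) f lt)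
          where
          j = next3 i
          k = next3 j
          k≢ : i ≢ k
          k≢ q = lem i q
            where
            lem : ∀ i → i ≢ next3 (next3 i)
            lem 0F ()
            lem 1F ()
            lem 2F ()
          ag = agree (P i) {Y j} {Y k} (zeroX j i (next3-≢ i)) (zeroX k i k≢) (trans (proj₁ (proj₂ (proj₂ (ms j)))) (sym (proj₁ (proj₂ (proj₂ (ms k))))))
          onP : ∀ c → EndOf f c → M c ≡ Y j c
          onP c ec with edge⇒vs (P i) lt ec
          ... | inj₁ c∈ = maj-two i (λ k → Y k c) (proj₁ ag c∈)
          ... | inj₂ refl = maj-two i (λ k → Y k v) (proj₂ ag)
        G' = switch M G
        wt' : ∀ x → wt G' H x ≡ wt G H (x ⊕ M)
        wt' x = sumF-≡ λ f → cong (λ b → bit b * H f) (lem (neg G f) (M (proj₁ (ends G f))) (M (proj₂ (ends G f))) (x (proj₁ (ends G f))) (x (proj₂ (ends G f))))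
          where
          lem : ∀ ν p q r s → (((ν xor p) xor q) xor r) xor s ≡ (ν xor (r xor p)) xor (s xor q)
          lem ν p q false s rewrite xor-identityʳ ((ν xor p) xor q) = trans (xor-assoc (ν xor p) q s) (cong ((ν xor p) xor_) (xor-comm q s))
          lem ν p q true s = trans (cong (_xor s) (trans (xor-comm ((ν xor p) xor q) true) refl)) (lem' ν p q s)
            where
            lem' : ∀ ν p q s → (not ((ν xor p) xor q)) xor s ≡ (ν xor not p) xor (s xor q)
            lem' false false false s = trans refl (cong not (sym (xor-identityʳ s)))
            lem' false false true false = refl
            lem' false false true true = refl
            lem' false true false s = sym (xor-identityʳ s)
            lem' false true true false = refl
            lem' false true true true = refl
            lem' true false false s = sym (xor-identityʳ s)
            lem' true false true false = refl
            lem' true false true true = refl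
            lem' true true false s = cong not (sym (xor-identityʳ s))
            lem' true true true false = refl
            lem' true true true true = refl
        lower' : ∀ x → T ≤ wt G' H x
        lower' x = subst (T ≤_) (sym (wt' x)) (lower (x ⊕ M))
        positive : ∀ f → 0 < D f → neg G' f ≡ false
        positive f lt = let (i , lt') = sum3-pos (λ i → cnt (P i) f) lt in zeroM i f lt'
        VD : Fin n → Set
        VD a = (a ≡ u ⊎ a ≡ v) ⊎ ∃ λ f → 0 < D f × EndOf f a
        vd? : ∀ a → Dec (VD a)
        vd? a = ((a ≟ u) ⊎-dec (a ≟ v)) ⊎-dec any? λ f → (0 ℕ.<? D f) ×-dec ((a ≟ _) ⊎-dec (a ≟ _))
        open Tightness G' H T lower' using (Tight; module Dependence)
        open Dependence u v VD vd? using (Dep)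

        -- `usedQ` fixes the total multiplicities, so all redistributions leave the same `H` and
        -- share one notion of tightness.
        record Sys (L : Fin 3 → List (Fin n)) : Set where
          field
            Q : Triple
            vsQ : ∀ i → vs (Q i) ≡ u ∷ L i
            usedQ : ∀ f → used Q f ≡ D f
            lenQ : sum3 (len' ∘ Q) ≡ sum3 (len' ∘ P)

          below : ∀ i f → cnt (Q i) f ≤ D f
          below i f = subst (cnt (Q i) f ≤_) (usedQ f) (term≤sum3 (λ i → cnt (Q i) f) i)

          zeroQ : ∀ i → Zero M (cnt (Q i))
          zeroQ i f lt = positive f (ℕₚ.<-≤-trans lt (below i f))

        negE : neg G e xor (M u xor M v) ≡ true
        negE = trans (cong (neg G e xor_) (sym (sgn-zero (P 0F) {M} (zeroM 0F)))) (odd 0F)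

        oddOf : ∀ (q : Walk u v) → Zero M (cnt q) → neg G e xor sgn q ≡ true
        oddOf q z = trans (cong (neg G e xor_) (sgn-zero q {M} z)) negE

        shorten : ∀ {L} (S : Sys L) i (q : Walk u v) → (∀ f → cnt q f ≤ cnt (Sys.Q S i) f) → len' q < len' (Sys.Q S i) → Goal
        shorten {L} S i q c lt = core d Q' odd' fits' (ℕₚ.<-≤-trans (sum3-< _ _ i lens lt') (subst (_≤ d) (sym lenQ) le))
          where
          open Sys S
          Q' : Triple
          Q' = Q [ i ≔ q ]
          at-i : Q' i ≡ q
          at-i = ≔-here Q i
          cnts : ∀ f k → cnt (Q' k) f ≤ cnt (Q k) f
          cnts f k with k ≟ i
          ... | yes refl = c f
          ... | no _ = ℕₚ.≤-refl
          lens : ∀ k → len' (Q' k) ≤ len' (Q k)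
          lens k with k ≟ i
          ... | yes refl = ℕₚ.<⇒≤ lt
          ... | no _ = ℕₚ.≤-refl
          lt' : len' (Q' i) < len' (Q i)
          lt' = subst (λ q → len' q < len' (Q i)) (sym at-i) lt
          odd' : ∀ k → neg G e xor sgn (Q' k) ≡ true
          odd' k = oddOf (Q' k) λ f h → zeroQ k f (ℕₚ.<-≤-trans h (cnts f k))
          fits' : ∀ f → (δ e f + used Q' f) + total l f ≤ w f
          fits' f = ℕₚ.≤-trans (ℕₚ.+-monoˡ-≤ (total l f) (ℕₚ.+-monoʳ-≤ (δ e f) (subst (used Q' f ≤_) (usedQ f) (sum3-≤ _ _ (cnts f))))) (fits f)

        exch : ∀ {L L'} i j → i ≢ j → ∀ a b a' b' z → L i ≡ a ++ z ∷ b → L j ≡ a' ++ z ∷ b' →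
          L' i ≡ a ++ z ∷ b' → L' j ≡ a' ++ z ∷ b → (∀ k → k ≢ i → k ≢ j → L' k ≡ L k) → Sys L → Sys L'
        exch {L} {L'} i j i≢j a b a' b' z Li Lj L'i L'j L'k S
          with splitVs (Sys.Q S i) (u ∷ a) (trans (Sys.vsQ S i) (cong (u ∷_) Li)) | splitVs (Sys.Q S j) (u ∷ a') (trans (Sys.vsQ S j) (cong (u ∷_) Lj))
        ... | splitV p₁ p₂ ep vp₁ vp₂ | splitV q₁ q₂ eq vq₁ vq₂ = record { Q = Q' ; vsQ = vsQ'
            ; usedQ = λ f → trans (sym (sum3-swap _ _ i j i≢j (cnts f) λ k ne ne' → cong (λ q → cnt q f) (Q'k k ne ne'))) (usedQ f)
            ; lenQ = trans (sym (sum3-swap (len' ∘ Q) (len' ∘ Q') i j i≢j lens λ k ne ne' → cong len' (Q'k k ne ne'))) lenQ }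
          where
          open Sys S
          Q' : Triple
          Q' = (Q [ i ≔ p₁ ⊙ q₂ ]) [ j ≔ q₁ ⊙ p₂ ]
          Q'i : Q' i ≡ p₁ ⊙ q₂
          Q'i = trans (≔-away _ i≢j) (≔-here Q i)
          Q'j : Q' j ≡ q₁ ⊙ p₂
          Q'j = ≔-here _ j
          Q'k : ∀ k → k ≢ i → k ≢ j → Q' k ≡ Q k
          Q'k k p q = trans (≔-away _ q) (≔-away Q p)
          vsQ' : ∀ k → vs (Q' k) ≡ u ∷ L' k
          vsQ' k = byCases (k ≟ i) (k ≟ j)
            where
            byCases : Dec (k ≡ i) → Dec (k ≡ j) → vs (Q' k) ≡ u ∷ L' k
            byCases (yes refl) _ = trans (cong vs Q'i) (trans (vs-⊙ p₁ q₂) (trans (cong₂ _++_ vp₁ vq₂) (cong (u ∷_) (sym L'i))))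
            byCases (no _) (yes refl) = trans (cong vs Q'j) (trans (vs-⊙ q₁ p₂) (trans (cong₂ _++_ vq₁ vp₂) (cong (u ∷_) (sym L'j))))
            byCases (no ne) (no ne') = trans (cong vs (Q'k k ne ne')) (trans (vsQ k) (cong (u ∷_) (sym (L'k k ne ne'))))
          lem : ∀ a b c d → (a + b) + (c + d) ≡ (a + d) + (c + b)
          lem = solve-∀
          cnts : ∀ f → cnt (Q i) f + cnt (Q j) f ≡ cnt (Q' i) f + cnt (Q' j) f
          cnts f = trans (cong₂ _+_ (trans (cong (λ q → cnt q f) ep) (cnt-⊙ p₁ p₂ f)) (trans (cong (λ q → cnt q f) eq) (cnt-⊙ q₁ q₂ f)))
            (trans (lem (cnt p₁ f) (cnt p₂ f) (cnt q₁ f) (cnt q₂ f))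
            (sym (cong₂ _+_ (trans (cong (λ q → cnt q f) Q'i) (cnt-⊙ p₁ q₂ f)) (trans (cong (λ q → cnt q f) Q'j) (cnt-⊙ q₁ p₂ f)))))
          lens : len' (Q i) + len' (Q j) ≡ len' (Q' i) + len' (Q' j)
          lens = trans (cong₂ _+_ (trans (cong len' ep) (len-⊙ p₁ p₂)) (trans (cong len' eq) (len-⊙ q₁ q₂)))
            (trans (lem (len' p₁) (len' p₂) (len' q₁) (len' q₂))
            (sym (cong₂ _+_ (trans (cong len' Q'i) (len-⊙ p₁ q₂)) (trans (cong len' Q'j) (len-⊙ q₁ p₂)))))

        nonempty : ∀ {a b} (p : Walk a b) {x xs} → vs p ≡ x ∷ xs → 0 < len' p
        nonempty (cons _ _ _) _ = s≤s z≤n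

        rep : ∀ {L} → Sys L → ∀ i x → Before (L i) x x → Goal
        rep {L} S i x (p , q , s , e') with splitVs (Sys.Q S i) (u ∷ p) (trans (Sys.vsQ S i) (cong (u ∷_) e'))
        ... | splitV p₁ p₂ ep vp₁ vp₂ with splitVs p₂ (x ∷ q) vp₂
        ... | splitV q₁ q₂ eq vq₁ vq₂ = shorten S i (p₁ ⊙ q₂) c lt
          where
          open Sys S
          c : ∀ f → cnt (p₁ ⊙ q₂) f ≤ cnt (Q i) f
          c f = subst₂ _≤_ (sym (cnt-⊙ p₁ q₂ f)) (sym (trans (cong (λ q → cnt q f) ep) (trans (cnt-⊙ p₁ p₂ f) (cong (cnt p₁ f +_) (trans (cong (λ q → cnt q f) eq) (cnt-⊙ q₁ q₂ f))))))
            (ℕₚ.+-monoʳ-≤ (cnt p₁ f) (ℕₚ.m≤n+m _ (cnt q₁ f)))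
          lt : len' (p₁ ⊙ q₂) < len' (Q i)
          lt = subst₂ _<_ (sym (len-⊙ p₁ q₂)) (sym (trans (cong len' ep) (trans (len-⊙ p₁ p₂) (cong (len' p₁ +_) (trans (cong len' eq) (len-⊙ q₁ q₂))))))
            (ℕₚ.+-monoʳ-< (len' p₁) (ℕₚ.+-monoˡ-≤ (len' q₂) (nonempty q₁ vq₁)))

        avoid-u : ∀ {L} → Sys L → ∀ i → u ∈ L i → Goal
        avoid-u {L} S i u∈ with ∈-∃++ u∈
        ... | a , b , e' with splitVs (Sys.Q S i) (u ∷ a) (trans (Sys.vsQ S i) (cong (u ∷_) e'))
        ... | splitV p₁ p₂ ep vp₁ vp₂ = shorten S i p₂
            (λ f → subst (cnt p₂ f ≤_) (sym (trans (cong (λ q → cnt q f) ep) (cnt-⊙ p₁ p₂ f))) (ℕₚ.m≤n+m _ (cnt p₁ f)))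
            (subst (len' p₂ <_) (sym (trans (cong len' ep) (len-⊙ p₁ p₂))) (ℕₚ.+-monoˡ-≤ (len' p₂) (nonempty p₁ vp₁)))

        avoid-v : ∀ {L} → Sys L → ∀ i → v ∈ L i → Goal
        avoid-v {L} S i v∈ with ∈-∃++ v∈
        ... | a , b , e' with splitVs (Sys.Q S i) (u ∷ a) (trans (Sys.vsQ S i) (cong (u ∷_) e'))
        ... | splitV p₁ p₂ ep vp₁ vp₂ = shorten S i p₁
            (λ f → subst (cnt p₁ f ≤_) (sym (trans (cong (λ q → cnt q f) ep) (cnt-⊙ p₁ p₂ f))) (ℕₚ.m≤m+n _ _))
            (subst (len' p₁ <_) (sym (trans (cong len' ep) (len-⊙ p₁ p₂))) (ℕₚ.m<m+n (len' p₁) (nonempty p₂ vp₂)))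

        inVD : ∀ {L} → Sys L → ∀ i {a} → a ∈ L i → VD a
        inVD S i {a} a∈ with vs⇒edge (Sys.Q S i) (subst (a ∈_) (sym (Sys.vsQ S i)) (there a∈))
        ... | f , lt , ef = inj₂ (f , ℕₚ.<-≤-trans lt (Sys.below S i f) , ef)

        mates : ∀ {L} → Sys L → ∀ i → ((∃ λ x → Tight x × x u ≡ false × x v ≡ false ×
          (∀ a → VD a → x a ≡ true → a ∈ L i × (∀ j → j ≢ i → a ∉ L j))) → Goal) → Goal
        mates {L} S i cont = mate Q (λ k → oddOf (Q k) (zeroQ k)) usedQ i λ (x , t , xu , z) → cont (convert x t xu z)
          where
          open Sys S
          convert : ∀ x → wt G H x ≡ T → x u ≡ false → (∀ j → j ≢ i → Zero x (cnt (Q j))) → _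
          convert x t xu z = x ⊕ M , trans (wt' (x ⊕ M)) (trans (wt-cong G H (λ a → lem (x a) (M a))) t) , cong₂ _xor_ xu Mu , xv , trace
            where
            lem : ∀ p q → (p xor q) xor q ≡ p
            lem p q = trans (xor-assoc p q q) (trans (cong (p xor_) (xor-same q)) (xor-identityʳ p))
            ag : ∀ j → j ≢ i → _
            ag j ne = agree (Q j) {x} {M} (z j ne) (zeroQ j) (trans xu (sym Mu))
            off : ∀ {c} → x c ≡ M c → (x ⊕ M) c ≡ false
            off {c} q = trans (cong (_xor M c) q) (xor-same (M c))
            xv : (x ⊕ M) v ≡ false
            xv = off (proj₂ (ag (next3 i) (next3-≢ i ∘ sym)))
            on : ∀ j → j ≢ i → ∀ {a} → a ∈ L j → (x ⊕ M) a ≡ false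
            on j ne {a} a∈ = off (proj₁ (ag j ne) (subst (a ∈_) (sym (vsQ j)) (there a∈)))
            trace : ∀ a → VD a → (x ⊕ M) a ≡ true → a ∈ L i × (∀ j → j ≢ i → a ∉ L j)
            trace a va h = place va , λ j ne a∈ → case trans (sym h) (on j ne a∈) of λ ()
              where
              place : VD a → a ∈ L i
              place (inj₁ (inj₁ refl)) = case trans (sym h) (cong₂ _xor_ xu Mu) of λ ()
              place (inj₁ (inj₂ refl)) = case trans (sym h) xv of λ ()
              place (inj₂ (f , lt , ef)) with sum3-pos (λ k → cnt (Q k) f) (subst (0 <_) (sym (usedQ f)) lt)
              ... | k , lt' with edge⇒vs (Q k) lt' ef
              ... | inj₂ refl = case trans (sym h) xv of λ ()
              ... | inj₁ a∈ with subst (a ∈_) (vsQ k) a∈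
              ... | here refl = case trans (sym h) (cong₂ _xor_ xu Mu) of λ ()
              ... | there a∈L with k ≟ i
              ... | yes refl = a∈L
              ... | no ne = case trans (sym h) (on k ne a∈L) of λ ()

        -- A tight signature with empty trace is positive on all three paths. Its weight is then `T`
        -- from `H` and at most one from the copy of `e`, which is below `3 + T`.
        notEmpty : ¬ Dep (λ _ → false)
        notEmpty (x , t , xu , xv , tr) = ℕₚ.<⇒≱ {1 + T} {3 + T} (s≤s (ℕₚ.n≤1+n _)) (ℕₚ.≤-trans (low (x ⊕ M)) total-small)
          where
          off : ∀ a → VD a → (x ⊕ M) a ≡ M a
          off a va = cong (_xor M a) (≢true λ h → case tr a va h of λ ())
          zeroD : Zero (x ⊕ M) D
          zeroD f lt = trans (cong₂ (λ s t → (neg G f xor s) xor t) (off _ (inj₂ (f , lt , inj₁ refl))) (off _ (inj₂ (f , lt , inj₂ refl)))) (positive f lt)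
          bit≤1 : ∀ b → bit b ≤ 1
          bit≤1 true = ℕₚ.≤-refl
          bit≤1 false = z≤n
          total-small : wt G w (x ⊕ M) ≤ 1 + T
          total-small = begin
            wt G w (x ⊕ M)                                          ≡⟨ wt-ext eH (x ⊕ M) ⟩
            wt G (λ f → (δ e f + D f) + H f) (x ⊕ M)                ≡⟨ wt-+ G (λ f → δ e f + D f) H (x ⊕ M) ⟩
            wt G (λ f → δ e f + D f) (x ⊕ M) + wt G H (x ⊕ M)       ≡⟨ cong₂ _+_ (wt-+ G (δ e) D (x ⊕ M)) (trans (sym (wt' x)) t) ⟩
            (wt G (δ e) (x ⊕ M) + wt G D (x ⊕ M)) + T               ≡⟨ cong (λ h → (wt G (δ e) (x ⊕ M) + h) + T) (zero⇒wt {x ⊕ M} zeroD) ⟩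
            (wt G (δ e) (x ⊕ M) + 0) + T                            ≤⟨ ℕₚ.+-monoˡ-≤ T (subst (_≤ 1) (sym (trans (ℕₚ.+-identityʳ _) (wt-δ e (x ⊕ M)))) (bit≤1 _)) ⟩
            1 + T ∎
            where open ℕₚ.≤-Reasoning

        systems : Sweep.Systems G' H T lower' u v VD vd? Goal
        systems = record
          { Sys = Sys
          ; resp = λ q S → record { Q = Sys.Q S ; vsQ = λ i → trans (Sys.vsQ S i) (cong (u ∷_) (q i)) ; usedQ = Sys.usedQ S ; lenQ = Sys.lenQ S }
          ; exchange = exch
          ; repeat = rep
          ; avoids-u = avoid-u
          ; adjacent = λ S i → walk-chain (Sys.Q S i) (Sys.vsQ S i) λ {f} lt j → f , j , Sys.zeroQ S i f lt
          ; in-VD = inVD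
          ; mate = mates
          ; VDu = inj₁ (inj₁ refl)
          ; VDv = inj₁ (inj₂ refl)
          ; negative = e , inj₁ refl , trans (xor-assoc (neg G e) (M u) (M v)) negE
          ; not-empty = notEmpty
          ; onMinor = λ k → ⊥-elim (noK5 (hasK5-step (bySwitch G M) k)) }

        inner : ∀ (p : Walk u v) → ∃ λ L → vs p ≡ u ∷ L
        inner p = go p u≢v
          where
          go : ∀ {a b} (p : Walk a b) → a ≢ b → ∃ λ L → vs p ≡ a ∷ L
          go [] ne = ⊥-elim (ne refl)
          go (cons f j p) _ = vs p , refl

        L₀ : Fin 3 → List (Fin n)
        L₀ i = proj₁ (inner (P i))
        S₀ : Sys L₀
        S₀ = record { Q = P ; vsQ = λ i → proj₂ (inner (P i)) ; usedQ = λ f → refl ; lenQ = refl }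

        decideV : Goal
        decideV with any? (λ i → v ∈? L₀ i)
        ... | yes (i , v∈) = avoid-v S₀ i v∈
        ... | no v∉ = Phases.sweep G' H T lower' u v VD vd? systems S₀ u≢v λ i v∈ → v∉ (i , v∈)

sumF-< : ∀ {m} {f g : Fin m → ℕ} i → (∀ j → f j ≤ g j) → f i < g i → sumF f < sumF g
sumF-< zero le lt = ℕₚ.+-mono-<-≤ lt (sumF-≤ (le ∘ suc))
sumF-< (suc i) le lt = ℕₚ.+-mono-≤-< (le zero) (sumF-< i (le ∘ suc) lt)

-- Induction on the number of walks and on the deficit

module PackingTheorem {n m} (G : SG n m) (noK5 : ¬ HasK5NegMinor G) where
  open Core G noK5

  private
    -- Three walks through `e` use three copies of it. Giving back the two borrowed ones leaves a
    -- single `e` with three paths, as `core` expects.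
    fit₃ : ∀ d p q r l w → (d + p) + ((d + q) + ((d + r) + l)) ≤ w + 2 * d → (d + ((p + q) + r)) + l ≤ w
    fit₃ d p q r l w h = ℕₚ.+-cancelʳ-≤ (2 * d) _ _ (subst (_≤ w + 2 * d) (lem d p q r l) h)
      where
      lem : ∀ d p q r l → (d + p) + ((d + q) + ((d + r) + l)) ≡ ((d + ((p + q) + r)) + l) + 2 * d
      lem = solve-∀

    fitLoop : ∀ d p q c l w → (d + p) + ((d + q) + (c + l)) ≤ w + 2 * d → p + (q + (c + l)) ≤ w
    fitLoop d p q c l w h = ℕₚ.+-cancelʳ-≤ (2 * d) _ _ (subst (_≤ w + 2 * d) (lem d p q c l) h)
      where
      lem : ∀ d p q c l → (d + p) + ((d + q) + (c + l)) ≡ (p + (q + (c + l))) + 2 * d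
      lem = solve-∀

    closeUp : ∀ {a b} (p : Walk a b) → a ≡ b → Σ Closed λ C → (∀ f → cntC C f ≡ cnt p f) × sgn (proj₂ C) ≡ sgn p
    closeUp p refl = (_ , p) , (λ f → refl) , refl

    total-replicate : ∀ k C f → total (replicate k C) f ≡ k * cntC C f
    total-replicate zero C f = refl
    total-replicate (suc k) C f = cong (cntC C f +_) (total-replicate k C f)

    fromCore : ∀ {t} T → t ≡ 2 + T → PackAll t → ∀ w → Par w (par (suc t)) → (∀ x → suc t ≤ wt G w x) →
      ∀ e → proj₁ (ends G e) ≢ proj₂ (ends G e) → ∀ {l} → All Odd l → length l ≡ T → (P : Fin 3 → Walk (proj₁ (ends G e)) (proj₂ (ends G e))) →
      (∀ i → neg G e xor sgn (P i) ≡ true) → (∀ f → (δ e f + sum3 (λ i → cnt (P i) f)) + total l f ≤ w f) → Pack (suc t) w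
    fromCore T refl ih w pw low e ne os s P odd fits = core T ih w pw low e ne os s _ P odd fits ℕₚ.≤-refl

  module Augment (t : ℕ) (ih : PackAll t) (w : Fin m → ℕ) (pw : Par w (par (suc t))) (low : ∀ x → suc t ≤ wt G w x) where

    -- A loop keeps its sign under switching, so a single copy takes just one from the weight of
    -- every signature. Loops are treated apart because `core` needs an edge with distinct ends.
    negativeLoop : ∀ f → 0 < w f → neg G f ≡ true → proj₁ (ends G f) ≡ proj₂ (ends G f) → Pack (suc t) w
    negativeLoop f pos ng q = peel ih C (trans (xor-identityʳ _) ng) eC pw low'
      where
      C : Closed
      C = proj₁ (ends G f) , cons f (inj₁ (cong (proj₁ (ends G f) ,_) (sym q))) []
      δ≤w : ∀ g → δ f g ≤ w g
      δ≤w g with f ≟ g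
      ... | yes refl = pos
      ... | no _ = z≤n
      eC : ∀ g → w g ≡ (δ f g + 0) + (w g ∸ δ f g)
      eC g = sym (trans (cong (_+ (w g ∸ δ f g)) (ℕₚ.+-identityʳ (δ f g))) (ℕₚ.m+[n∸m]≡n (δ≤w g)))
      bit≤1 : ∀ b → bit b ≤ 1
      bit≤1 true = ℕₚ.≤-refl
      bit≤1 false = z≤n
      one : ∀ x → wt G (cntC C) x ≤ 1
      one x = subst (_≤ 1) (sym (trans (wt-ext (λ g → ℕₚ.+-identityʳ (δ f g)) x) (wt-δ f x))) (bit≤1 _)
      low' : ∀ x → t ≤ wt G (λ g → w g ∸ δ f g) x
      low' x = ℕₚ.+-cancelˡ-≤ 1 _ _ (ℕₚ.≤-trans (low x) (subst (_≤ 1 + wt G (λ g → w g ∸ δ f g) x)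
        (sym (trans (wt-ext eC x) (wt-+ G (cntC C) _ x))) (ℕₚ.+-monoˡ-≤ _ (one x))))

    -- An odd trail exists, since otherwise some signature would have weight zero, and every edge
    -- has room for `suc t` copies of it.
    saturated : (∀ f → 0 < w f → suc t ≤ w f) → Pack (suc t) w
    saturated big with bipartite-or-odd w
    ... | inj₁ (x , z) = case subst (suc t ≤_) (zero⇒wt {x} z) (low x) of λ ()
    ... | inj₂ odd with oddOn-trail odd
    ... | C , oC , tr , le = pack (replicate (suc t) C) (Allₚ.replicate⁺ (suc t) oC) (length-replicate (suc t)) fit
      where
      fit : ∀ f → total (replicate (suc t) C) f ≤ w f
      fit f rewrite total-replicate (suc t) C f with cntC C f in ec | le f | tr f
      ... | zero | _ | _ = subst (_≤ w f) (sym (ℕₚ.*-zeroʳ (suc t))) z≤n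
      ... | suc zero | pos | _ = subst (_≤ w f) (sym (ℕₚ.*-identityʳ (suc t))) (big f pos)
      ... | suc (suc _) | _ | s≤s ()

    module _ (e : Fin m) (pos : 0 < w e) (noNegLoop : proj₁ (ends G e) ≡ proj₂ (ends G e) → neg G e ≡ false) where
      private
        u = proj₁ (ends G e)
        v = proj₂ (ends G e)
      -- Two copies are added, so that the parity of every signature is unchanged.
      w⁺ : Fin m → ℕ
      w⁺ f = w f + 2 * δ e f

      Par-w⁺ : Par w⁺ (par (suc t))
      Par-w⁺ x = trans (cong par (trans (wt-ext (λ f → lem (w f) (δ e f)) x) (trans (wt-+ G w (λ f → δ e f + δ e f) x) (cong (wt G w x +_) (wt-+ G (δ e) (δ e) x)))))
        (trans (par-+ (wt G w x) _) (trans (cong₂ _xor_ (pw x) (trans (par-+ (wt G (δ e) x) _) (xor-same (par (wt G (δ e) x))))) (xor-identityʳ _)))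
        where
        lem : ∀ a b → a + 2 * b ≡ a + (b + b)
        lem = solve-∀

      module _ {l} (os : All Odd l) (ts : Trails l) (size : length l ≡ suc t) (fits : ∀ f → total l f ≤ w⁺ f) where

        atMost : total l e ≤ w e → Pack (suc t) w
        atMost le = pack l os size fit
          where
          fit : ∀ f → total l f ≤ w f
          fit f with e ≟ f
          ... | yes refl = le
          ... | no ne = subst (total l f ≤_) (trans (cong (λ d → w f + 2 * d) (δ-other ne)) (ℕₚ.+-identityʳ (w f))) (fits f)

        oneMore : total l e ≡ suc (w e) → Pack (suc t) w
        oneMore eq with extract l e os ts (subst (0 <_) (sym eq) (s≤s z≤n))
        ... | extracted C r oC or _ once s sm with openAt C e (subst (0 <_) (sym once) (s≤s z≤n))
        ... | P , cP , sP = reroute e {R' = R'} P (trans (sym sP) oC) or (trans (sym s) size) parR sum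
          where
          R : Fin m → ℕ
          R f = w⁺ f ∸ total l f
          eR : ∀ f → w⁺ f ≡ total l f + R f
          eR f = sym (ℕₚ.m+[n∸m]≡n (fits f))
          R' : Fin m → ℕ
          R' f = R f ∸ δ e f
          Re : R e ≡ 1
          Re = trans (cong₂ _∸_ (cong (λ d → w e + 2 * d) (δ-self e)) eq) (trans (cong (_∸ suc (w e)) (ℕₚ.+-suc (w e) 1)) (ℕₚ.m+n∸m≡n (w e) 1))
          δ≤R : ∀ f → δ e f ≤ R f
          δ≤R f = byCase (e ≟ f)
            where
            byCase : Dec (e ≡ f) → δ e f ≤ R f
            byCase (yes refl) = subst₂ _≤_ (sym (δ-self e)) (sym Re) ℕₚ.≤-refl
            byCase (no ne) = subst (_≤ R f) (sym (δ-other ne)) z≤n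
          eR' : ∀ f → δ e f + R' f ≡ R f
          eR' f = ℕₚ.m+[n∸m]≡n (δ≤R f)
          parR : Par (λ f → δ e f + R' f) false
          parR x = trans (cong par (wt-ext eR' x)) (trans (Par-minus eR Par-w⁺ (Par-total os) x) (trans (cong (λ k → par (suc t) xor par k) size) (xor-same (par (suc t)))))
          sum : ∀ f → ((δ e f + cnt P f) + total r f) + (δ e f + R' f) ≡ w⁺ f
          sum f = trans (cong₂ _+_ (trans (cong (_+ total r f) (sym (cP f))) (sym (sm f))) (eR' f)) (sym (eR f))

        -- As `w e` is positive, `e` is used at least three times, and by three different walks
        -- because all are trails. If `e` is a loop it is positive, and leaving it out of two walks
        -- is enough.
        twoMore : total l e ≡ 2 + w e → Pack (suc t) w
        twoMore eq with extract l e os ts (subst (0 <_) (sym eq) (s≤s z≤n))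
        ... | extracted C₁ l₁ o₁ os₁ ts₁ once₁ s₁ sm₁ with extract l₁ e os₁ ts₁ (subst (0 <_) (sym e₁) (s≤s z≤n))
          where
          e₁ : total l₁ e ≡ suc (w e)
          e₁ = ℕₚ.suc-injective (trans (sym (trans (sm₁ e) (cong (_+ total l₁ e) once₁))) eq)
        ... | extracted C₂ l₂ o₂ os₂ ts₂ once₂ s₂ sm₂ with extract l₂ e os₂ ts₂ (subst (0 <_) (sym e₂) pos)
          where
          e₁ : total l₁ e ≡ suc (w e)
          e₁ = ℕₚ.suc-injective (trans (sym (trans (sm₁ e) (cong (_+ total l₁ e) once₁))) eq)
          e₂ : total l₂ e ≡ w e
          e₂ = ℕₚ.suc-injective (trans (sym (trans (sm₂ e) (cong (_+ total l₂ e) once₂))) e₁)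
        ... | extracted C₃ l₃ o₃ os₃ ts₃ once₃ s₃ sm₃
          with openAt C₁ e (subst (0 <_) (sym once₁) (s≤s z≤n)) | openAt C₂ e (subst (0 <_) (sym once₂) (s≤s z≤n)) | openAt C₃ e (subst (0 <_) (sym once₃) (s≤s z≤n))
        ... | P₁ , c₁ , g₁ | P₂ , c₂ , g₂ | P₃ , c₃ , g₃ = byLoop (u ≟ v)
          where
          all : ∀ f → total l f ≡ (δ e f + cnt P₁ f) + ((δ e f + cnt P₂ f) + (cntC C₃ f + total l₃ f))
          all f = trans (sm₁ f) (cong₂ _+_ (c₁ f) (trans (sm₂ f) (cong₂ _+_ (c₂ f) (sm₃ f))))
          byLoop : Dec (u ≡ v) → Pack (suc t) w
          byLoop (yes q) with closeUp P₁ q | closeUp P₂ q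
          ... | D₁ , d₁ , h₁ | D₂ , d₂ , h₂ = pack (D₁ ∷ D₂ ∷ C₃ ∷ l₃) (trans h₁ (odd g₁ o₁) ∷ trans h₂ (odd g₂ o₂) ∷ o₃ ∷ os₃)
              (trans (sym (trans s₁ (cong suc (trans s₂ (cong suc s₃))))) size) fit
            where
            odd : ∀ {s p} → s ≡ neg G e xor p → s ≡ true → p ≡ true
            odd {s} {p} a b = trans (sym (trans a (cong (_xor p) (noNegLoop q)))) b
            fit : ∀ f → cntC D₁ f + (cntC D₂ f + (cntC C₃ f + total l₃ f)) ≤ w f
            fit f = subst₂ (λ a b → a + (b + (cntC C₃ f + total l₃ f)) ≤ w f) (sym (d₁ f)) (sym (d₂ f))
              (fitLoop (δ e f) (cnt P₁ f) (cnt P₂ f) (cntC C₃ f) (total l₃ f) (w f) (subst (_≤ w⁺ f) (all f) (fits f)))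
          byLoop (no ne) = fromCore (length l₃) (ℕₚ.suc-injective (trans (sym size) (trans s₁ (cong suc (trans s₂ (cong suc s₃)))))) ih w pw low e ne os₃ refl P odd fit
            where
            P : Fin 3 → Walk u v
            P 0F = P₁
            P 1F = P₂
            P 2F = P₃
            odd : ∀ i → neg G e xor sgn (P i) ≡ true
            odd 0F = trans (sym g₁) o₁
            odd 1F = trans (sym g₂) o₂
            odd 2F = trans (sym g₃) o₃
            fit : ∀ f → (δ e f + sum3 (λ i → cnt (P i) f)) + total l₃ f ≤ w f
            fit f = fit₃ (δ e f) (cnt P₁ f) (cnt P₂ f) (cnt P₃ f) (total l₃ f) (w f)
              (subst (_≤ w⁺ f) (trans (all f) (cong (λ c → (δ e f + cnt P₁ f) + ((δ e f + cnt P₂ f) + (c + total l₃ f))) (c₃ f))) (fits f))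

        repair : Pack (suc t) w
        repair = byCases (total l e ℕ.≤? w e) (total l e ℕ.≟ suc (w e))
          where
          byCases : Dec (total l e ≤ w e) → Dec (total l e ≡ suc (w e)) → Pack (suc t) w
          byCases (yes le) _ = atMost le
          byCases (no _) (yes eq) = oneMore eq
          byCases (no gt) (no ne) = twoMore (ℕₚ.≤-antisym
            (subst (total l e ≤_) (trans (cong (λ d → w e + 2 * d) (δ-self e)) (ℕₚ.+-comm (w e) 2)) (fits e))
            (ℕₚ.≤∧≢⇒< (ℕₚ.≰⇒> gt) (ne ∘ sym)))

  deficit : ℕ → (Fin m → ℕ) → ℕ
  deficit t w = sumF λ f → t ∸ w f

  packAll : ∀ t → PackAll t
  packStep : ∀ t → PackAll t → ∀ d w → Par w (par (suc t)) → (∀ x → suc t ≤ wt G w x) → deficit (suc t) w < d → Pack (suc t) w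

  packAll zero w pw low = pack [] [] refl λ f → z≤n
  packAll (suc t) w pw low = packStep t (packAll t) _ w pw low ℕₚ.≤-refl

  packStep t ih (suc d) w pw low (s≤s le)
    with any? (λ f → (0 ℕ.<? w f) ×-dec ((neg G f Data.Bool.≟ true) ×-dec (proj₁ (ends G f) ≟ proj₂ (ends G f))))
  ... | yes (f , pos , ng , q) = Augment.negativeLoop t ih w pw low f pos ng q
  ... | no noLoop with any? (λ f → (0 ℕ.<? w f) ×-dec (w f ℕ.<? suc t))
  ... | no none = Augment.saturated t ih w pw low λ f pos → ℕₚ.≮⇒≥ λ lt → none (f , pos , lt)
  ... | yes (e , pos , lt) = fromIH (packStep t ih d w⁺' (Par-w⁺ e pos noNeg) (λ x → ℕₚ.≤-trans (low x) (wt-≤ G (λ f → ℕₚ.m≤m+n (w f) (2 * δ e f)) x)) (ℕₚ.<-≤-trans smaller le))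
    where
    open Augment t ih w pw low
    noNeg : proj₁ (ends G e) ≡ proj₂ (ends G e) → neg G e ≡ false
    noNeg q = ≢true λ ng → noLoop (e , pos , ng , q)
    w⁺' = w⁺ e pos noNeg
    smaller : deficit (suc t) w⁺' < deficit (suc t) w
    smaller = sumF-< e (λ f → ℕₚ.∸-monoʳ-≤ (suc t) (ℕₚ.m≤m+n (w f) (2 * δ e f)))
      (ℕₚ.≤-<-trans (ℕₚ.∸-monoʳ-≤ (suc t) (subst (w e <_) (cong (λ d → w e + 2 * d) (sym (δ-self e))) (ℕₚ.m<m+n (w e) (s≤s z≤n)))) (ℕₚ.∸-monoʳ-< {suc t} ℕₚ.≤-refl lt))
    fromIH : Pack (suc t) w⁺' → Pack (suc t) w
    fromIH (pack l os s fits) with trailify l os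
    ... | l' , os' , ts , s' , le' = repair e pos noNeg os' ts (trans s' s) λ f → ℕₚ.≤-trans (le' f) (fits f)

-- From packings to double covers

repetition : ∀ {n} (l : List (Fin n)) → (∃ λ x → Before l x x) ⊎ Unique l
repetition [] = inj₂ []
repetition (x ∷ l) with x ∈? l
... | yes x∈ = let (q , s , e) = ∈-∃++ x∈ in inj₁ (x , [] , q , s , cong (x ∷_) e)
... | no x∉ with repetition l
... | inj₁ (y , p , q , s , e) = inj₁ (y , x ∷ p , q , s , cong (x ∷_) e)
... | inj₂ u = inj₂ (Allₚ.¬Any⇒All¬ l x∉ ∷ u)

countTrue-sum : ∀ {m} (f : Fin m → Bool) → countTrue f ≡ sumF (bit ∘ f)
countTrue-sum {zero} f = refl
countTrue-sum {suc m} f with f zero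
... | true = cong suc (countTrue-sum (f ∘ suc))
... | false = countTrue-sum (f ∘ suc)

sumF-punchIn : ∀ {m} (h : Fin (suc m) → ℕ) e → sumF h ≡ h e + sumF (h ∘ punchIn e)
sumF-punchIn h zero = refl
sumF-punchIn {suc m} h (suc e) = trans (cong (h zero +_) (sumF-punchIn (h ∘ suc) e)) (lem (h zero) (h (suc e)) _)
  where
  lem : ∀ a b c → a + (b + c) ≡ b + (a + c)
  lem = solve-∀

par⇒%2 : ∀ n → par n ≡ true → n % 2 ≡ 1
par⇒%2 (suc zero) p = refl
par⇒%2 (suc (suc n)) p = trans (trans (cong (_% 2) (ℕₚ.+-comm 2 n)) ([m+n]%n≡m%n n 2)) (par⇒%2 n (trans (sym (not-involutive (par n))) p))

frustration : ∀ {n m} (G : SG n m) {k} → Critical G k → Frustration G k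
frustration {m = zero} G c = c
frustration {m = suc m} G c = proj₁ c

-- A minimum signature of `G` without `e` has `k - 1` negative edges. If `e` were positive in it,
-- `G` would have a signature with fewer than `k`.
critical-edge : ∀ {n m} (G : SG n m) {k} → Critical G k → ∀ e → ∃ λ x → numNeg (switch x G) ≡ k × neg (switch x G) e ≡ true
critical-edge {m = suc m} G {k} (fr , del) e with del e
... | j , refl , (x , ex) , _ = x , both (neg (switch x G) e) refl
  where
  count : numNeg (switch x G) ≡ bit (neg (switch x G) e) + j
  count = trans (countTrue-sum (neg (switch x G))) (trans (sumF-punchIn (bit ∘ neg (switch x G)) e)
    (cong (bit (neg (switch x G) e) +_) (trans (sym (countTrue-sum (neg (switch x G) ∘ punchIn e))) ex)))
  both : ∀ b → neg (switch x G) e ≡ b → numNeg (switch x G) ≡ suc j × neg (switch x G) e ≡ true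
  both true q = trans count (cong (λ b → bit b + j) q) , q
  both false q = ⊥-elim (ℕₚ.<⇒≱ ℕₚ.≤-refl (subst (suc j ≤_) (trans count (cong (λ b → bit b + j) q)) (proj₂ fr x)))

module Covers {n m} (G : SG n m) where
  open WalkVertices G

  Simple : Closed → Set
  Simple (_ , p) = Unique (vs p)

  -- A repeated vertex cuts a closed walk into two closed walks whose signs add, so one of them is
  -- odd and it is shorter.
  simpleCycle : ∀ d (C : Closed) → Odd C → len' (proj₂ C) < d → Σ Closed λ D → Odd D × Simple D × (∀ f → cntC D f ≤ cntC C f)
  simpleCycle (suc d) (a , p) o (s≤s le) with repetition (vs p)
  ... | inj₂ u = (a , p) , o , u , λ f → ℕₚ.≤-refl
  ... | inj₁ (z , xs , ys , zs , e) with splitVs p xs e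
  ... | splitV p₁ p₂ refl v₁ v₂ with splitVs p₂ (z ∷ ys) v₂
  ... | splitV q₁ q₂ refl w₁ w₂ = choose (xor-odd {sgn q₁} (trans (sym signs) o))
    where
    nonempty : ∀ {a b} (p : Walk a b) {x xs} → vs p ≡ x ∷ xs → 0 < len' p
    nonempty (cons _ _ _) _ = s≤s z≤n
    signs : sgn (p₁ ⊙ (q₁ ⊙ q₂)) ≡ sgn q₁ xor (sgn p₁ xor sgn q₂)
    signs = trans (sgn-⊙ p₁ (q₁ ⊙ q₂)) (trans (cong (sgn p₁ xor_) (sgn-⊙ q₁ q₂)) (lem (sgn p₁) (sgn q₁) (sgn q₂)))
      where
      lem : ∀ a b c → a xor (b xor c) ≡ b xor (a xor c)
      lem false b c = refl
      lem true false c = refl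
      lem true true c = refl
    lens : len' (p₁ ⊙ (q₁ ⊙ q₂)) ≡ len' p₁ + (len' q₁ + len' q₂)
    lens = trans (len-⊙ p₁ _) (cong (len' p₁ +_) (len-⊙ q₁ q₂))
    cnts : ∀ f → cnt (p₁ ⊙ (q₁ ⊙ q₂)) f ≡ cnt p₁ f + (cnt q₁ f + cnt q₂ f)
    cnts f = trans (cnt-⊙ p₁ _ f) (cong (cnt p₁ f +_) (cnt-⊙ q₁ q₂ f))
    use : ∀ D → Odd D → len' (proj₂ D) < d → (∀ f → cntC D f ≤ cnt (p₁ ⊙ (q₁ ⊙ q₂)) f) →
      Σ Closed λ D → Odd D × Simple D × (∀ f → cntC D f ≤ cnt (p₁ ⊙ (q₁ ⊙ q₂)) f)
    use D oD lt c with simpleCycle d D oD lt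
    ... | E , oE , sE , cE = E , oE , sE , λ f → ℕₚ.≤-trans (cE f) (c f)
    choose : sgn q₁ ≡ true ⊎ sgn p₁ xor sgn q₂ ≡ true → _
    choose (inj₁ h) = use (z , q₁) h
      (ℕₚ.<-≤-trans (subst (len' q₁ <_) (sym lens) (ℕₚ.<-≤-trans (ℕₚ.m<m+n (len' q₁) (nonempty q₂ w₂)) (ℕₚ.m≤n+m _ (len' p₁)))) le)
      (λ f → subst (cnt q₁ f ≤_) (sym (cnts f)) (ℕₚ.≤-trans (ℕₚ.m≤m+n _ (cnt q₂ f)) (ℕₚ.m≤n+m _ (cnt p₁ f))))
    choose (inj₂ h) = use (a , p₁ ⊙ q₂) (trans (sgn-⊙ p₁ q₂) h)
      (ℕₚ.<-≤-trans (subst₂ _<_ (sym (len-⊙ p₁ q₂)) (sym lens) (ℕₚ.+-monoʳ-< (len' p₁) (ℕₚ.m<n+m (len' q₂) (nonempty q₁ w₁)))) le)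
      (λ f → subst₂ _≤_ (sym (cnt-⊙ p₁ q₂ f)) (sym (cnts f)) (ℕₚ.+-monoʳ-≤ (cnt p₁ f) (ℕₚ.m≤n+m _ (cnt q₁ f))))

  vertexAt : ∀ {a b} (p : Walk a b) → Fin (suc (len' p)) → Fin n
  vertexAt {a} p zero = a
  vertexAt (cons f j p) (suc i) = vertexAt p i

  edgeAt : ∀ {a b} (p : Walk a b) → Fin (len' p) → Fin m
  edgeAt (cons f j p) zero = f
  edgeAt (cons f j p) (suc i) = edgeAt p i

  joinsAt : ∀ {a b} (p : Walk a b) i → Joins G (edgeAt p i) (vertexAt p (inject₁ i)) (vertexAt p (suc i))
  joinsAt (cons f j p) zero = j
  joinsAt (cons f j p) (suc i) = joinsAt p i

  vertexAt-last : ∀ {a b} (p : Walk a b) → vertexAt p (fromℕ (len' p)) ≡ b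
  vertexAt-last [] = refl
  vertexAt-last (cons f j p) = vertexAt-last p

  vertexAt-∈ : ∀ {a b} (p : Walk a b) i → vertexAt p (inject₁ i) ∈ vs p
  vertexAt-∈ (cons f j p) zero = here refl
  vertexAt-∈ (cons f j p) (suc i) = there (vertexAt-∈ p i)

  vertexAt-injective : ∀ {a b} (p : Walk a b) → Unique (vs p) → ∀ {i j} → vertexAt p (inject₁ i) ≡ vertexAt p (inject₁ j) → i ≡ j
  vertexAt-injective (cons f j p) (ne ∷ u) {zero} {zero} e = refl
  vertexAt-injective (cons f j p) (ne ∷ u) {zero} {suc i} e = ⊥-elim (All.lookup ne (vertexAt-∈ p i) e)
  vertexAt-injective (cons f j p) (ne ∷ u) {suc i} {zero} e = ⊥-elim (All.lookup ne (vertexAt-∈ p i) (sym e))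
  vertexAt-injective (cons f j p) (ne ∷ u) {suc i} {suc k} e = cong suc (vertexAt-injective p u e)

  edgeAt-cnt : ∀ {a b} (p : Walk a b) i → 0 < cnt p (edgeAt p i)
  edgeAt-cnt (cons f j p) zero = cnt>0 {j = j} {p = p}
  edgeAt-cnt (cons f j p) (suc i) = cnt-tail {j = j} p (edgeAt-cnt p i)

  cnt-edgeAt : ∀ {a b} (p : Walk a b) {f} → 0 < cnt p f → ∃ λ i → edgeAt p i ≡ f
  cnt-edgeAt (cons g j p) lt with cnt-cons⁻ {j = j} p lt
  ... | inj₁ e = zero , e
  ... | inj₂ lt' = let (i , e) = cnt-edgeAt p lt' in suc i , e

  edgeAt-injective : ∀ {a b} (p : Walk a b) → IsTrail (cnt p) → ∀ {i j} → edgeAt p i ≡ edgeAt p j → i ≡ j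
  edgeAt-injective (cons f j p) t {zero} {zero} e = refl
  edgeAt-injective (cons f j p) t {suc i} {suc k} e = cong suc (edgeAt-injective p (λ g → ℕₚ.≤-trans (ℕₚ.m≤n+m _ (δ f g)) (t g)) e)
  edgeAt-injective (cons f j p) t {zero} {suc k} e = ⊥-elim (ℕₚ.<⇒≱ (subst (λ d → 1 < d + cnt p f) (sym (δ-self f)) (s≤s (subst (λ g → 0 < cnt p g) (sym e) (edgeAt-cnt p k)))) (t f))
  edgeAt-injective (cons f j p) t {suc k} {zero} e = ⊥-elim (ℕₚ.<⇒≱ (subst (λ d → 1 < d + cnt p f) (sym (δ-self f)) (s≤s (subst (λ g → 0 < cnt p g) e (edgeAt-cnt p k)))) (t f))

  edgeSet : Closed → Fin m → Bool
  edgeSet C f = does (0 ℕ.<? cntC C f)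

  edgeSet-bit : ∀ C → IsTrail (cntC C) → ∀ f → bit (edgeSet C f) ≡ cntC C f
  edgeSet-bit C t f with cntC C f | t f
  ... | zero | _ = refl
  ... | suc zero | _ = refl
  ... | suc (suc _) | s≤s ()

  positive⁺ : ∀ c → 0 < c → does (0 ℕ.<? c) ≡ true
  positive⁺ (suc c) _ = refl

  positive⁻ : ∀ c → does (0 ℕ.<? c) ≡ true → 0 < c
  positive⁻ (suc c) _ = s≤s z≤n

  -- Oddness excludes the empty walk. At length two distinct vertices do not yet give distinct
  -- edges; the trail condition does.
  isCycle : ∀ C → Odd C → IsTrail (cntC C) → Simple C → IsCycle G (edgeSet C)
  isCycle (a , cons f j p) o t s = len' p , (λ i → vertexAt w (inject₁ i)) , edgeAt w , vertexAt-injective w s , edgeAt-injective w t , joins , members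
    where
    w = cons f j p
    -- The walk has one more vertex position than edges, and its last position is the starting
    -- vertex again; this matches the wrap-around of `next`.
    advance : ∀ i → vertexAt w (suc i) ≡ vertexAt w (inject₁ (next i))
    advance i with suc (toℕ i) ℕ.<? suc (len' p)
    ... | yes lt = cong (vertexAt w) (toℕ-injective (sym (trans (toℕ-inject₁ (fromℕ< lt)) (toℕ-fromℕ< lt))))
    ... | no ¬lt = trans (cong (vertexAt w) (toℕ-injective (trans (cong suc last) (sym (toℕ-fromℕ (suc (len' p))))))) (vertexAt-last w)
      where
      last : toℕ i ≡ len' p
      last = ℕₚ.≤-antisym (ℕₚ.≤-pred (toℕ<n i)) (ℕₚ.≤-pred (ℕₚ.≮⇒≥ ¬lt))
    joins : ∀ i → Joins G (edgeAt w i) (vertexAt w (inject₁ i)) (vertexAt w (inject₁ (next i)))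
    joins i = subst (Joins G (edgeAt w i) (vertexAt w (inject₁ i))) (advance i) (joinsAt w i)
    members : ∀ g → (edgeSet (a , w) g ≡ true) ⇔ (Σ (Fin (suc (len' p))) λ i → edgeAt w i ≡ g)
    members g = mk⇔ onCycle inSet
      where
      onCycle : edgeSet (a , w) g ≡ true → Σ (Fin (suc (len' p))) λ i → edgeAt w i ≡ g
      onCycle h = cnt-edgeAt w (positive⁻ (cnt w g) h)
      inSet : (Σ (Fin (suc (len' p))) λ i → edgeAt w i ≡ g) → edgeSet (a , w) g ≡ true
      inSet (i , refl) = positive⁺ (cnt w (edgeAt w i)) (edgeAt-cnt w i)

  isNegative : ∀ C → Odd C → IsTrail (cntC C) → IsNegative G (edgeSet C)
  isNegative C o t = par⇒%2 (countTrue (λ f → edgeSet C f ∧ neg G f)) (trans (cong par count) (trans (Par-closed C (λ _ → false)) o))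
    where
    count : countTrue (λ f → edgeSet C f ∧ neg G f) ≡ wt G (cntC C) (λ _ → false)
    count = trans (countTrue-sum (λ f → edgeSet C f ∧ neg G f)) (sumF-≡ λ f → trans (lem (edgeSet C f) (neg G f)) (cong (bit (neg (switch (λ _ → false) G) f) *_) (edgeSet-bit C t f)))
      where
      lem : ∀ s ν → bit (s ∧ ν) ≡ bit ((ν xor false) xor false) * bit s
      lem true true = refl
      lem true false = refl
      lem false true = refl
      lem false false = refl

  record SimpleOdd (C : Closed) : Set where
    field
      odd : Odd C
      isTrail : IsTrail (cntC C)
      simple : Simple C

  simplify : ∀ l → All Odd l → Σ (List Closed) λ l' → All SimpleOdd l' × length l' ≡ length l × (∀ f → total l' f ≤ total l f)
  simplify [] [] = [] , [] , refl , λ f → z≤n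
  simplify (C ∷ l) (o ∷ os) with oddTrail _ C o ℕₚ.≤-refl | simplify l os
  ... | D , oD , cD , tD | l' , ss , s , le with simpleCycle _ D oD ℕₚ.≤-refl
  ... | E , oE , sE , cE = E ∷ l' , record { odd = oE ; isTrail = λ f → ℕₚ.≤-trans (cE f) (tD f) ; simple = sE } ∷ ss , cong suc s ,
          λ f → ℕₚ.+-mono-≤ (ℕₚ.≤-trans (cE f) (cD f)) (le f)

  family : (l : List Closed) → Fin (length l) → Fin m → Bool
  family (C ∷ l) zero = edgeSet C
  family (C ∷ l) (suc i) = family l i

  family-cycles : ∀ {l} → All SimpleOdd l → ∀ i → IsCycle G (family l i) × IsNegative G (family l i)
  family-cycles {C ∷ l} (s ∷ ss) zero = isCycle C odd isTrail simple , isNegative C odd isTrail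
    where open SimpleOdd s
  family-cycles {C ∷ l} (s ∷ ss) (suc i) = family-cycles ss i

  family-count : ∀ {l} → All SimpleOdd l → ∀ f → countTrue (λ i → family l i f) ≡ total l f
  family-count {l} ss f = trans (countTrue-sum (λ i → family l i f)) (go ss)
    where
    go : ∀ {l} → All SimpleOdd l → sumF (λ i → bit (family l i f)) ≡ total l f
    go [] = refl
    go {C ∷ l} (s ∷ ss) = cong₂ _+_ (edgeSet-bit C (SimpleOdd.isTrail s) f) (go ss)

  wt-two : ∀ x → wt G (λ _ → 2) x ≡ 2 * numNeg (switch x G)
  wt-two x = trans (sumF-≡ λ f → lem (bit (neg (switch x G) f))) (trans (sumF-+ (bit ∘ neg (switch x G)) (bit ∘ neg (switch x G)))
    (trans (cong₂ _+_ (sym (countTrue-sum (neg (switch x G)))) (sym (countTrue-sum (neg (switch x G))))) (lem' (numNeg (switch x G)))))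
    where
    lem : ∀ a → a * 2 ≡ a + a
    lem = solve-∀
    lem' : ∀ a → a + a ≡ 2 * a
    lem' = solve-∀

mainTheorem17 : ∀ {n m} (G : SG n m) (k : ℕ) → Critical G k → ¬ HasK5NegMinor G
    → Σ (Fin (2 * k) → Fin m → Bool) λ C → NegCycleDoubleCover G (2 * k) C
mainTheorem17 {n} {m} G k crit noK5 = fromPack (PackingTheorem.packAll G noK5 (2 * k) (λ _ → 2) parity low)
  where
  open WalkVertices G
  open Covers G
  par-double : ∀ a → par (2 * a) ≡ false
  par-double a = trans (cong par (lem a)) (trans (par-+ a a) (xor-same (par a)))
    where
    lem : ∀ a → 2 * a ≡ a + a
    lem = solve-∀
  parity : Par (λ _ → 2) (par (2 * k))
  parity x = trans (cong par (wt-two x)) (trans (par-double (numNeg (switch x G))) (sym (par-double k)))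
  low : ∀ x → 2 * k ≤ wt G (λ _ → 2) x
  low x = subst (2 * k ≤_) (sym (wt-two x)) (ℕₚ.*-monoʳ-≤ 2 (proj₂ (frustration G crit) x))
  fromPack : Pack (2 * k) (λ _ → 2) → Σ (Fin (2 * k) → Fin m → Bool) λ C → NegCycleDoubleCover G (2 * k) C
  fromPack (pack l os size fits) with simplify l os
  ... | l' , ss , s , le = subst (λ t → Σ (Fin t → Fin m → Bool) (NegCycleDoubleCover G t)) len≡
          (family l' , family-cycles ss , λ e → trans (family-count ss e) (exact e))
    where
    len≡ : length l' ≡ 2 * k
    len≡ = trans s size
    at-most : ∀ f → total l' f ≤ 2
    at-most f = ℕₚ.≤-trans (le f) (fits f)
    -- The minimum signature through e meets every walk exactly once, so it is used to full capacity.
    exact : ∀ e → total l' e ≡ 2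
    exact e with critical-edge G crit e
    ... | x , ex , ne = ℕₚ.≤-antisym (at-most e) (ℕₚ.≮⇒≥ λ lt → ℕₚ.<⇒≱ (below lt) above)
      where
      above : 2 * k ≤ wt G (total l') x
      above = subst (_≤ wt G (total l') x) len≡ (length≤wt (All.map SimpleOdd.odd ss) x)
      below : total l' e < 2 → wt G (total l') x < 2 * k
      below lt = subst (wt G (total l') x <_) (trans (wt-two x) (cong (2 *_) ex))
        (sumF-< e (λ f → ℕₚ.*-monoʳ-≤ (bit (neg (switch x G) f)) (at-most f))
          (subst (λ b → bit b * total l' e < bit b * 2) (sym ne) (subst (_< 2) (sym (ℕₚ.+-identityʳ (total l' e))) lt)))
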